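{- Let $(u_j)_{j\ge1}$ and $(v_j)_{j\ge1}$ be sequences of complex numbers. Then for any $n\ge1$ and any $k=0,\dots,n-1$, \[\frac{(-1)^{n-1}}{(n-1)!} \sum_{\substack{ \sigma, \tau\in P(n) \\ \sigma\vee \tau=1_n \\ |\sigma|+|\tau|=n+1-k}} \mu(0_n,\sigma)\mu(0_n,\tau) u_\sigma v_\tau = (-1)^k \sum_{g=0}^{\lfloor k/2\rfloor} s_k^{(g)},\] where \[s_k^{(g)} = \sum_{\substack{\zeta \vdash n\\ \ell(\zeta) = k+1-2g}} \frac{n}{\prod_{i=1}^{\ell(\zeta)} \zeta_i \prod_{i=1}^n t_i^\zeta!} \sum_{\alpha \in S^{(g)}_{NC}[\zeta]} u_\alpha v_{\alpha^{ -1}\gamma_\zeta}.\]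
   Context: $P(n)$ is the lattice of set partitions of $\{1,\dots,n\}$ under refinement, with minimum $0_n$, maximum $1_n$, join $\vee$, $|\pi|$ the number of blocks, and Möbius function $\mu(0_n,\pi)=(-1)^{n-|\pi|}\prod_{V\in\pi}(|V|-1)!$. For a sequence $(u_j)$, $u_\pi=\prod_{V\in\pi}u_{|V|}$, and for a permutation $\alpha\in S_n$, $u_\alpha=u_{f(\alpha)}$ where $f(\alpha)\in P(n)$ is the partition into cycles (orbits) of $\alpha$; $\#(\alpha)$ is the number of cycles. For an integer partition $\zeta=[\zeta_1,\dots,\zeta_m]\vdash n$ ($\zeta_1\ge\dots\ge\zeta_m\ge1$), $\ell(\zeta)=m$ is its number of parts, $t_i^\zeta$ is the number of parts equal to $i$, and $\gamma_\zeta=(1,\dots,\zeta_1)(\zeta_1+1,\dots,\zeta_1+\zeta_2)\cdots(\zeta_1+\dots+\zeta_{m-1}+1,\dots,n)\in S_n$. For $\alpha,\gamma\in S_n$ such that the subgroup generated by $\alpha$ and $\gamma$ acts transitively on $\{1,\dots,n\}$, the genus of $\alpha$ relative to $\gamma$ is the integer $g\ge0$ with $\#(\alpha)+\#(\alpha^{ -1}\gamma)+\#(\gamma)=n+2(1-g)$ (equivalently, the minimal genus of a closed oriented surface carrying a suitable cellular embedding of the map determined by $\alpha,\gamma$). $S^{(g)}_{NC}[\zeta]$ is the set of $\alpha\in S_n$ such that the subgroup generated by $\alpha$ and $\gamma_\zeta$ acts transitively on $\{1,\dots,n\}$ and $\alpha$ has genus $g$ relative to $\gamma_\zeta$. -}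

module Defs where

open import Level using (Level)
open import Data.Bool using (Bool; true; false; _∧_; _∨_; if_then_else_)
open import Data.Nat.Base using (ℕ; zero; suc; _+_; _*_; _∸_; _≡ᵇ_; _≤ᵇ_; _!; ⌊_/2⌋)
open import Data.List.Base
  using (List; []; _∷_; _++_; [_]; map; concatMap; filterᵇ; foldr; length; upTo)
open import Data.Nat.ListAction using (product)
open import Data.Bool.ListAction using (any; all)
open import Algebra.Bundles using (CommutativeRing)

-- Elementary list / permutation machinery on {0,…,n-1}
-- (the paper's {1,…,n} is shifted to {0,…,n-1}).

nth : List ℕ → ℕ → ℕ
nth []       _       = 0
nth (x ∷ xs) zero    = x
nth (x ∷ xs) (suc i) = nth xs i

count : ℕ → List ℕ → ℕ
count a []       = 0
count a (x ∷ xs) = if a ≡ᵇ x then suc (count a xs) else count a xs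

-- A labelling b = [b(0),…,b(n-1)] (labels < n) determines the partition of
-- {0,…,n-1} into the level sets of b.  blockSizes lists |V| for its blocks V.
blockSizes : ℕ → List ℕ → List ℕ
blockSizes n b = filterᵇ (λ s → 1 ≤ᵇ s) (map (λ L → count L b) (upTo n))

numBlocks : ℕ → List ℕ → ℕ
numBlocks n b = length (blockSizes n b)

iter : {A : Set} → ℕ → (A → A) → A → A
iter zero    f a = a
iter (suc m) f a = f (iter m f a)

mem : ℕ → List ℕ → Bool
mem j S = any (λ i → j ≡ᵇ i) S

-- The lattice P(n): set partitions of {0,…,n-1}, each represented
-- uniquely by its restricted growth string b (b(0)=0 and
-- b(i) ≤ 1 + max_{j<i} b(j)); blocks = level sets of b.

rgsFrom : ℕ → ℕ → List (List ℕ)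
rgsFrom zero    m = [ [] ]
rgsFrom (suc r) m =
  concatMap (λ L → map (L ∷_) (rgsFrom r (if L ≡ᵇ m then suc m else m))) (upTo (suc m))

P : ℕ → List (List ℕ)
P n = rgsFrom n 0

-- σ ∨ τ = 1_n : the join (transitive closure of "same block of σ or same
-- block of τ") has a single block, i.e. the block of 0 in the join is all
-- of {0,…,n-1}.  The block of 0 is computed by n closure steps.
joinStep : ℕ → List ℕ → List ℕ → List ℕ → List ℕ
joinStep n σ τ S =
  filterᵇ (λ j → any (λ i → (nth σ i ≡ᵇ nth σ j) ∨ (nth τ i ≡ᵇ nth τ j)) S) (upTo n)

joinIsTop : ℕ → List ℕ → List ℕ → Bool
joinIsTop n σ τ = all (λ j → mem j (iter n (joinStep n σ τ) [ 0 ])) (upTo n)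

-- Permutations of {0,…,n-1}, as lists [α(0),…,α(n-1)].

insertEverywhere : ℕ → List ℕ → List (List ℕ)
insertEverywhere x []       = [ x ∷ [] ]
insertEverywhere x (y ∷ ys) = (x ∷ y ∷ ys) ∷ map (y ∷_) (insertEverywhere x ys)

perms : List ℕ → List (List ℕ)
perms []       = [ [] ]
perms (x ∷ xs) = concatMap (insertEverywhere x) (perms xs)

S : ℕ → List (List ℕ)
S n = perms (upTo n)

indexOf : ℕ → List ℕ → ℕ
indexOf j []       = 0
indexOf j (x ∷ xs) = if x ≡ᵇ j then 0 else suc (indexOf j xs)

invPerm : ℕ → List ℕ → List ℕ
invPerm n α = map (λ j → indexOf j α) (upTo n)

invComp : ℕ → List ℕ → List ℕ → List ℕ
invComp n α γ = map (λ i → nth (invPerm n α) (nth γ i)) (upTo n)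

minL : ℕ → List ℕ → ℕ
minL d []       = d
minL d (x ∷ xs) = let m = minL d xs in if x ≤ᵇ m then x else m

orbitMin : ℕ → List ℕ → ℕ → ℕ
orbitMin n α i = minL i (map (λ m → iter m (nth α) i) (upTo n))

cyclePartition : ℕ → List ℕ → List ℕ
cyclePartition n α = map (orbitMin n α) (upTo n)

numCycles : ℕ → List ℕ → ℕ
numCycles n α = numBlocks n (cyclePartition n α)

-- the subgroup generated by α and γ acts transitively on {0,…,n-1}
-- (the orbit of 0 under α, γ is everything)
transStep : ℕ → List ℕ → List ℕ → List ℕ → List ℕ
transStep n α γ T =
  filterᵇ (λ j → any (λ i → (j ≡ᵇ i) ∨ (nth α i ≡ᵇ j) ∨ (nth γ i ≡ᵇ j)) T) (upTo n)

transitive : ℕ → List ℕ → List ℕ → Bool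
transitive n α γ = all (λ j → mem j (iter n (transStep n α γ) [ 0 ])) (upTo n)

-- α has genus g relative to γ:  #(α)+#(α⁻¹γ)+#(γ) = n + 2(1-g)
hasGenus : ℕ → ℕ → List ℕ → List ℕ → Bool
hasGenus n g α γ =
  (numCycles n α + numCycles n (invComp n α γ) + numCycles n γ + 2 * g) ≡ᵇ (n + 2)

-- Integer partitions ζ ⊢ n : non-increasing lists of positive parts
-- summing to n.  ipf fuel m b = partitions of m with all parts ≤ b.

ipf : ℕ → ℕ → ℕ → List (List ℕ)
ipf _          zero    b = [ [] ]
ipf zero       (suc m) b = []
ipf (suc fuel) (suc m) b =
  concatMap (λ p → map (p ∷_) (ipf fuel (suc m ∸ p) p))
            (filterᵇ (λ p → p ≤ᵇ b) (map suc (upTo (suc m))))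

intPartitions : ℕ → List (List ℕ)
intPartitions n = ipf n n n

-- γ_ζ = (1,…,ζ₁)(ζ₁+1,…,ζ₁+ζ₂)⋯  (shifted to start at 0)
cycleBlock : ℕ → ℕ → List ℕ
cycleBlock s zero    = []
cycleBlock s (suc q) = map (λ i → s + suc i) (upTo q) ++ [ s ]

gammaFrom : ℕ → List ℕ → List ℕ
gammaFrom s []       = []
gammaFrom s (p ∷ ps) = cycleBlock s p ++ gammaFrom (s + p) ps

gamma : List ℕ → List ℕ
gamma ζ = gammaFrom 0 ζ

inSNC : ℕ → ℕ → List ℕ → List ℕ → Bool
inSNC n g ζ α = transitive n α (gamma ζ) ∧ hasGenus n g α (gamma ζ)

t : ℕ → List ℕ → ℕ
t i ζ = count i ζ

-- Scalars: a commutative ring R in which the positive integers are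
-- invertible (a ℚ-algebra, e.g. ℂ); `inv m` is the inverse of m·1.

module Formula {c ℓ : Level} (R : CommutativeRing c ℓ)
                (inv : ℕ → CommutativeRing.Carrier R) where
  open CommutativeRing R
    renaming (_+_ to _+R_; _*_ to _*R_; -_ to -R_)

  ι : ℕ → Carrier
  ι zero    = 0#
  ι (suc m) = 1# +R ι m

  sgn : ℕ → Carrier
  sgn zero    = 1#
  sgn (suc m) = -R (sgn m)

  sumR : List Carrier → Carrier
  sumR = foldr _+R_ 0#

  prodR : List Carrier → Carrier
  prodR = foldr _*R_ 1#

  -- μ(0_n, π) = (-1)^{n-|π|} ∏_{V∈π} (|V|-1)!
  mob : ℕ → List ℕ → Carrier
  mob n π = sgn (n ∸ numBlocks n π) *R ι (product (map (λ s → (s ∸ 1) !) (blockSizes n π)))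

  uP : (ℕ → Carrier) → ℕ → List ℕ → Carrier
  uP u n π = prodR (map u (blockSizes n π))

  uPerm : (ℕ → Carrier) → ℕ → List ℕ → Carrier
  uPerm u n α = uP u n (cyclePartition n α)

  LHS : (ℕ → Carrier) → (ℕ → Carrier) → ℕ → ℕ → Carrier
  LHS u v n k =
    sgn (n ∸ 1) *R inv ((n ∸ 1) !) *R
    sumR (concatMap (λ σ → map (λ τ →
            if joinIsTop n σ τ ∧ ((numBlocks n σ + numBlocks n τ) ≡ᵇ (n + 1 ∸ k))
            then mob n σ *R mob n τ *R uP u n σ *R uP v n τ
            else 0#) (P n)) (P n))

  coef : ℕ → List ℕ → Carrier
  coef n ζ = ι n *R inv (product ζ * product (map (λ i → (t i ζ) !) (map suc (upTo n))))

  s : (ℕ → Carrier) → (ℕ → Carrier) → ℕ → ℕ → ℕ → Carrier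
  s u v n k g =
    sumR (map (λ ζ → coef n ζ *R
                 sumR (map (λ α → uPerm u n α *R uPerm v n (invComp n α (gamma ζ)))
                           (filterᵇ (inSNC n g ζ) (S n))))
              (filterᵇ (λ ζ → length ζ ≡ᵇ (k + 1 ∸ 2 * g)) (intPartitions n)))

  RHS : (ℕ → Carrier) → (ℕ → Carrier) → ℕ → ℕ → Carrier
  RHS u v n k = sgn k *R sumR (map (s u v n k) (upTo (suc ⌊ k /2⌋)))

{-# OPTIONS --safe #-}
module Submission where

-- Since ∏ (|V|-1)! counts the permutations with cycle partition σ, the left side is (-1)^k / (n-1)! times the sum of
-- u_α v_β over the pairs of permutations generating a transitive group with #(α) + #(β) = n + 1 - k. Put γ = αβ.
-- The Riemann–Hurwitz relation #(α) + #(β) + #(γ) + 2g = n + 2, with g ≥ 0, makes #(γ) = k + 1 - 2g; it is proved by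
-- building β up from transpositions, each of which changes #(αβ) by ±1. The inner sum over α depends only on the
-- conjugacy class of γ, so it may be evaluated at γ_ζ, and the class of type ζ has n! / (∏ ζ_i ∏ t_i!) elements.
--
-- Both the count of permutations by cycle partition and the class sizes come from one recursion: a permutation of
-- {0,…,n} is obtained from one of {0,…,n-1} by inserting n behind some j in its cycle or as a fixed point.

open import Defs
open import Level using (Level)
open import Algebra.Bundles using (CommutativeRing; CommutativeSemiring)
open import Data.Bool.Base using (Bool; true; false; _∧_; _∨_; if_then_else_; T)
open import Data.Bool.ListAction using (any; all)
open import Data.Bool.Properties using (T-∧; T-∨; T?)
open import Data.Empty using (⊥-elim)
open import Data.Fin.Base using (Fin; toℕ; fromℕ<)
import Data.Fin.Properties as Fin
open import Data.List.Base
  using (List; []; _∷_; _++_; [_]; map; concat; concatMap; filterᵇ; foldr; length; upTo; applyUpTo)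
open import Data.List.Properties
  using ( length-map; length-upTo; length-++; length-filter; map-cong; map-∘; map-++; map-id; map-upTo; upTo-∷ʳ
        ; ++-assoc; ++-identityʳ; concat-++; ≡-dec; ∷-injective)
open import Data.List.Membership.Propositional using (_∈_; _∉_)
open import Data.List.Membership.Propositional.Properties
  using ( ∈-map⁺; ∈-map⁻; ∈-++⁺ˡ; ∈-++⁺ʳ; ∈-++⁻; ∈-upTo⁺; ∈-upTo⁻; ∈-filter⁺; ∈-filter⁻
        ; ∈-∃++; ∈-concat⁺′; ∈-concat⁻′)
open import Data.List.Membership.Propositional.Properties.WithK using (unique∧set⇒bag)
open import Data.List.Relation.Binary.BagAndSetEquality using (∼bag⇒↭)
open import Data.List.Relation.Binary.Equality.Propositional using (≋⇒≡)
open import Data.List.Relation.Binary.Permutation.Propositional as Perm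
  using (_↭_; ↭-refl; ↭-sym; ↭-trans; prep; swap; ↭-reflexive)
open import Data.List.Relation.Binary.Permutation.Propositional.Properties
  using (∈-resp-↭; All-resp-↭; ↭-length; drop-∷; drop-mid; shift; ∷↭∷ʳ; ↭-map-inv; ++⁺ˡ; ++⁺ʳ; ++-comm)
  renaming (map⁺ to ↭-map⁺; ++⁺ to ↭-++⁺)
open import Data.List.Relation.Unary.All as All using (All; []; _∷_)
open import Data.List.Relation.Unary.All.Properties using () renaming (map⁺ to All-map⁺; ++⁺ to All-++)
open import Data.List.Relation.Unary.AllPairs using ([]; _∷_)
open import Data.List.Relation.Unary.Any using (here; there)
open import Data.List.Relation.Unary.Linked using (Linked; []; [-]; _∷_)
open import Data.List.Relation.Unary.Sorted.TotalOrder.Properties using (↗↭↗⇒≋)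
open import Data.List.Relation.Unary.Unique.Propositional using (Unique)
import Data.List.Relation.Unary.Unique.Propositional.Properties as Uniq
open import Data.Nat.Base
open import Data.Nat.DivMod using (_/_; _%_; m≡m%n+[m/n]*n; m%n<n)
open import Data.Nat.ListAction using (sum; product)
open import Data.Nat.ListAction.Properties using (sum-↭; sum-++; product-↭; product≢0)
open import Data.Nat.Properties
open import Data.List.Membership.DecPropositional _≟_ using (_∈?_)
open import Data.Nat.Solver using (module +-*-Solver)
open import Data.Product.Base using (∃; _×_; _,_; proj₁; proj₂)
open import Data.Sum.Base using (_⊎_; inj₁; inj₂)
open import Function.Base using (_∘_; id)
open import Function.Bundles using (_⇔_; mk⇔; Equivalence)
open import Relation.Binary.Bundles using (DecTotalOrder)
import Relation.Binary.Construct.Flip.EqAndOrd as Flip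
open import Relation.Binary.PropositionalEquality
  using (_≡_; _≢_; refl; sym; trans; cong; cong₂; subst; subst₂; module ≡-Reasoning)
open import Relation.Nullary.Decidable.Core using (Dec; yes; no; isYes; toWitness; fromWitness)
open import Relation.Nullary.Negation.Core using (¬_)
open import Data.List.Sort (Flip.decTotalOrder ≤-decTotalOrder) using (sort; sort-↭; sort-↗)
open +-*-Solver using (solve; _:+_; _:*_; con; _:=_)
open Equivalence using () renaming (to to ⇒; from to ⇐)

-- Lists and finite sums

-- The codes serve both inductions because a new entry multiplies on the right by a transposition
-- whose larger point is still fixed. For the counts the entries range freely, so a sum over
-- permutations becomes an iterated sum. For the genus every nontrivial factor merges two cycles of
-- β, and only the cycles of αβ and the orbits of the group need a case distinction. The products
-- met on the way need not act transitively, so the relation is proved with n + 2r on the right,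
-- where r is the number of classes of a labelling invariant under α and β; r = 1 is inserted at the
-- end. The other obstacle is that one notion occurs in several encodings: orbit minima, restricted
-- growth strings and merged labels for the cycle partition, two closure computations for
-- transitivity. They are compared through two properties free of any encoding, `OrbLab` and
-- `Transitive`. Class sizes enter as an identity without division, and inverses are cancelled only
-- when the coefficient n / (∏ ζ_i ∏ t_i!) is formed.

T⇒≡ : ∀ {b} → T b → b ≡ true
T⇒≡ {true} _ = refl

¬T⇒≡ : ∀ {b} → ¬ T b → b ≡ false
¬T⇒≡ {true} ¬b = ⊥-elim (¬b _)
¬T⇒≡ {false} ¬b = refl

bool-ext : ∀ {a b} → (T a → T b) → (T b → T a) → a ≡ b
bool-ext {true}  {true}  f g = refl
bool-ext {true}  {false} f g = ⊥-elim (f _)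
bool-ext {false} {true}  f g = ⊥-elim (g _)
bool-ext {false} {false} f g = refl

eqᵇ-cong : ∀ {a b c d} → (a ≡ b → c ≡ d) → (c ≡ d → a ≡ b) → (a ≡ᵇ b) ≡ (c ≡ᵇ d)
eqᵇ-cong {a} {b} {c} {d} f g =
  bool-ext (λ h → ≡⇒≡ᵇ c d (f (≡ᵇ⇒≡ a b h))) (λ h → ≡⇒≡ᵇ a b (g (≡ᵇ⇒≡ c d h)))

eqᵇ-true : ∀ {a b} → a ≡ b → (a ≡ᵇ b) ≡ true
eqᵇ-true {a} {b} e = T⇒≡ (≡⇒≡ᵇ a b e)

eqᵇ-false : ∀ {a b} → a ≢ b → (a ≡ᵇ b) ≡ false
eqᵇ-false {a} {b} ne = ¬T⇒≡ (ne ∘ ≡ᵇ⇒≡ a b)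

module _ {A : Set} where

  all⇒∀ : (p : A → Bool) (xs : List A) → T (all p xs) → ∀ {x} → x ∈ xs → T (p x)
  all⇒∀ p (x ∷ xs) h (here refl) = proj₁ (⇒ T-∧ h)
  all⇒∀ p (x ∷ xs) h (there m) = all⇒∀ p xs (proj₂ (⇒ T-∧ h)) m

  ∀⇒all : (p : A → Bool) (xs : List A) → (∀ {x} → x ∈ xs → T (p x)) → T (all p xs)
  ∀⇒all p [] h = _
  ∀⇒all p (x ∷ xs) h = ⇐ T-∧ (h (here refl) , ∀⇒all p xs (h ∘ there))

  any⇒∃ : (p : A → Bool) (xs : List A) → T (any p xs) → ∃ λ x → x ∈ xs × T (p x)
  any⇒∃ p (x ∷ xs) h with ⇒ (T-∨ {p x}) h
  ... | inj₁ px = x , here refl , px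
  ... | inj₂ h′ = let (y , m , py) = any⇒∃ p xs h′ in y , there m , py

  ∃⇒any : (p : A → Bool) {xs : List A} {x : A} → x ∈ xs → T (p x) → T (any p xs)
  ∃⇒any p {x ∷ xs} (here refl) px = ⇐ (T-∨ {p x}) (inj₁ px)
  ∃⇒any p {x ∷ xs} (there m) px = ⇐ (T-∨ {p x}) (inj₂ (∃⇒any p m px))

  ∈-filterᵇ⁺ : (p : A → Bool) {xs : List A} {x : A} → x ∈ xs → T (p x) → x ∈ filterᵇ p xs
  ∈-filterᵇ⁺ p = ∈-filter⁺ (T? ∘ p)

  ∈-filterᵇ⁻ : (p : A → Bool) {xs : List A} {x : A} → x ∈ filterᵇ p xs → x ∈ xs × T (p x)
  ∈-filterᵇ⁻ p = ∈-filter⁻ (T? ∘ p)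

  -- Bijections reach the sums and the block counts through this lemma: the lists involved have no
  -- repetitions, so equality as sets already gives a rearrangement.
  unique-set⇒↭ : {xs ys : List A} → Unique xs → Unique ys →
                 (∀ {x} → x ∈ xs → x ∈ ys) → (∀ {x} → x ∈ ys → x ∈ xs) → xs ↭ ys
  unique-set⇒↭ ux uy f g = ∼bag⇒↭ (unique∧set⇒bag ux uy (mk⇔ f g))

  unique-resp-↭ : {xs ys : List A} → xs ↭ ys → Unique xs → Unique ys
  unique-resp-↭ Perm.refl u = u
  unique-resp-↭ (prep x p) (a ∷ u) = All-resp-↭ p a ∷ unique-resp-↭ p u
  unique-resp-↭ (swap x y p) ((xy ∷ ax) ∷ ay ∷ u) =
    ((xy ∘ sym) ∷ All-resp-↭ p ay) ∷ All-resp-↭ p ax ∷ unique-resp-↭ p u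
  unique-resp-↭ (Perm.trans p q) u = unique-resp-↭ q (unique-resp-↭ p u)

  unique-∷ : {x : A} {xs : List A} → x ∉ xs → Unique xs → Unique (x ∷ xs)
  unique-∷ x∉ u = All.tabulate (λ {y} m e → x∉ (subst (_∈ _) (sym e) m)) ∷ u

  unique-head : {x : A} {xs : List A} → Unique (x ∷ xs) → x ∉ xs
  unique-head (a ∷ _) m = All.lookup a m refl

module _ {A B : Set} where

  unique-map-on : (f : A → B) {xs : List A} → (∀ {x y} → x ∈ xs → y ∈ xs → f x ≡ f y → x ≡ y) →
                  Unique xs → Unique (map f xs)
  unique-map-on f inj [] = []
  unique-map-on f {x ∷ xs} inj (a ∷ u) = unique-∷
    (λ m → let (y , y∈ , e) = ∈-map⁻ f m in unique-head (a ∷ u) (subst (_∈ xs) (sym (inj (here refl) (there y∈) e)) y∈))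
    (unique-map-on f (λ p q → inj (there p) (there q)) u)

  ∈-concatMap-intro : (f : A → List B) {xs : List A} {x : A} {z : B} → x ∈ xs → z ∈ f x → z ∈ concatMap f xs
  ∈-concatMap-intro f x∈ z∈ = ∈-concat⁺′ z∈ (∈-map⁺ f x∈)

  ∈-concatMap-elim : (f : A → List B) (xs : List A) {z : B} → z ∈ concatMap f xs → ∃ λ x → x ∈ xs × z ∈ f x
  ∈-concatMap-elim f xs m with ∈-concat⁻′ (map f xs) m
  ... | ys , z∈ , ys∈ with ∈-map⁻ f ys∈
  ... | x , x∈ , refl = x , x∈ , z∈

  unique-concatMap : (f : A → List B) {xs : List A} → Unique xs → (∀ {x} → x ∈ xs → Unique (f x)) →
                     (∀ {x y z} → x ∈ xs → y ∈ xs → z ∈ f x → z ∈ f y → x ≡ y) → Unique (concatMap f xs)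
  unique-concatMap f [] uf dis = []
  unique-concatMap f {x ∷ xs} (a ∷ u) uf dis = Uniq.++⁺ (uf (here refl))
    (unique-concatMap f u (uf ∘ there) (λ p q → dis (there p) (there q)))
    λ { (z∈ , z∈′) → let (y , y∈ , z∈y) = ∈-concatMap-elim f xs z∈′ in
        unique-head (a ∷ u) (subst (_∈ xs) (sym (dis (here refl) (there y∈) z∈ z∈y)) y∈) }

mem⇒∈ : ∀ j xs → T (mem j xs) → j ∈ xs
mem⇒∈ j xs h with any⇒∃ (j ≡ᵇ_) xs h
... | x , x∈ , e rewrite ≡ᵇ⇒≡ j x e = x∈

∈⇒mem : ∀ {j xs} → j ∈ xs → T (mem j xs)
∈⇒mem {j} m = ∃⇒any (j ≡ᵇ_) m (≡⇒≡ᵇ j j refl)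

-- Functions on {0,...,n-1} as lists

tab : ℕ → (ℕ → ℕ) → List ℕ
tab n f = map f (upTo n)

length-tab : ∀ n f → length (tab n f) ≡ n
length-tab n f = trans (length-map f (upTo n)) (length-upTo n)

nth-∈ : ∀ xs {i} → i < length xs → nth xs i ∈ xs
nth-∈ (x ∷ xs) {zero} _ = here refl
nth-∈ (x ∷ xs) {suc i} (s≤s h) = there (nth-∈ xs h)

nth-map : ∀ (f : ℕ → ℕ) xs {i} → i < length xs → nth (map f xs) i ≡ f (nth xs i)
nth-map f (x ∷ xs) {zero} _ = refl
nth-map f (x ∷ xs) {suc i} (s≤s h) = nth-map f xs h

nth-++ˡ : ∀ xs ys {i} → i < length xs → nth (xs ++ ys) i ≡ nth xs i
nth-++ˡ (x ∷ xs) ys {zero} _ = refl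
nth-++ˡ (x ∷ xs) ys {suc i} (s≤s h) = nth-++ˡ xs ys h

nth-++ʳ : ∀ xs ys i → nth (xs ++ ys) (length xs + i) ≡ nth ys i
nth-++ʳ [] ys i = refl
nth-++ʳ (x ∷ xs) ys i = nth-++ʳ xs ys i

nth-snoc : ∀ xs y → nth (xs ++ [ y ]) (length xs) ≡ y
nth-snoc [] y = refl
nth-snoc (x ∷ xs) y = nth-snoc xs y

nth-upTo : ∀ n {i} → i < n → nth (upTo n) i ≡ i
nth-upTo n {i} h = go n i id h
  where
  go : ∀ n i (f : ℕ → ℕ) → i < n → nth (applyUpTo f n) i ≡ f i
  go (suc n) zero f _ = refl
  go (suc n) (suc i) f (s≤s h) = go n i (f ∘ suc) h

nth-tab : ∀ n f {i} → i < n → nth (tab n f) i ≡ f i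
nth-tab n f h = trans (nth-map f (upTo n) (subst (_ <_) (sym (length-upTo n)) h)) (cong f (nth-upTo n h))

map-cong-∈ : {A B : Set} {f g : A → B} (xs : List A) → (∀ {x} → x ∈ xs → f x ≡ g x) → map f xs ≡ map g xs
map-cong-∈ [] h = refl
map-cong-∈ (x ∷ xs) h = cong₂ _∷_ (h (here refl)) (map-cong-∈ xs (h ∘ there))

tab-cong : ∀ {n f g} → (∀ {i} → i < n → f i ≡ g i) → tab n f ≡ tab n g
tab-cong {n} h = map-cong-∈ (upTo n) (h ∘ ∈-upTo⁻)

tab-nth : ∀ xs → tab (length xs) (nth xs) ≡ xs
tab-nth xs = go xs
  where
  go : ∀ xs → map (nth xs) (upTo (length xs)) ≡ xs
  go [] = refl
  go (x ∷ xs) = cong (x ∷_) (trans (cong (map (nth (x ∷ xs))) (sym (map-suc (length xs))))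
      (trans (sym (map-∘ (upTo (length xs)))) (go xs)))
    where
    map-suc : ∀ n → map suc (upTo n) ≡ applyUpTo suc n
    map-suc n = map-upTo suc n

tab-nth′ : ∀ {n xs} → length xs ≡ n → xs ≡ tab n (nth xs)
tab-nth′ {_} {xs} refl = sym (tab-nth xs)

indexOf-∈ : ∀ {x xs} → x ∈ xs → indexOf x xs < length xs × nth xs (indexOf x xs) ≡ x
indexOf-∈ {x} {y ∷ ys} m with y ≡ᵇ x in e
... | true = s≤s z≤n , ≡ᵇ⇒≡ y x (subst T (sym e) _)
... | false with m
...   | here refl = ⊥-elim (subst T e (≡⇒≡ᵇ x x refl))
...   | there m′ = let (a , b) = indexOf-∈ m′ in s≤s a , b

nth-inj : ∀ {xs} → Unique xs → ∀ {i j} → i < length xs → j < length xs → nth xs i ≡ nth xs j → i ≡ j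
nth-inj {x ∷ xs} u {zero} {zero} p q e = refl
nth-inj {x ∷ xs} u {zero} {suc j} p (s≤s q) e = ⊥-elim (unique-head u (subst (_∈ xs) (sym e) (nth-∈ xs q)))
nth-inj {x ∷ xs} u {suc i} {zero} (s≤s p) q e = ⊥-elim (unique-head u (subst (_∈ xs) e (nth-∈ xs p)))
nth-inj {x ∷ xs} (_ ∷ u) {suc i} {suc j} (s≤s p) (s≤s q) e = cong suc (nth-inj u p q e)

indexOf-nth : ∀ {xs} → Unique xs → ∀ {i} → i < length xs → indexOf (nth xs i) xs ≡ i
indexOf-nth {xs} u h = let (a , b) = indexOf-∈ (nth-∈ xs h) in nth-inj u a h b

-- Finite sums over lists in a commutative semiring

module Sums {c ℓ} (R : CommutativeSemiring c ℓ) where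
  private module R = CommutativeSemiring R
  open R using (_≈_; 0#; 1#)
    renaming (Carrier to C; _+_ to _⊕_; _*_ to _⊛_; refl to ≈-refl; sym to ≈-sym; trans to ≈-trans)
  open import Algebra.Properties.CommutativeSemigroup R.+-commutativeSemigroup using (interchange)

  ∑ : {A : Set} → List A → (A → C) → C
  ∑ xs F = foldr _⊕_ 0# (map F xs)

  when : Bool → C → C
  when b x = if b then x else 0#

  module _ {A : Set} where

    ∑-cong : ∀ (xs : List A) {F G : A → C} → (∀ {x} → x ∈ xs → F x ≈ G x) → ∑ xs F ≈ ∑ xs G
    ∑-cong [] h = ≈-refl
    ∑-cong (x ∷ xs) h = R.+-cong (h (here refl)) (∑-cong xs (h ∘ there))

    ∑-++ : ∀ (xs ys : List A) {F : A → C} → ∑ (xs ++ ys) F ≈ ∑ xs F ⊕ ∑ ys F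
    ∑-++ [] ys = ≈-sym (R.+-identityˡ _)
    ∑-++ (x ∷ xs) ys = ≈-trans (R.+-congˡ (∑-++ xs ys)) (≈-sym (R.+-assoc _ _ _))

    ∑-zero : ∀ (xs : List A) → ∑ xs (λ _ → 0#) ≈ 0#
    ∑-zero [] = ≈-refl
    ∑-zero (x ∷ xs) = ≈-trans (R.+-identityˡ _) (∑-zero xs)

    ∑-+ : ∀ (xs : List A) {F G : A → C} → ∑ xs (λ x → F x ⊕ G x) ≈ ∑ xs F ⊕ ∑ xs G
    ∑-+ [] = ≈-sym (R.+-identityˡ _)
    ∑-+ (x ∷ xs) = ≈-trans (R.+-congˡ (∑-+ xs)) (interchange _ _ _ _)

    ∑-*ˡ : ∀ (xs : List A) a {F : A → C} → ∑ xs (λ x → a ⊛ F x) ≈ a ⊛ ∑ xs F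
    ∑-*ˡ [] a = ≈-sym (R.zeroʳ a)
    ∑-*ˡ (x ∷ xs) a = ≈-trans (R.+-congˡ (∑-*ˡ xs a)) (≈-sym (R.distribˡ a _ _))

    ∑-*ʳ : ∀ (xs : List A) a {F : A → C} → ∑ xs (λ x → F x ⊛ a) ≈ ∑ xs F ⊛ a
    ∑-*ʳ xs a = ≈-trans (∑-cong xs (λ _ → R.*-comm _ a)) (≈-trans (∑-*ˡ xs a) (R.*-comm a _))

    ∑-↭ : ∀ {xs ys : List A} {F : A → C} → xs ↭ ys → ∑ xs F ≈ ∑ ys F
    ∑-↭ Perm.refl = ≈-refl
    ∑-↭ (prep x p) = R.+-congˡ (∑-↭ p)
    ∑-↭ (swap x y p) = ≈-trans (≈-sym (R.+-assoc _ _ _)) (≈-trans (R.+-congʳ (R.+-comm _ _))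
      (≈-trans (R.+-assoc _ _ _) (R.+-congˡ (R.+-congˡ (∑-↭ p)))))
    ∑-↭ (Perm.trans p q) = ≈-trans (∑-↭ p) (∑-↭ q)

    ∑-filter : ∀ (p : A → Bool) xs {F : A → C} → ∑ (filterᵇ p xs) F ≈ ∑ xs (λ x → when (p x) (F x))
    ∑-filter p [] = ≈-refl
    ∑-filter p (x ∷ xs) with p x
    ... | true = R.+-congˡ (∑-filter p xs)
    ... | false = ≈-trans (∑-filter p xs) (≈-sym (R.+-identityˡ _))

  ∑-map : {A B : Set} (f : A → B) (xs : List A) {F : B → C} → ∑ (map f xs) F ≡ ∑ xs (F ∘ f)
  ∑-map f xs = cong (foldr _⊕_ 0#) (sym (map-∘ xs))

  ∑-concatMap : {A B : Set} (f : A → List B) (xs : List A) {F : B → C} →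
                ∑ (concatMap f xs) F ≈ ∑ xs (λ x → ∑ (f x) F)
  ∑-concatMap f [] = ≈-refl
  ∑-concatMap f (x ∷ xs) = ≈-trans (∑-++ (f x) (concatMap f xs)) (R.+-congˡ (∑-concatMap f xs))

  ∑-swap : {A B : Set} (xs : List A) (ys : List B) {F : A → B → C} →
           ∑ xs (λ x → ∑ ys (F x)) ≈ ∑ ys (λ y → ∑ xs (λ x → F x y))
  ∑-swap [] ys = ≈-sym (∑-zero ys)
  ∑-swap (x ∷ xs) ys = ≈-trans (R.+-congˡ (∑-swap xs ys)) (≈-sym (∑-+ ys))

  when-cong : ∀ {b b′ x y} → b ≡ b′ → (T b → x ≈ y) → when b x ≈ when b′ y
  when-cong {true} refl h = h _
  when-cong {false} refl h = ≈-refl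

  when-true : ∀ {b x} → T b → when b x ≈ x
  when-true {true} _ = ≈-refl

  when-false : ∀ {b x} → ¬ T b → when b x ≈ 0#
  when-false {true} h = ⊥-elim (h _)
  when-false {false} h = ≈-refl

  when-*ˡ : ∀ b {a x} → a ⊛ when b x ≈ when b (a ⊛ x)
  when-*ˡ true = ≈-refl
  when-*ˡ false = R.zeroʳ _

  when-∑ : {A : Set} → ∀ b (xs : List A) {F : A → C} → when b (∑ xs F) ≈ ∑ xs (λ x → when b (F x))
  when-∑ true xs = ≈-refl
  when-∑ false xs = ≈-sym (∑-zero xs)

  -- Introduces a parameter that a term determines, such as the genus of a factorisation or the
  -- cycle type of a permutation.
  ∑-delta : {A : Set} (xs : List A) (b : A → Bool) {F : A → C} (x₀ : A) → Unique xs → x₀ ∈ xs →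
            (∀ {x} → x ∈ xs → T (b x) → x ≡ x₀) → T (b x₀) → ∑ xs (λ x → when (b x) (F x)) ≈ F x₀
  ∑-delta (x ∷ xs) b {F} x₀ u (here refl) h t = ≈-trans (R.+-cong (when-true t)
    (≈-trans (∑-cong xs (λ {y} m → when-false (λ ty → unique-head u (subst (_∈ xs) (h (there m) ty) m)))) (∑-zero xs)))
    (R.+-identityʳ _)
  ∑-delta (x ∷ xs) b {F} x₀ u@(_ ∷ u′) (there m) h t = ≈-trans (R.+-cong
    (when-false (λ tx → unique-head u (subst (_∈ xs) (sym (h (here refl) tx)) m)))
    (∑-delta xs b x₀ u′ m (h ∘ there) t)) (R.+-identityˡ _)

  ∑-reindex : {A : Set} (xs : List A) (φ ψ : A → A) {F : A → C} → Unique xs →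
              (∀ {x} → x ∈ xs → φ x ∈ xs) → (∀ {x} → x ∈ xs → ψ x ∈ xs) →
              (∀ {x} → x ∈ xs → ψ (φ x) ≡ x) → (∀ {x} → x ∈ xs → φ (ψ x) ≡ x) →
              ∑ xs (F ∘ φ) ≈ ∑ xs F
  ∑-reindex xs φ ψ {F} u φ∈ ψ∈ ψφ φψ = ≈-trans (R.reflexive (sym (∑-map φ xs))) (∑-↭
    (unique-set⇒↭ (unique-map-on φ (λ p q e → trans (sym (ψφ p)) (trans (cong ψ e) (ψφ q))) u) u
      (λ m → let (y , y∈ , e) = ∈-map⁻ φ m in subst (_∈ xs) (sym e) (φ∈ y∈))
      (λ m → subst (_∈ map φ xs) (φψ m) (∈-map⁺ φ (ψ∈ m)))))

-- Permutations and their codes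

-- Functions on all of ℕ, with values beyond `n` left free, so that they compose without bound
-- proofs inside the terms. The inverse is part of the data, which makes conjugation immediate.
record IsPerm (n : ℕ) (π : ℕ → ℕ) : Set where
  field
    inv   : ℕ → ℕ
    π<    : ∀ {x} → x < n → π x < n
    inv<  : ∀ {x} → x < n → inv x < n
    inv-π : ∀ {x} → x < n → inv (π x) ≡ x
    π-inv : ∀ {x} → x < n → π (inv x) ≡ x

  inj : ∀ {x y} → x < n → y < n → π x ≡ π y → x ≡ y
  inj p q e = trans (sym (inv-π p)) (trans (cong inv e) (inv-π q))

open IsPerm

inverse : ∀ {n π} (p : IsPerm n π) → IsPerm n (inv p)
inverse {π = π} p = record { inv = π ; π< = inv< p ; inv< = π< p ; inv-π = π-inv p ; π-inv = inv-π p }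

compose : ∀ {n π ρ} → IsPerm n π → IsPerm n ρ → IsPerm n (π ∘ ρ)
compose {n} {π} {ρ} p q = record
  { inv = inv q ∘ inv p ; π< = π< p ∘ π< q ; inv< = inv< q ∘ inv< p
  ; inv-π = λ h → trans (cong (inv q) (inv-π p (π< q h))) (inv-π q h)
  ; π-inv = λ h → trans (cong π (π-inv q (inv< p h))) (π-inv p h) }

isPerm-cong : ∀ {n π ρ} → (∀ {x} → x < n → π x ≡ ρ x) → IsPerm n π → IsPerm n ρ
isPerm-cong h p = record
  { inv = inv p ; π< = λ q → subst (_< _) (h q) (π< p q) ; inv< = inv< p
  ; inv-π = λ q → trans (cong (inv p) (sym (h q))) (inv-π p q)
  ; π-inv = λ q → trans (sym (h (inv< p q))) (π-inv p q) }

∈-insertEverywhere : ∀ x l₁ l₂ → l₁ ++ x ∷ l₂ ∈ insertEverywhere x (l₁ ++ l₂)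
∈-insertEverywhere x [] [] = here refl
∈-insertEverywhere x [] (y ∷ l₂) = here refl
∈-insertEverywhere x (y ∷ l₁) l₂ = there (∈-map⁺ (y ∷_) (∈-insertEverywhere x l₁ l₂))

insertEverywhere-elim : ∀ x ys {l} → l ∈ insertEverywhere x ys →
  ∃ λ l₁ → ∃ λ l₂ → l ≡ l₁ ++ x ∷ l₂ × ys ≡ l₁ ++ l₂
insertEverywhere-elim x [] (here refl) = [] , [] , refl , refl
insertEverywhere-elim x (y ∷ ys) (here refl) = [] , y ∷ ys , refl , refl
insertEverywhere-elim x (y ∷ ys) (there m) with ∈-map⁻ (y ∷_) m
... | l , l∈ , refl with insertEverywhere-elim x ys l∈
... | l₁ , l₂ , refl , refl = y ∷ l₁ , l₂ , refl , refl

insertEverywhere-unique : ∀ x ys → x ∉ ys → Unique (insertEverywhere x ys)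
insertEverywhere-unique x [] x∉ = [] ∷ []
insertEverywhere-unique x (y ∷ ys) x∉ = unique-∷
  (λ m → let (l , _ , e) = ∈-map⁻ (y ∷_) m in x∉ (here (proj₁ (∷-injective e))))
  (Uniq.map⁺ (proj₂ ∘ ∷-injective) (insertEverywhere-unique x ys (x∉ ∘ there)))

-- As `x` occurs in neither prefix, its position in the word is determined. This keeps insertions
-- into different words apart in `perms-unique`.
insert-cancel : ∀ {x : ℕ} l₁ {l₂} m₁ {m₂} → x ∉ l₁ → x ∉ m₁ → l₁ ++ x ∷ l₂ ≡ m₁ ++ x ∷ m₂ → l₁ ++ l₂ ≡ m₁ ++ m₂
insert-cancel [] [] p q refl = refl
insert-cancel [] (y ∷ m₁) p q e = ⊥-elim (q (here (proj₁ (∷-injective e))))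
insert-cancel (y ∷ l₁) [] p q e = ⊥-elim (p (here (sym (proj₁ (∷-injective e)))))
insert-cancel (y ∷ l₁) (z ∷ m₁) p q e =
  cong₂ _∷_ (proj₁ (∷-injective e)) (insert-cancel l₁ m₁ (p ∘ there) (q ∘ there) (proj₂ (∷-injective e)))

∈perms⇒↭ : ∀ xs {l} → l ∈ perms xs → l ↭ xs
∈perms⇒↭ [] (here refl) = ↭-refl
∈perms⇒↭ (x ∷ xs) m with ∈-concatMap-elim (insertEverywhere x) (perms xs) m
... | ys , ys∈ , l∈ with insertEverywhere-elim x ys l∈
... | l₁ , l₂ , refl , refl = ↭-trans (shift x l₁ l₂) (prep x (∈perms⇒↭ xs ys∈))

↭⇒∈perms : ∀ xs {l} → l ↭ xs → l ∈ perms xs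
↭⇒∈perms [] p with ↭-length p
↭⇒∈perms [] {[]} p | _ = here refl
↭⇒∈perms (x ∷ xs) p with ∈-∃++ (∈-resp-↭ (↭-sym p) (here refl))
... | l₁ , l₂ , refl = ∈-concatMap-intro (insertEverywhere x)
  (↭⇒∈perms xs (drop-mid l₁ [] p)) (∈-insertEverywhere x l₁ l₂)

perms-unique : ∀ {xs} → Unique xs → Unique (perms xs)
perms-unique {[]} u = [] ∷ []
perms-unique {x ∷ xs} u@(_ ∷ u′) = unique-concatMap (insertEverywhere x) (perms-unique u′)
  (λ m → insertEverywhere-unique x _ (x∉ m)) sep
  where
  x∉ : ∀ {ys} → ys ∈ perms xs → x ∉ ys
  x∉ m h = unique-head u (∈-resp-↭ (∈perms⇒↭ xs m) h)
  sep : ∀ {ys zs l} → ys ∈ perms xs → zs ∈ perms xs → l ∈ insertEverywhere x ys → l ∈ insertEverywhere x zs → ys ≡ zs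
  sep {ys} {zs} p q m m′ with insertEverywhere-elim x ys m | insertEverywhere-elim x zs m′
  ... | l₁ , l₂ , refl , refl | m₁ , m₂ , e , refl =
    insert-cancel l₁ m₁ (x∉ p ∘ ∈-++⁺ˡ) (x∉ q ∘ ∈-++⁺ˡ) e

S-unique : ∀ n → Unique (S n)
S-unique n = perms-unique (Uniq.upTo⁺ n)

S-length : ∀ n {α} → α ∈ S n → length α ≡ n
S-length n m = trans (↭-length (∈perms⇒↭ (upTo n) m)) (length-upTo n)

S-tab : ∀ n {α} → α ∈ S n → α ≡ tab n (nth α)
S-tab n m = tab-nth′ (S-length n m)

↭⇒isPerm : ∀ {n α} → α ↭ upTo n → IsPerm n (nth α)
↭⇒isPerm {n} {α} p = record
  { inv = λ j → indexOf j α
  ; π<  = λ h → ∈-upTo⁻ (∈-resp-↭ p (nth-∈ α (l h)))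
  ; inv< = λ h → subst (_ <_) len (proj₁ (ix h))
  ; inv-π = λ h → indexOf-nth (unique-resp-↭ (↭-sym p) (Uniq.upTo⁺ n)) (l h)
  ; π-inv = λ h → proj₂ (ix h) }
  where
  len : length α ≡ n
  len = trans (↭-length p) (length-upTo n)
  l : ∀ {x} → x < n → x < length α
  l = subst (_ <_) (sym len)
  ix : ∀ {x} → x < n → indexOf x α < length α × nth α (indexOf x α) ≡ x
  ix h = indexOf-∈ (∈-resp-↭ (↭-sym p) (∈-upTo⁺ h))

∈S⇒isPerm : ∀ n {α} → α ∈ S n → IsPerm n (nth α)
∈S⇒isPerm n m = ↭⇒isPerm (∈perms⇒↭ (upTo n) m)

tab-↭ : ∀ {n π} → IsPerm n π → tab n π ↭ upTo n
tab-↭ {n} {π} p = unique-set⇒↭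
  (unique-map-on π (λ a b → inj p (∈-upTo⁻ a) (∈-upTo⁻ b)) (Uniq.upTo⁺ n)) (Uniq.upTo⁺ n)
  (λ m → let (y , y∈ , e) = ∈-map⁻ π m in subst (_∈ upTo n) (sym e) (∈-upTo⁺ (π< p (∈-upTo⁻ y∈))))
  (λ m → subst (_∈ tab n π) (π-inv p (∈-upTo⁻ m)) (∈-map⁺ π (∈-upTo⁺ (inv< p (∈-upTo⁻ m)))))

tab∈S : ∀ {n π} → IsPerm n π → tab n π ∈ S n
tab∈S {n} p = ↭⇒∈perms (upTo n) (tab-↭ p)

invComp-tab : ∀ n {α} γ (a : α ∈ S n) → IsPerm n (nth γ) →
              ∀ {i} → i < n → nth (invComp n α γ) i ≡ inv (∈S⇒isPerm n a) (nth γ i)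
invComp-tab n γ a g h = trans (nth-tab n _ h) (nth-tab n _ (π< g h))

invComp-isPerm : ∀ n {α} γ → α ∈ S n → IsPerm n (nth γ) → IsPerm n (nth (invComp n α γ))
invComp-isPerm n γ a g =
  isPerm-cong (λ h → sym (invComp-tab n γ a g h)) (compose (inverse (∈S⇒isPerm n a)) g)

invComp-∈ : ∀ n {α} γ → α ∈ S n → IsPerm n (nth γ) → invComp n α γ ∈ S n
invComp-∈ n γ a g = tab∈S (isPerm-cong (nth-tab n _) (invComp-isPerm n γ a g))

invComp-spec : ∀ n {α} γ → α ∈ S n → IsPerm n (nth γ) → ∀ {i} → i < n → nth α (nth (invComp n α γ) i) ≡ nth γ i
invComp-spec n {α} γ a g h = trans (cong (nth α) (invComp-tab n γ a g h)) (π-inv (∈S⇒isPerm n a) (π< g h))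

invComp-unique : ∀ n {α} γ {β} → α ∈ S n → IsPerm n (nth γ) → β ∈ S n →
                 (∀ {i} → i < n → nth α (nth β i) ≡ nth γ i) → invComp n α γ ≡ β
invComp-unique n γ a g b h = trans (S-tab n (invComp-∈ n γ a g)) (trans
  (tab-cong λ q → inj (∈S⇒isPerm n a) (π< (invComp-isPerm n γ a g) q) (π< (∈S⇒isPerm n b) q)
    (trans (invComp-spec n γ a g q) (sym (h q))))
  (sym (S-tab n b)))

-- A code [j_{n-1},…,j_0] with j_m ≤ m stands for the product of the transpositions (0 j_0)(1 j_1)⋯(n-1 j_{n-1}).

transp : ℕ → ℕ → ℕ → ℕ
transp m j x = if x ≡ᵇ m then j else (if x ≡ᵇ j then m else x)

data TranspView (m j x : ℕ) : ℕ → Set where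
  isˡ  : x ≡ m → TranspView m j x j
  isʳ  : x ≢ m → x ≡ j → TranspView m j x m
  isno : x ≢ m → x ≢ j → TranspView m j x x

transpView : ∀ m j x → TranspView m j x (transp m j x)
transpView m j x with x ≡ᵇ m in e
... | true = isˡ (≡ᵇ⇒≡ x m (subst T (sym e) _))
... | false with x ≡ᵇ j in e′
...   | true = isʳ (λ p → subst T e (≡⇒≡ᵇ x m p)) (≡ᵇ⇒≡ x j (subst T (sym e′) _))
...   | false = isno (λ p → subst T e (≡⇒≡ᵇ x m p)) (λ p → subst T e′ (≡⇒≡ᵇ x j p))

transpˡ : ∀ m j → transp m j m ≡ j
transpˡ m j rewrite eqᵇ-true (refl {x = m}) = refl

transpʳ : ∀ m j → transp m j j ≡ m
transpʳ m j with transp m j j | transpView m j j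
... | _ | isˡ e = e
... | _ | isʳ _ _ = refl
... | _ | isno _ ne = ⊥-elim (ne refl)

transp-else : ∀ {m j x} → x ≢ m → x ≢ j → transp m j x ≡ x
transp-else {m} {j} p q rewrite eqᵇ-false p | eqᵇ-false q = refl

transp-invol : ∀ m j x → transp m j (transp m j x) ≡ x
transp-invol m j x with transp m j x | transpView m j x
... | _ | isˡ refl = transpʳ m j
... | _ | isʳ _ refl = transpˡ m j
... | _ | isno p q = transp-else p q

transp-self : ∀ m x → transp m m x ≡ x
transp-self m x with transp m m x | transpView m m x
... | _ | isˡ e = sym e
... | _ | isʳ _ e = sym e
... | _ | isno _ _ = refl

transp-isPerm : ∀ {n a b} → a < n → b < n → IsPerm n (transp a b)
transp-isPerm {n} {a} {b} p q = record
  { inv = transp a b ; π< = t< ; inv< = t< ; inv-π = λ _ → transp-invol a b _ ; π-inv = λ _ → transp-invol a b _ }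
  where
  t< : ∀ {x} → x < n → transp a b x < n
  t< {x} h with transp a b x | transpView a b x
  ... | _ | isˡ _ = q
  ... | _ | isʳ _ _ = p
  ... | _ | isno _ _ = h

-- With n = `length c` fixed by `perm c`, the factor (n j) on the right gives j ↦ n ↦ `perm c j`:
-- the point n is inserted behind j, and j = n makes it a fixed point.
perm : List ℕ → ℕ → ℕ
perm [] x = x
perm (j ∷ c) x = perm c (transp (length c) j x)

data IsCode : List ℕ → Set where
  []  : IsCode []
  _∷_ : ∀ {j c} → j ≤ length c → IsCode c → IsCode (j ∷ c)

codes : ℕ → List (List ℕ)
codes zero = [ [] ]
codes (suc n) = concatMap (λ c → map (_∷ c) (upTo (suc n))) (codes n)

codes⇒ : ∀ n {c} → c ∈ codes n → IsCode c × length c ≡ n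
codes⇒ zero (here refl) = [] , refl
codes⇒ (suc n) m with ∈-concatMap-elim (λ c → map (_∷ c) (upTo (suc n))) (codes n) m
... | c , c∈ , m′ with ∈-map⁻ (_∷ c) m′ | codes⇒ n c∈
... | j , j∈ , refl | ic , refl = (≤-pred (∈-upTo⁻ j∈) ∷ ic) , refl

codes-∷ : ∀ {n c j} → c ∈ codes n → j ≤ n → j ∷ c ∈ codes (suc n)
codes-∷ {n} {c} m h = ∈-concatMap-intro (λ c → map (_∷ c) (upTo (suc n))) m (∈-map⁺ (_∷ c) (∈-upTo⁺ (s≤s h)))

codes-unique : ∀ n → Unique (codes n)
codes-unique zero = [] ∷ []
codes-unique (suc n) = unique-concatMap _ (codes-unique n)
  (λ _ → Uniq.map⁺ (proj₁ ∘ ∷-injective) (Uniq.upTo⁺ (suc n)))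
  λ {x} {y} _ _ p q → let (_ , _ , e) = ∈-map⁻ (_∷ x) p ; (_ , _ , e′) = ∈-map⁻ (_∷ y) q in
    proj₂ (∷-injective (trans (sym e) e′))

perm-fix : ∀ {c} → IsCode c → ∀ {x} → length c ≤ x → perm c x ≡ x
perm-fix [] h = refl
perm-fix {j ∷ c} (p ∷ ic) {x} h = trans (cong (perm c) (transp-else (>⇒≢ h) (>⇒≢ (≤-<-trans p h))))
  (perm-fix ic (<⇒≤ h))

isPerm-suc : ∀ {n π} → π n ≡ n → IsPerm n π → IsPerm (suc n) π
isPerm-suc {n} {π} e p = record
  { inv = λ x → if x ≡ᵇ n then n else inv p x
  ; π< = λ h → bnd h
  ; inv< = λ {x} h → ibnd x (≤-pred h)
  ; inv-π = λ h → ip h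
  ; π-inv = λ {x} h → pi x (≤-pred h) }
  where
  bnd : ∀ {x} → x < suc n → π x < suc n
  bnd h with m≤n⇒m<n∨m≡n (≤-pred h)
  ... | inj₁ q = m<n⇒m<1+n (π< p q)
  ... | inj₂ refl = subst (_< suc n) (sym e) ≤-refl
  ibnd : ∀ x → x ≤ n → (if x ≡ᵇ n then n else inv p x) < suc n
  ibnd x h with m≤n⇒m<n∨m≡n h
  ... | inj₁ q rewrite eqᵇ-false (<⇒≢ q) = m<n⇒m<1+n (inv< p q)
  ... | inj₂ q rewrite eqᵇ-true q = ≤-refl
  ip : ∀ {x} → x < suc n → (if π x ≡ᵇ n then n else inv p (π x)) ≡ x
  ip h with m≤n⇒m<n∨m≡n (≤-pred h)
  ... | inj₁ q rewrite eqᵇ-false (<⇒≢ (π< p q)) = inv-π p q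
  ... | inj₂ refl rewrite eqᵇ-true e = refl
  pi : ∀ x → x ≤ n → π (if x ≡ᵇ n then n else inv p x) ≡ x
  pi x h with m≤n⇒m<n∨m≡n h
  ... | inj₁ q rewrite eqᵇ-false (<⇒≢ q) = π-inv p q
  ... | inj₂ q rewrite eqᵇ-true q = trans e (sym q)

isPerm-restrict : ∀ {n π} → π n ≡ n → IsPerm (suc n) π → IsPerm n π
isPerm-restrict {n} {π} e p = record
  { inv = inv p
  ; π< = λ h → lt h (π< p (m<n⇒m<1+n h)) (λ q → inj p (m<n⇒m<1+n h) ≤-refl (trans q (sym e)))
  ; inv< = λ h → lt h (inv< p (m<n⇒m<1+n h)) (λ q → trans (sym (π-inv p (m<n⇒m<1+n h))) (trans (cong π q) e))
  ; inv-π = inv-π p ∘ m<n⇒m<1+n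
  ; π-inv = π-inv p ∘ m<n⇒m<1+n }
  where
  lt : ∀ {x y} → x < n → y < suc n → (y ≡ n → x ≡ n) → y < n
  lt h k f = ≤∧≢⇒< (≤-pred k) (λ q → <⇒≢ h (f q))

perm-isPerm : ∀ {c} → IsCode c → IsPerm (length c) (perm c)
perm-isPerm [] = record { inv = id ; π< = id ; inv< = id ; inv-π = λ _ → refl ; π-inv = λ _ → refl }
perm-isPerm (p ∷ ic) = compose (isPerm-suc (perm-fix ic ≤-refl) (perm-isPerm ic)) (transp-isPerm ≤-refl (s≤s p))

perm-isPerm-≤ : ∀ {n c} → IsCode c → length c ≤ n → IsPerm n (perm c)
perm-isPerm-≤ {n} {c} ic h = go n (≤⇒≤′ h)
  where
  go : ∀ n → length c ≤′ n → IsPerm n (perm c)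
  go _ ≤′-refl = perm-isPerm ic
  go (suc n) (≤′-step q) = isPerm-suc (perm-fix ic (≤′⇒≤ q)) (go n q)

codes-isPerm : ∀ {n c} → c ∈ codes n → IsPerm n (perm c)
codes-isPerm {n} m with codes⇒ n m
... | ic , refl = perm-isPerm ic

perm-surj : ∀ n {π} → IsPerm n π → ∃ λ c → c ∈ codes n × (∀ {x} → x < n → perm c x ≡ π x)
perm-surj zero p = [] , here refl , λ ()
perm-surj (suc n) {π} p = j ∷ c , codes-∷ c∈ j≤ , agree
  where
  -- A code sends its head to the largest point, so the head must be π⁻¹(n). Then π (n j) fixes n
  -- and restricts to the smaller set.
  j = inv p n
  j≤ : j ≤ n
  j≤ = ≤-pred (inv< p ≤-refl)
  π′ : ℕ → ℕ
  π′ x = π (transp n j x)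
  fix : π′ n ≡ n
  fix = trans (cong π (transpˡ n j)) (π-inv p ≤-refl)
  p′ : IsPerm n π′
  p′ = isPerm-restrict fix (compose p (transp-isPerm ≤-refl (s≤s j≤)))
  c = proj₁ (perm-surj n p′)
  c∈ = proj₁ (proj₂ (perm-surj n p′))
  len = proj₂ (codes⇒ n c∈)
  agree′ : ∀ {y} → y ≤ n → perm c y ≡ π′ y
  agree′ h with m≤n⇒m<n∨m≡n h
  ... | inj₁ q = proj₂ (proj₂ (perm-surj n p′)) q
  ... | inj₂ refl = trans (perm-fix (proj₁ (codes⇒ n c∈)) (≤-reflexive len)) (sym fix)
  agree : ∀ {x} → x < suc n → perm c (transp (length c) j x) ≡ π x
  agree {x} h rewrite len = trans (agree′ (≤-pred (π< (transp-isPerm ≤-refl (s≤s j≤)) h)))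
    (cong π (transp-invol n j x))

-- The head of a code is the preimage of the largest point, hence determined by the permutation;
-- cancelling the common transposition leaves the tails.
perm-inj : ∀ n {c d} → c ∈ codes n → d ∈ codes n → (∀ {x} → x < n → perm c x ≡ perm d x) → c ≡ d
perm-inj n p q h with codes⇒ n p | codes⇒ n q
perm-inj zero {[]} {[]} p q h | _ | _ = refl
perm-inj (suc n) {j ∷ c} {k ∷ d} p q h | (a ∷ ic) , refl | (b ∷ id′) , e =
  cong₂ _∷_ j≡k (perm-inj n (tailcode p) (tailcode q) (λ {x} hx → trans
    (cong (perm c) (sym (transp-invol (length c) j x)))
    (trans (h (π< (transp-isPerm ≤-refl (s≤s a)) (m<n⇒m<1+n hx)))
    (trans (cong₂ (λ l i → perm d (transp l i (transp (length c) j x))) ld (sym j≡k))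
    (cong (perm d) (transp-invol (length c) j x))))))
  where
  ld : length d ≡ length c
  ld = suc-injective e
  tailcode : ∀ {i e} → i ∷ e ∈ codes (suc (length c)) → e ∈ codes (length c)
  tailcode m with ∈-concatMap-elim (λ c′ → map (_∷ c′) (upTo (suc (length c)))) (codes (length c)) m
  ... | e′ , e∈ , m′ with ∈-map⁻ (_∷ e′) m′
  ... | _ , _ , refl = e∈
  hitsˡ : perm (j ∷ c) j ≡ length c
  hitsˡ = trans (cong (perm c) (transpʳ (length c) j)) (perm-fix ic ≤-refl)
  hitsʳ : perm (k ∷ d) k ≡ length c
  hitsʳ = trans (cong (perm d) (transpʳ (length d) k)) (trans (perm-fix id′ ≤-refl) ld)
  j≡k : j ≡ k
  j≡k = inj (codes-isPerm q) (s≤s a) (s≤s (subst (k ≤_) ld b))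
    (trans (sym (h (s≤s a))) (trans hitsˡ (sym hitsʳ)))

S-↭-codes : ∀ n → map (λ c → tab n (perm c)) (codes n) ↭ S n
S-↭-codes n = unique-set⇒↭
  (unique-map-on _ (λ p q e → perm-inj n p q (λ h → trans (sym (nth-tab n _ h)) (trans (cong (λ l → nth l _) e) (nth-tab n _ h))))
    (codes-unique n)) (S-unique n)
  (λ m → let (c , c∈ , e) = ∈-map⁻ _ m in subst (_∈ S n) (sym e) (tab∈S (codes-isPerm c∈)))
  (λ m → let (c , c∈ , h) = perm-surj n (∈S⇒isPerm n m) in
    subst (_∈ map (λ c → tab n (perm c)) (codes n)) (trans (tab-cong h) (sym (S-tab n m))) (∈-map⁺ _ c∈))

-- Set partitions and orbits

filterᵇ-map : {A B : Set} (p : B → Bool) (f : A → B) (xs : List A) →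
              filterᵇ p (map f xs) ≡ map f (filterᵇ (p ∘ f) xs)
filterᵇ-map p f [] = refl
filterᵇ-map p f (x ∷ xs) with p (f x)
... | true = cong (f x ∷_) (filterᵇ-map p f xs)
... | false = filterᵇ-map p f xs

count-cong : {L L′ : ℕ} {f g : ℕ → ℕ} (xs : List ℕ) → (∀ {x} → x ∈ xs → (L ≡ f x → L′ ≡ g x) × (L′ ≡ g x → L ≡ f x)) →
             count L (map f xs) ≡ count L′ (map g xs)
count-cong [] h = refl
count-cong {L} {L′} {f} {g} (x ∷ xs) h
  rewrite eqᵇ-cong {L} {f x} {L′} {g x} (proj₁ (h (here refl))) (proj₂ (h (here refl)))
        | count-cong {L} {L′} {f} {g} xs (h ∘ there) = refl

count-here : ∀ L xs → count L (L ∷ xs) ≡ suc (count L xs)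
count-here L xs rewrite eqᵇ-true (refl {x = L}) = refl

count-other : ∀ {L x} xs → L ≢ x → count L (x ∷ xs) ≡ count L xs
count-other xs ne rewrite eqᵇ-false ne = refl

count-≥1⇒∈ : ∀ L xs → 1 ≤ count L xs → L ∈ xs
count-≥1⇒∈ L (x ∷ xs) h with L ≡ᵇ x in e
... | true = here (≡ᵇ⇒≡ L x (subst T (sym e) _))
... | false = there (count-≥1⇒∈ L xs h)

∈⇒count-≥1 : ∀ {L xs} → L ∈ xs → 1 ≤ count L xs
∈⇒count-≥1 {L} {x ∷ xs} m with L ≡ᵇ x in e
... | true = s≤s z≤n
∈⇒count-≥1 {L} {x ∷ xs} (here refl) | false = ⊥-elim (subst T e (≡⇒≡ᵇ x x refl))
∈⇒count-≥1 {L} {x ∷ xs} (there m) | false = ∈⇒count-≥1 m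

∉⇒count-0 : ∀ {L xs} → L ∉ xs → count L xs ≡ 0
∉⇒count-0 {L} {xs} ne with count L xs in e
... | zero = refl
... | suc k = ⊥-elim (ne (count-≥1⇒∈ L xs (subst (1 ≤_) (sym e) (s≤s z≤n))))

count-++ : ∀ L xs ys → count L (xs ++ ys) ≡ count L xs + count L ys
count-++ L [] ys = refl
count-++ L (x ∷ xs) ys with L ≡ᵇ x
... | true = cong suc (count-++ L xs ys)
... | false = count-++ L xs ys

count-↭ : ∀ L {xs ys} → xs ↭ ys → count L xs ≡ count L ys
count-↭ L Perm.refl = refl
count-↭ L (prep x p) with L ≡ᵇ x
... | true = cong suc (count-↭ L p)
... | false = count-↭ L p
count-↭ L (swap x y p) with L ≡ᵇ x | L ≡ᵇ y
... | true | true = cong (suc ∘ suc) (count-↭ L p)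
... | true | false = cong suc (count-↭ L p)
... | false | true = cong suc (count-↭ L p)
... | false | false = count-↭ L p
count-↭ L (Perm.trans p q) = trans (count-↭ L p) (count-↭ L q)

-- Labellings of {0,…,n-1}; two of them describe the same set partition when their kernels agree.

SameKer : ℕ → (ℕ → ℕ) → (ℕ → ℕ) → Set
SameKer n f g = ∀ {i k} → i < n → k < n → (f i ≡ f k → g i ≡ g k) × (g i ≡ g k → f i ≡ f k)

Below : ℕ → ℕ → (ℕ → ℕ) → Set
Below n m f = ∀ {i} → i < n → f i < m

used : ℕ → List ℕ → List ℕ
used n b = filterᵇ (λ L → 1 ≤ᵇ count L b) (upTo n)

blockSizes-used : ∀ n b → blockSizes n b ≡ map (λ L → count L b) (used n b)
blockSizes-used n b = filterᵇ-map (1 ≤ᵇ_) (λ L → count L b) (upTo n)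

used⁻ : ∀ n f {L} → L ∈ used n (tab n f) → L < n × (∃ λ i → i < n × f i ≡ L)
used⁻ n f {L} m with ∈-filterᵇ⁻ (λ L → 1 ≤ᵇ count L (tab n f)) m
... | m′ , h with ∈-map⁻ f (count-≥1⇒∈ L (tab n f) (≤ᵇ⇒≤ 1 _ h))
... | i , i∈ , e = ∈-upTo⁻ m′ , i , ∈-upTo⁻ i∈ , sym e

used⁺ : ∀ n f {i} → i < n → f i < n → f i ∈ used n (tab n f)
used⁺ n f {i} h h′ = ∈-filterᵇ⁺ (λ L → 1 ≤ᵇ count L (tab n f)) (∈-upTo⁺ h′) (≤⇒≤ᵇ (∈⇒count-≥1 (∈-map⁺ f (∈-upTo⁺ h))))

used-unique : ∀ n b → Unique (used n b)
used-unique n b = Uniq.filter⁺ _ (Uniq.upTo⁺ n)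

-- Both lists are ordered by label values, which the kernel does not determine, hence a
-- rearrangement and not an equality. The bounds enter because `blockSizes` sees only labels below
-- `n`.
blockSizes-ker : ∀ n {f g} → Below n n f → Below n n g → SameKer n f g →
                 blockSizes n (tab n f) ↭ blockSizes n (tab n g)
blockSizes-ker n {f} {g} bf bg ker = ↭-trans (↭-reflexive (trans (blockSizes-used n b)
    (trans (map-cong-∈ (used n b) same) (map-∘ (used n b)))))
    (↭-trans (↭-map⁺ (λ L → count L b′) φ↭) (↭-reflexive (sym (blockSizes-used n b′))))
  where
  b = tab n f
  b′ = tab n g
  -- The translation of labels: the value of `g` at the first position carrying `L`. It is
  -- meaningful on labels in use, where `ker` makes it independent of the position.
  φ : ℕ → ℕ
  φ L = g (indexOf L b)
  ix : ∀ {i} → i < n → indexOf (f i) b < n × f (indexOf (f i) b) ≡ f i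
  ix {i} h with indexOf-∈ (∈-map⁺ f (∈-upTo⁺ h))
  ... | p , e with subst (indexOf (f i) b <_) (length-tab n f) p
  ... | q = q , trans (sym (nth-tab n f {indexOf (f i) b} q)) e
  φf : ∀ {i} → i < n → φ (f i) ≡ g i
  φf h = proj₁ (ker (proj₁ (ix h)) h) (proj₂ (ix h))
  φ↭ : map φ (used n b) ↭ used n b′
  φ↭ = unique-set⇒↭ (unique-map-on φ inj′ (used-unique n b)) (used-unique n b′) to from
    where
    inj′ : ∀ {x y} → x ∈ used n b → y ∈ used n b → φ x ≡ φ y → x ≡ y
    inj′ p q e with used⁻ n f p | used⁻ n f q
    ... | _ , i , hi , refl | _ , k , hk , refl = proj₂ (ker hi hk) (trans (sym (φf hi)) (trans e (φf hk)))
    to : ∀ {x} → x ∈ map φ (used n b) → x ∈ used n b′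
    to m with ∈-map⁻ φ m
    ... | L , L∈ , refl with used⁻ n f L∈
    ... | _ , i , hi , refl = subst (_∈ used n b′) (sym (φf hi)) (used⁺ n g hi (bg hi))
    from : ∀ {x} → x ∈ used n b′ → x ∈ map φ (used n b)
    from m with used⁻ n g m
    ... | _ , i , hi , refl = subst (_∈ map φ (used n b)) (φf hi) (∈-map⁺ φ (used⁺ n f hi (bf hi)))
  same : ∀ {L} → L ∈ used n b → count L b ≡ count (φ L) b′
  same m with used⁻ n f m
  ... | _ , i , hi , refl = count-cong (upTo n) (λ x∈ → let hx = ∈-upTo⁻ x∈ in
    (λ e → trans (φf hi) (proj₁ (ker hi hx) e)) , (λ e → proj₂ (ker hi hx) (trans (sym (φf hi)) e)))

-- Orbits of a permutation and labellings by orbits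

Orb : (ℕ → ℕ) → ℕ → ℕ → Set
Orb π x y = ∃ λ m → iter m π x ≡ y

iter-+ : {A : Set} (a b : ℕ) (f : A → A) (x : A) → iter (a + b) f x ≡ iter a f (iter b f x)
iter-+ zero b f x = refl
iter-+ (suc a) b f x = cong f (iter-+ a b f x)

iter-* : {A : Set} (q p : ℕ) (f : A → A) (x : A) → iter p f x ≡ x → iter (q * p) f x ≡ x
iter-* zero p f x e = refl
iter-* (suc q) p f x e = trans (iter-+ p (q * p) f x) (trans (cong (iter p f) (iter-* q p f x e)) e)

iter-suc : {A : Set} (m : ℕ) (f : A → A) (x : A) → iter (suc m) f x ≡ iter m f (f x)
iter-suc zero f x = refl
iter-suc (suc m) f x = cong f (iter-suc m f x)

orb-refl : ∀ {π x} → Orb π x x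
orb-refl = 0 , refl

orb-trans : ∀ {π x y z} → Orb π x y → Orb π y z → Orb π x z
orb-trans {π} {x} (a , p) (b , q) = b + a , trans (iter-+ b a π x) (trans (cong (iter b π) p) q)

orb-step : ∀ {π x} → Orb π x (π x)
orb-step = 1 , refl

module _ {n π} (p : IsPerm n π) where

  iter< : ∀ m {x} → x < n → iter m π x < n
  iter< zero h = h
  iter< (suc m) h = π< p (iter< m h)

  iter-cancel : ∀ a {b x} → x < n → iter a π x ≡ iter (a + b) π x → x ≡ iter b π x
  iter-cancel zero h e = e
  iter-cancel (suc a) {b} h e = iter-cancel a h (inj p (iter< a h) (iter< (a + b) h) e)

  period : ∀ {x} → x < n → ∃ λ q → suc q ≤ n × iter (suc q) π x ≡ x
  -- Two of the n + 1 iterates x, π x, ..., π^n x coincide, and injectivity cancels the steps they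
  -- share.
  period {x} h with Fin.pigeonhole (n<1+n n) (λ (i : Fin (suc n)) → fromℕ< (iter< (toℕ i) h))
  ... | i , j , i<j , e = fin (toℕ i) (toℕ j) i<j (≤-pred (Fin.toℕ<n j))
        (trans (sym (Fin.toℕ-fromℕ< (iter< (toℕ i) h))) (trans (cong toℕ e) (Fin.toℕ-fromℕ< (iter< (toℕ j) h))))
    where
    fin : ∀ a b → a < b → b ≤ n → iter a π x ≡ iter b π x → ∃ λ q → suc q ≤ n × iter (suc q) π x ≡ x
    fin a b a<b b≤n e with m≤n⇒∃[o]m+o≡n a<b
    ... | q , refl = q , ≤-trans (s≤s (m≤n+m q a)) b≤n ,
      sym (iter-cancel a h (trans e (cong (λ k → iter k π x) (sym (+-suc a q)))))

  orb-sym : ∀ {x y} → x < n → Orb π x y → Orb π y x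
  orb-sym {x} h (m , refl) with period h
  -- Another m q steps complete m rounds of length q + 1.
  ... | q , _ , e = m * q , trans (sym (iter-+ (m * q) m π x))
     (trans (cong (λ k → iter k π x) (trans (+-comm (m * q) m) (sym (*-suc m q)))) (iter-* m (suc q) π x e))

  orb-bounded : ∀ {x y} → x < n → Orb π x y → ∃ λ m → m < n × iter m π x ≡ y
  orb-bounded {x} h (m , refl) with period h
  ... | q , q<n , e = m % suc q , <-≤-trans (m%n<n m (suc q)) q<n , sym
    (trans (cong (λ k → iter k π x) (m≡m%n+[m/n]*n m (suc q)))
    (trans (iter-+ (m % suc q) (m / suc q * suc q) π x) (cong (iter (m % suc q) π) (iter-* (m / suc q) (suc q) π x e))))

-- The level sets of `f` are exactly the orbits: `stay` makes `f` constant on orbits, `joins` keeps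
-- different orbits apart. No particular label is prescribed, since by `orbLab-ker` any two such
-- labellings have the same kernel and hence the same block sizes.
record OrbLab (n : ℕ) (π f : ℕ → ℕ) : Set where
  field
    lab<  : Below n n f
    stay  : ∀ {i} → i < n → f (π i) ≡ f i
    joins : ∀ {i k} → i < n → k < n → f i ≡ f k → Orb π i k

open OrbLab

stay* : ∀ {n π} (f : ℕ → ℕ) → IsPerm n π → (∀ {i} → i < n → f (π i) ≡ f i) → ∀ {i k} → i < n → Orb π i k → f i ≡ f k
stay* f p st h (zero , refl) = refl
stay* f p st h (suc m , refl) = trans (stay* f p st h (m , refl)) (sym (st (iter< p m h)))

orbLab-ker : ∀ {n π f g} → IsPerm n π → OrbLab n π f → OrbLab n π g → SameKer n f g
orbLab-ker {f = f} {g} p lf lg hi hk =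
  (λ e → stay* g p (stay lg) hi (joins lf hi hk e)) , (λ e → stay* f p (stay lf) hi (joins lg hi hk e))

orb-cong : ∀ {n π ρ} → IsPerm n π → (∀ {x} → x < n → π x ≡ ρ x) → ∀ {x y} → x < n → Orb π x y → Orb ρ x y
orb-cong {n} {π} {ρ} p h hx (m , refl) = m , go m
  where
  go : ∀ m → iter m ρ _ ≡ iter m π _
  go zero = refl
  go (suc m) = trans (cong ρ (go m)) (sym (h (iter< p m hx)))

orbLab-cong : ∀ {n π ρ f g} → IsPerm n π → (∀ {x} → x < n → π x ≡ ρ x) → (∀ {x} → x < n → f x ≡ g x) →
              OrbLab n π f → OrbLab n ρ g
orbLab-cong {n} {f = f} {g} p h hf l = record
  { lab< = λ q → subst (_< n) (hf q) (lab< l q)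
  ; stay = λ q → trans (cong g (sym (h q))) (trans (sym (hf (π< p q))) (trans (stay l q) (hf q)))
  ; joins = λ a b e → orb-cong p h a (joins l a b (trans (hf a) (trans e (sym (hf b))))) }

minL-≤ : ∀ d xs {y} → y ∈ d ∷ xs → minL d xs ≤ y
minL-≤ d [] (here refl) = ≤-refl
minL-≤ d (x ∷ xs) m with x ≤ᵇ minL d xs in e
minL-≤ d (x ∷ xs) (here refl) | true = ≤-trans (≤ᵇ⇒≤ x _ (subst T (sym e) _)) (minL-≤ d xs (here refl))
minL-≤ d (x ∷ xs) (there (here refl)) | true = ≤-refl
minL-≤ d (x ∷ xs) (there (there m)) | true = ≤-trans (≤ᵇ⇒≤ x _ (subst T (sym e) _)) (minL-≤ d xs (there m))
minL-≤ d (x ∷ xs) (here refl) | false = minL-≤ d xs (here refl)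
minL-≤ d (x ∷ xs) (there (here refl)) | false = ≰⇒≥ (λ h → subst T e (≤⇒≤ᵇ h))
minL-≤ d (x ∷ xs) (there (there m)) | false = minL-≤ d xs (there m)

minL-∈ : ∀ d xs → minL d xs ∈ d ∷ xs
minL-∈ d [] = here refl
minL-∈ d (x ∷ xs) with x ≤ᵇ minL d xs
... | true = there (here refl)
... | false with minL-∈ d xs
...   | here e = here e
...   | there m = there (there m)

module _ {n} (α : List ℕ) (p : IsPerm n (nth α)) where

  private
    orbit : ℕ → List ℕ
    orbit i = map (λ m → iter m (nth α) i) (upTo n)

  ∈orbit : ∀ {i y} → i < n → Orb (nth α) i y → y ∈ i ∷ orbit i
  ∈orbit {i} h o with orb-bounded p h o
  ... | m , m<n , refl = there (∈-map⁺ (λ m → iter m (nth α) i) (∈-upTo⁺ m<n))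

  orbitMin-orb : ∀ i → Orb (nth α) i (orbitMin n α i)
  orbitMin-orb i with minL-∈ i (orbit i)
  ... | here e = 0 , sym e
  ... | there m with ∈-map⁻ (λ m → iter m (nth α) i) m
  ...   | k , _ , e = k , sym e

  orbitMin-lab : OrbLab n (nth α) (orbitMin n α)
  orbitMin-lab = record
    { lab< = λ {i} h → let (m , e) = orbitMin-orb i in subst (_< n) e (iter< p m h)
    ; stay = λ h → ≤-antisym (le (π< p h) h (orb-sym p h orb-step)) (le h (π< p h) orb-step)
    ; joins = λ {i} {k} a b e → orb-trans (subst (Orb (nth α) i) e (orbitMin-orb i)) (orb-sym p b (orbitMin-orb k)) }
    where
    le : ∀ {i k} → i < n → k < n → Orb (nth α) i k → orbitMin n α i ≤ orbitMin n α k
    le {i} {k} a b o = minL-≤ i (orbit i) (∈orbit a (orb-trans o (orbitMin-orb k)))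

cycleSizes : ∀ {n} α {f} → IsPerm n (nth α) → OrbLab n (nth α) f →
             blockSizes n (cyclePartition n α) ↭ blockSizes n (tab n f)
cycleSizes {n} α p l = blockSizes-ker n (lab< (orbitMin-lab α p)) (lab< l) (orbLab-ker p (orbitMin-lab α p) l)

-- The restricted growth string of the cycle partition of a code, and its block sizes.

incAt : ℕ → List ℕ → List ℕ
incAt i [] = []
incAt zero (x ∷ xs) = suc x ∷ xs
incAt (suc i) (x ∷ xs) = x ∷ incAt i xs

labels : List ℕ → List ℕ
sizes : List ℕ → List ℕ
labels [] = []
labels (j ∷ c) = labels c ++ [ (if j ≡ᵇ length c then length (sizes c) else nth (labels c) j) ]
sizes [] = []
sizes (j ∷ c) = if j ≡ᵇ length c then sizes c ++ [ 1 ] else incAt (nth (labels c) j) (sizes c)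

length-labels : ∀ c → length (labels c) ≡ length c
length-labels [] = refl
length-labels (j ∷ c) = trans (length-++ (labels c)) (trans (+-comm (length (labels c)) 1) (cong suc (length-labels c)))

length-incAt : ∀ i xs → length (incAt i xs) ≡ length xs
length-incAt i [] = refl
length-incAt zero (x ∷ xs) = refl
length-incAt (suc i) (x ∷ xs) = cong suc (length-incAt i xs)

length-sizes : ∀ j c → length (sizes (j ∷ c)) ≡ (if j ≡ᵇ length c then suc (length (sizes c)) else length (sizes c))
length-sizes j c with j ≡ᵇ length c
... | true = trans (length-++ (sizes c)) (+-comm (length (sizes c)) 1)
... | false = length-incAt (nth (labels c) j) (sizes c)

length-sizes-≤ : ∀ c → length (sizes c) ≤ length c
length-sizes-≤ [] = z≤n
length-sizes-≤ (j ∷ c) rewrite length-sizes j c with j ≡ᵇ length c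
... | true = s≤s (length-sizes-≤ c)
... | false = m≤n⇒m≤1+n (length-sizes-≤ c)

labels-old : ∀ j c {i} → i < length c → nth (labels (j ∷ c)) i ≡ nth (labels c) i
labels-old j c h = nth-++ˡ (labels c) _ (subst (_ <_) (sym (length-labels c)) h)

labels-last : ∀ j c → nth (labels (j ∷ c)) (length c) ≡ (if j ≡ᵇ length c then length (sizes c) else nth (labels c) j)
labels-last j c = trans (cong (nth (labels (j ∷ c))) (sym (length-labels c))) (nth-snoc (labels c) _)

labels< : ∀ {c} → IsCode c → Below (length c) (length (sizes c)) (nth (labels c))
labels< {j ∷ c} (p ∷ ic) {i} h rewrite length-sizes j c with m≤n⇒m<n∨m≡n (≤-pred h)
... | inj₁ q rewrite labels-old j c q with j ≡ᵇ length c
...   | true = m<n⇒m<1+n (labels< ic q)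
...   | false = labels< ic q
labels< {j ∷ c} (p ∷ ic) {i} h | inj₂ refl rewrite labels-last j c with j ≡ᵇ length c in e
...   | true = ≤-refl
...   | false = labels< ic (≤∧≢⇒< p (λ q → subst T e (≡⇒≡ᵇ j (length c) q)))

labels-orbLab : ∀ {c} → IsCode c → OrbLab (length c) (perm c) (nth (labels c))
labels-orbLab [] = record { lab< = λ () ; stay = λ () ; joins = λ () }
labels-orbLab {j ∷ c} (p ∷ ic) = record
  { lab< = λ h → <-≤-trans (labels< (p ∷ ic) h) (length-sizes-≤ (j ∷ c))
  ; stay = λ {i} h → stay′ i (≤-pred h)
  ; joins = λ {i} {k} a b → joins′ (≤-pred a) (≤-pred b) }
  where
  n = length c
  π = perm c
  π′ = perm (j ∷ c)
  f = nth (labels c)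
  f′ = nth (labels (j ∷ c))
  l = labels-orbLab ic
  pp = perm-isPerm ic
  π′n : π′ n ≡ π j
  π′n = cong π (transpˡ n j)
  π′j : π′ j ≡ n
  π′j = trans (cong π (transpʳ n j)) (perm-fix ic ≤-refl)
  π′o : ∀ {i} → i ≢ n → i ≢ j → π′ i ≡ π i
  π′o a b = cong π (transp-else a b)
  f′n : j ≢ n → f′ n ≡ f j
  f′n ne = trans (labels-last j c) (cong (λ b → if b then length (sizes c) else f j) (eqᵇ-false ne))
  stay′ : ∀ i → i ≤ n → f′ (π′ i) ≡ f′ i
  stay′ i h with i ≟ n | i ≟ j
  ... | yes refl | yes refl = cong f′ π′j
  ... | yes refl | no ne = trans (cong f′ π′n) (trans (labels-old j c (π< pp j<)) (trans (stay l j<) (sym (f′n (ne ∘ sym)))))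
    where j< = ≤∧≢⇒< p (ne ∘ sym)
  ... | no ne | yes refl = trans (cong f′ π′j) (trans (f′n ne) (sym (labels-old j c (≤∧≢⇒< h ne))))
  ... | no ne | no ne′ = trans (cong f′ (π′o ne ne′)) (trans (labels-old j c (π< pp i<)) (trans (stay l i<) (sym (labels-old j c i<))))
    where i< = ≤∧≢⇒< h ne
  -- Only the step out of j becomes longer: it now passes through n.
  step : ∀ {y} → y < n → Orb π′ y (π y)
  step {y} h with y ≟ j
  ... | yes refl = 2 , trans (cong π′ π′j) π′n
  ... | no ne = 1 , π′o (<⇒≢ h) ne
  lift : ∀ {i k} → i < n → Orb π i k → Orb π′ i k
  lift h (zero , refl) = orb-refl
  lift h (suc m , refl) = orb-trans (lift h (m , refl)) (step (iter< pp m h))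
  -- The point n shares a label with an old point only if it was inserted behind j < n; as a fixed
  -- point it carries the fresh label, which exceeds all old ones.
  new : ∀ {i} → i < n → f i ≡ f′ n → (Orb π′ i n × Orb π′ n i)
  new {i} h e with j ≟ n
  ... | yes refl = ⊥-elim (<⇒≢ (labels< ic h)
        (trans e (trans (labels-last j c) (cong (λ b → if b then length (sizes c) else nth (labels c) j) (eqᵇ-true (refl {x = j}))))))
  ... | no ne = orb-trans (lift h (joins l h j< fij)) (1 , π′j)
              , orb-trans (1 , π′n) (lift (π< pp j<) (joins l (π< pp j<) h (trans (stay l j<) (sym fij))))
    where
    j< = ≤∧≢⇒< p ne
    fij : f i ≡ f j
    fij = trans e (f′n ne)
  joins′ : ∀ {i k} → i ≤ n → k ≤ n → f′ i ≡ f′ k → Orb π′ i k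
  joins′ a b e with m≤n⇒m<n∨m≡n a | m≤n⇒m<n∨m≡n b
  ... | inj₁ a′ | inj₁ b′ = lift a′ (joins l a′ b′ (trans (sym (labels-old j c a′)) (trans e (labels-old j c b′))))
  ... | inj₁ a′ | inj₂ refl = proj₁ (new a′ (trans (sym (labels-old j c a′)) e))
  ... | inj₂ refl | inj₁ b′ = proj₂ (new b′ (trans (sym (labels-old j c b′)) (sym e)))
  ... | inj₂ refl | inj₂ refl = orb-refl

-- The genus of a factorisation

cls : ℕ → (ℕ → ℕ) → ℕ
cls n f = numBlocks n (tab n f)

cls-used : ∀ n f → cls n f ≡ length (used n (tab n f))
cls-used n f = trans (cong length (blockSizes-used n (tab n f))) (length-map _ (used n (tab n f)))

cls-ker : ∀ {n f g} → Below n n f → Below n n g → SameKer n f g → cls n f ≡ cls n g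
cls-ker {n} bf bg ker = ↭-length (blockSizes-ker n bf bg ker)

cls-image : ∀ n f m → m ≤ n → Below n m f → (∀ {L} → L < m → ∃ λ i → i < n × f i ≡ L) → cls n f ≡ m
cls-image n f m m≤n bf onto = trans (cls-used n f) (trans (↭-length (unique-set⇒↭ (used-unique n (tab n f)) (Uniq.upTo⁺ m) to from)) (length-upTo m))
  where
  to : ∀ {x} → x ∈ used n (tab n f) → x ∈ upTo m
  to h with used⁻ n f h
  ... | _ , i , hi , refl = ∈-upTo⁺ (bf hi)
  from : ∀ {x} → x ∈ upTo m → x ∈ used n (tab n f)
  from h with onto (∈-upTo⁻ h)
  ... | i , hi , refl = used⁺ n f hi (<-≤-trans (bf hi) m≤n)

merge : (ℕ → ℕ) → ℕ → ℕ → ℕ → ℕ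
merge f a b i = if f i ≡ᵇ f a then f b else f i

merge-yes : ∀ f {a b i} → f i ≡ f a → merge f a b i ≡ f b
merge-yes f e rewrite eqᵇ-true e = refl

merge-no : ∀ f {a b i} → f i ≢ f a → merge f a b i ≡ f i
merge-no f e rewrite eqᵇ-false e = refl

merge-cong : ∀ f {a b i k} → f i ≡ f k → merge f a b i ≡ merge f a b k
merge-cong f e rewrite e = refl

merge-below : ∀ {n f a b} → b < n → Below n n f → Below n n (merge f a b)
merge-below {n} {f} {a} hb bf {i} hi with f i ≡ᵇ f a
... | true = bf hb
... | false = bf hi

merge-joined : ∀ f {a b} → merge f a b a ≡ merge f a b b
merge-joined f {a} {b} with f b ≟ f a
... | yes e = merge-cong f (sym e)
... | no ne = trans (merge-yes f refl) (sym (merge-no f ne))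

-- The labels in use for `f` are those in use after merging, together with `f a`, which has
-- disappeared.
cls-merge : ∀ {n f a b} → Below n n f → a < n → b < n → f a ≢ f b → suc (cls n (merge f a b)) ≡ cls n f
cls-merge {n} {f} {a} {b} bf ha hb ne = sym (trans (cls-used n f) (trans
  (↭-length (unique-set⇒↭ (used-unique n (tab n f)) (unique-∷ fa∉ (used-unique n (tab n f′))) to from))
  (cong suc (sym (cls-used n f′)))))
  where
  f′ = merge f a b
  fa∉ : f a ∉ used n (tab n f′)
  fa∉ m with used⁻ n f′ m
  ... | _ , i , hi , e with f i ≟ f a
  ...   | yes q = ne (sym (trans (sym (merge-yes f q)) e))
  ...   | no q = q (trans (sym (merge-no f q)) e)
  to : ∀ {L} → L ∈ used n (tab n f) → L ∈ f a ∷ used n (tab n f′)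
  to m with used⁻ n f m
  ... | _ , i , hi , refl with f i ≟ f a
  ...   | yes q = here q
  ...   | no q = there (subst (_∈ used n (tab n f′)) (merge-no f q) (used⁺ n f′ hi (merge-below hb bf hi)))
  from : ∀ {L} → L ∈ f a ∷ used n (tab n f′) → L ∈ used n (tab n f)
  from (here refl) = used⁺ n f ha (bf ha)
  from (there m) with used⁻ n f′ m
  ... | _ , i , hi , refl with f i ≟ f a
  ...   | yes q = subst (_∈ used n (tab n f)) (sym (merge-yes f q)) (used⁺ n f hb (bf hb))
  ...   | no q = subst (_∈ used n (tab n f)) (sym (merge-no f q)) (used⁺ n f hi (bf hi))

-- From a the new permutation goes to π b and then follows the old cycle of b. That cycle does not
-- contain a, so nothing diverts it before it reaches b, whence it enters the old cycle of a. The
-- two cycles become one.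
orbLab-merge : ∀ {n π f a b} → IsPerm n π → OrbLab n π f → a < n → b < n → f a ≢ f b →
               OrbLab n (π ∘ transp a b) (merge f a b)
orbLab-merge {n} {π} {f} {a} {b} p l ha hb ne = record
  { lab< = merge-below hb (lab< l) ; stay = stay′ ; joins = joins′ }
  where
  τ = transp a b
  π′ = π ∘ τ
  p′ : IsPerm n π′
  p′ = compose p (transp-isPerm ha hb)
  π′a : π′ a ≡ π b
  π′a = cong π (transpˡ a b)
  π′b : π′ b ≡ π a
  π′b = cong π (transpʳ a b)
  stay′ : ∀ {x} → x < n → merge f a b (π′ x) ≡ merge f a b x
  stay′ {x} h with τ x | transpView a b x
  ... | _ | isˡ refl = trans (merge-cong f (stay l hb)) (sym (merge-joined f))
  ... | _ | isʳ _ refl = trans (merge-cong f (stay l ha)) (merge-joined f)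
  ... | _ | isno _ _ = merge-cong f (stay l h)
  walk : ∀ m {y} → y < n → f y ≢ f a → iter m π y ≡ b → Orb π′ y b
  walk zero h q e = 0 , e
  walk (suc m) {y} h q e with y ≟ b
  ... | yes y≡b = 0 , y≡b
  ... | no y≢b = orb-trans (1 , cong π (transp-else (q ∘ cong f) y≢b))
      (walk m (π< p h) (q ∘ trans (sym (stay l h))) (trans (sym (iter-suc m π y)) e))
  a⇝b : Orb π′ a b
  a⇝b with orb-sym p hb orb-step
  ... | m , e = orb-trans (1 , π′a) (walk m (π< p hb) (λ q → ne (sym (trans (sym (stay l hb)) q))) e)
  b⇝a = orb-sym p′ ha a⇝b
  step : ∀ {y} → Orb π′ y (π y)
  step {y} with y ≟ a | y ≟ b
  ... | yes refl | _ = orb-trans a⇝b (1 , π′b)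
  ... | no _ | yes refl = orb-trans b⇝a (1 , π′a)
  ... | no q | no q′ = 1 , cong π (transp-else q q′)
  lift : ∀ {i k} → Orb π i k → Orb π′ i k
  lift (zero , refl) = orb-refl
  lift (suc m , refl) = orb-trans (lift (m , refl)) step
  joins′ : ∀ {i k} → i < n → k < n → merge f a b i ≡ merge f a b k → Orb π′ i k
  joins′ {i} {k} hi hk e with f i ≟ f a | f k ≟ f a
  ... | yes q | yes q′ = lift (joins l hi hk (trans q (sym q′)))
  ... | yes q | no q′ = orb-trans (lift (joins l hi ha q)) (orb-trans a⇝b
       (lift (joins l hb hk (trans (sym (merge-yes f q)) (trans e (merge-no f q′))))))
  ... | no q | yes q′ = orb-trans (lift (joins l hi hb (trans (sym (merge-no f q)) (trans e (merge-yes f q′)))))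
       (orb-trans b⇝a (lift (joins l ha hk (sym q′))))
  ... | no q | no q′ = lift (joins l hi hk (trans (sym (merge-no f q)) (trans e (merge-no f q′))))

least : {P : ℕ → Set} → (∀ i → Dec (P i)) → ∀ m → P m → ∃ λ k → P k × (∀ {j} → j < k → ¬ P j)
least P? zero h = 0 , h , λ ()
least {P} P? (suc m) h with P? 0
... | yes p = 0 , p , λ ()
... | no q with least (P? ∘ suc) m h
...   | k , pk , mn = suc k , pk , λ { {zero} _ → q ; {suc j} (s≤s lt) → mn lt }

-- If k ≥ 0 is least with π^{k+1} b = a, then {π b, …, π^{k+1} b} is stable under π ∘ (a b), contains a and misses b.
separated : ∀ {n π a b} → IsPerm n π → a ≢ b → a < n → b < n → Orb π b a → ¬ Orb (π ∘ transp a b) a b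
separated {n} {π} {a} {b} p a≢b ha hb (zero , e) _ = a≢b (sym e)
separated {n} {π} {a} {b} p a≢b ha hb (suc m , e) (r , er) =
  b∉C (subst C er (closed r))
  where
  first = least (λ i → iter (suc i) π b ≟ a) m e
  k = proj₁ first
  ek = proj₁ (proj₂ first)
  mn : ∀ {j} → j < k → iter (suc j) π b ≢ a
  mn = proj₂ (proj₂ first)
  C : ℕ → Set
  C y = ∃ λ i → i ≤ k × iter (suc i) π b ≡ y
  -- A return to b before reaching a could be cut out, giving a shorter way from b to a than the
  -- minimal `k` allows.
  noreturn : ∀ {i} → i ≤ k → iter (suc i) π b ≢ b
  noreturn {i} h e′ with m≤n⇒m<n∨m≡n h
  ... | inj₂ refl = a≢b (trans (sym ek) e′)
  ... | inj₁ lt with m≤n⇒∃[o]m+o≡n lt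
  ...   | o , eo = mn {o} (subst (o <_) eo (s≤s (m≤n+m o i)))
          (trans (cong (iter (suc o) π) (sym e′)) (trans (sym (iter-+ (suc o) (suc i) π b))
          (trans (cong (λ z → iter z π b) (trans (+-comm (suc o) (suc i)) (trans (cong suc (+-suc i o)) (cong suc eo)))) ek)))
  closed : ∀ r → C (iter r (π ∘ transp a b) a)
  closed zero = k , ≤-refl , ek
  closed (suc r) with closed r
  ... | i , i≤k , e′ with m≤n⇒m<n∨m≡n i≤k
  ...   | inj₂ refl = 0 , z≤n , cong π (sym (trans (cong (transp a b) (trans (sym e′) ek)) (transpˡ a b)))
  ...   | inj₁ lt = suc i , lt , cong π (trans e′ (sym (transp-else
            (λ q → mn lt (trans e′ q)) (λ q → noreturn i≤k (trans e′ q)))))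
  b∉C : ¬ C b
  b∉C (i , i≤k , e′) = noreturn i≤k e′

someLab : ∀ {n π} → IsPerm n π → ∃ λ f → OrbLab n π f
someLab {n} {π} p = orbitMin n α , orbLab-cong p′ (nth-tab n π) (λ _ → refl) (orbitMin-lab α p′)
  where
  α = tab n π
  p′ : IsPerm n (nth α)
  p′ = isPerm-cong (sym ∘ nth-tab n π) p

-- By `separated`, a and b lie in different cycles of π (a b). Multiplying by (a b) once more merges
-- these and gives back π, which therefore has one cycle fewer.
orbLab-split : ∀ {n π f a b} → IsPerm n π → OrbLab n π f → a < n → b < n → a ≢ b → f a ≡ f b →
               ∃ λ f′ → OrbLab n (π ∘ transp a b) f′ × cls n f′ ≡ suc (cls n f)
orbLab-split {n} {π} {f} {a} {b} p l ha hb a≢b e = f′ , l′ ,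
  trans (sym (cls-merge (lab< l′) ha hb ne)) (cong suc (cls-ker (lab< l″) (lab< l) (orbLab-ker p l″ l)))
  where
  p′ = compose p (transp-isPerm ha hb)
  f′ = proj₁ (someLab p′)
  l′ = proj₂ (someLab p′)
  ne : f′ a ≢ f′ b
  ne q = separated p a≢b ha hb (joins l hb ha (sym e)) (joins l′ ha hb q)
  l″ : OrbLab n π (merge f′ a b)
  l″ = orbLab-cong (compose p′ (transp-isPerm ha hb)) (λ {x} _ → cong π (transp-invol a b x)) (λ _ → refl)
         (orbLab-merge p′ l′ ha hb ne)

-- R labels the orbits of the group generated by α and β, or a coarser partition.
record Genus (n : ℕ) (α β f : ℕ → ℕ) : Set where
  field
    R fβ fγ : ℕ → ℕ
    R<  : Below n n R
    Rα  : ∀ {i} → i < n → R (α i) ≡ R i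
    Rβ  : ∀ {i} → i < n → R (β i) ≡ R i
    lβ  : OrbLab n β fβ
    lγ  : OrbLab n (α ∘ β) fγ
    h   : ℕ
    euler : cls n f + cls n fβ + cls n fγ + 2 * h ≡ n + 2 * cls n R

-- Multiplying β by a transposition (m j), with m fixed by β, merges two cycles of β. It changes the number of
-- cycles of αβ by ±1, and by -1 if it also merges two orbits of R.
genus-code : ∀ {n α f} → IsPerm n α → OrbLab n α f → ∀ {c} → IsCode c → length c ≤ n → Genus n α (perm c) f
genus-code {n} {α} {f} p l [] _ = record
  { R = f ; fβ = id ; fγ = f ; R< = lab< l ; Rα = stay l ; Rβ = λ _ → refl
  ; lβ = record { lab< = id ; stay = λ _ → refl ; joins = λ _ _ e → 0 , e }
  ; lγ = l ; h = 0
  -- For β the identity, αβ = α and β has n cycles: both sides are n + 2 #(α), with `h` = 0 and the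
  -- orbits of α as classes of `R`.
  ; euler = trans (cong (λ z → cls n f + z + cls n f + 0) (cls-image n id n ≤-refl id (λ {L} q → L , q , refl)))
      (solve 2 (λ x y → x :+ y :+ x :+ con 0 := y :+ con 2 :* x) refl (cls n f) n) }
genus-code {n} {α} {f} p l {j ∷ c} (j≤ ∷ ic) c<n with j ≟ length c
... | yes refl = record
  { R = R ; fβ = fβ ; fγ = fγ ; R< = R< ; Rα = Rα
  ; Rβ = λ {i} q → trans (cong (R ∘ perm c) (transp-self (length c) i)) (Rβ q)
  ; lβ = orbLab-cong pc (λ {x} _ → cong (perm c) (sym (transp-self (length c) x))) (λ _ → refl) lβ
  ; lγ = orbLab-cong (compose p pc) (λ {x} _ → cong (α ∘ perm c) (sym (transp-self (length c) x))) (λ _ → refl) lγ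
  ; h = h ; euler = euler }
  where
  open Genus (genus-code p l ic (<⇒≤ c<n))
  pc = perm-isPerm-≤ ic (<⇒≤ c<n)
... | no j≢ = rec (R m ≟ R j) (fγ m ≟ fγ j)
  where
  m = length c
  open Genus (genus-code p l ic (<⇒≤ c<n))
  pc = perm-isPerm-≤ ic (<⇒≤ c<n)
  pγ = compose p pc
  j<n : j < n
  j<n = ≤-<-trans j≤ c<n
  τ = transp m j
  fixed : ∀ r → iter r (perm c) m ≡ m
  fixed zero = refl
  fixed (suc r) = trans (cong (perm c) (fixed r)) (perm-fix ic ≤-refl)
  -- The point m is alone in its cycle, so the transposition always merges on the side of β.
  neβ : fβ m ≢ fβ j
  neβ e with joins lβ c<n j<n e
  ... | r , er = j≢ (trans (sym er) (fixed r))
  lβ′ = orbLab-merge pc lβ c<n j<n neβ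
  #β = cls-merge (lab< lβ) c<n j<n neβ
  Rt : R m ≡ R j → ∀ {i} → R (τ i) ≡ R i
  Rt e {i} with τ i | transpView m j i
  ... | _ | isˡ refl = sym e
  ... | _ | isʳ _ refl = e
  ... | _ | isno _ _ = refl
  τ< : ∀ {i} → i < n → τ i < n
  τ< = π< (transp-isPerm c<n j<n)
  Rγ : ∀ {i k} → i < n → k < n → fγ i ≡ fγ k → R i ≡ R k
  Rγ hi hk e = stay* R pγ (λ q → trans (Rα (π< pc q)) (Rβ q)) hi (joins lγ hi hk e)
  rec : Dec (R m ≡ R j) → Dec (fγ m ≡ fγ j) → Genus n α (perm (j ∷ c)) f
  -- One cycle of β is lost and one of αβ is gained: `h` and `R` stay.
  rec (yes r) (yes g) = record
    { R = R ; fβ = merge fβ m j ; fγ = proj₁ sp ; R< = R< ; Rα = Rα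
    ; Rβ = λ q → trans (Rβ (τ< q)) (Rt r)
    ; lβ = lβ′ ; lγ = proj₁ (proj₂ sp) ; h = h
    ; euler = trans (cong (λ z → cls n f + cls n (merge fβ m j) + z + 2 * h) (proj₂ (proj₂ sp)))
        (trans (solve 4 (λ a b c d → a :+ b :+ (con 1 :+ c) :+ con 2 :* d := a :+ (con 1 :+ b) :+ c :+ con 2 :* d) refl
          (cls n f) (cls n (merge fβ m j)) (cls n fγ) h)
        (trans (cong (λ z → cls n f + z + cls n fγ + 2 * h) #β) euler)) }
    where sp = orbLab-split pγ lγ c<n j<n (j≢ ∘ sym) g
  -- Both cycle counts drop while the classes of `R` stay: `h` rises by one.
  rec (yes r) (no g) = record
    { R = R ; fβ = merge fβ m j ; fγ = merge fγ m j ; R< = R< ; Rα = Rα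
    ; Rβ = λ q → trans (Rβ (τ< q)) (Rt r)
    ; lβ = lβ′ ; lγ = orbLab-merge pγ lγ c<n j<n g ; h = suc h
    ; euler = trans (solve 4 (λ a b c d → a :+ b :+ c :+ con 2 :* (con 1 :+ d) := a :+ (con 1 :+ b) :+ (con 1 :+ c) :+ con 2 :* d) refl
          (cls n f) (cls n (merge fβ m j)) (cls n (merge fγ m j)) h)
        (trans (cong₂ (λ y z → cls n f + y + z + 2 * h) #β (cls-merge (lab< lγ) c<n j<n g)) euler) }
  -- Impossible, since `R` is constant on the cycles of αβ.
  rec (no r) (yes g) = ⊥-elim (r (Rγ c<n j<n g))
  -- Both cycle counts drop by one and so does the number of classes, which counts twice on the
  -- right: `h` stays.
  rec (no r) (no g) = record
    { R = merge R m j ; fβ = merge fβ m j ; fγ = merge fγ m j ; R< = merge-below j<n R<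
    ; Rα = λ q → merge-cong R (Rα q)
    ; Rβ = λ {i} q → trans (merge-cong R (Rβ (τ< q))) (mt i)
    ; lβ = lβ′ ; lγ = orbLab-merge pγ lγ c<n j<n g ; h = h
    ; euler = +-cancelʳ-≡ 2 _ _ (trans (solve 4 (λ a b c d → a :+ b :+ c :+ con 2 :* d :+ con 2 := a :+ (con 1 :+ b) :+ (con 1 :+ c) :+ con 2 :* d) refl
          (cls n f) (cls n (merge fβ m j)) (cls n (merge fγ m j)) h)
        (trans (cong₂ (λ y z → cls n f + y + z + 2 * h) #β (cls-merge (lab< lγ) c<n j<n g)) (trans euler
        (trans (cong (λ z → n + 2 * z) (sym (cls-merge R< c<n j<n r)))
        (solve 2 (λ a b → a :+ con 2 :* (con 1 :+ b) := a :+ con 2 :* b :+ con 2) refl n (cls n (merge R m j))))))) }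
    where
    mt : ∀ i → merge R m j (τ i) ≡ merge R m j i
    mt i with τ i | transpView m j i
    ... | _ | isˡ refl = sym (merge-joined R)
    ... | _ | isʳ _ refl = merge-joined R
    ... | _ | isno _ _ = refl

cls-const : ∀ {n f} → 1 ≤ n → Below n n f → (∀ {i} → i < n → f i ≡ f 0) → cls n f ≡ 1
cls-const {n} {f} h bf e = trans (cls-ker bf (λ _ → h) (λ a b → (λ _ → refl) , (λ _ → trans (e a) (sym (e b)))))
  (cls-image n (λ _ → 0) 1 h (λ _ → s≤s z≤n) (λ { {zero} _ → 0 , h , refl ; {suc L} (s≤s ()) }))

-- Stated through invariant labellings and not through words in α and β: it applies directly to the
-- labelling `R` of `Genus` and pulls back along a conjugation.
Transitive : ℕ → (ℕ → ℕ) → (ℕ → ℕ) → Set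
Transitive n α β = ∀ R → Below n n R → (∀ {i} → i < n → R (α i) ≡ R i) → (∀ {i} → i < n → R (β i) ≡ R i) →
                   ∀ {i} → i < n → R i ≡ R 0

-- Transitivity collapses `R` to one class, and `cls-ker` carries the counts over from the
-- labellings built along the code to the given ones.
genus-exists : ∀ {n α β γ f fβ fγ} → 1 ≤ n → IsPerm n α → IsPerm n β → (∀ {i} → i < n → α (β i) ≡ γ i) →
               OrbLab n α f → OrbLab n β fβ → OrbLab n γ fγ → Transitive n α β →
               ∃ λ h → cls n f + cls n fβ + cls n fγ + 2 * h ≡ n + 2
genus-exists {n} {α} {β} {γ} {f} {fβ} {fγ} 1≤n pα pβ eγ lα lβ lγ tr with perm-surj n pβ
... | c , c∈ , ec with codes⇒ n c∈
... | ic , refl = G.h , trans (cong₂ (λ y z → cls n f + y + z + 2 * G.h) #β #γ)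
      (trans G.euler (cong (λ z → n + 2 * z) (cls-const 1≤n G.R<
        (tr G.R G.R< G.Rα (λ q → trans (cong G.R (sym (ec q))) (G.Rβ q))))))
  where
  module G = Genus (genus-code pα lα ic ≤-refl)
  #β : cls n fβ ≡ cls n G.fβ
  #β = cls-ker (lab< lβ) (lab< G.lβ) (orbLab-ker pβ lβ (orbLab-cong (perm-isPerm ic) ec (λ _ → refl) G.lβ))
  pγ : IsPerm n (α ∘ perm c)
  pγ = compose pα (perm-isPerm ic)
  eγ′ : ∀ {x} → x < n → α (perm c x) ≡ γ x
  eγ′ q = trans (cong α (ec q)) (eγ q)
  #γ : cls n fγ ≡ cls n G.fγ
  #γ = cls-ker (lab< lγ) (lab< G.lγ) (orbLab-ker (isPerm-cong eγ′ pγ) lγ (orbLab-cong pγ eγ′ (λ _ → refl) G.lγ))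

-- Transitivity

unique-⊆-length : {A : Set} {xs ys : List A} → Unique xs → (∀ {x} → x ∈ xs → x ∈ ys) → length xs ≤ length ys
unique-⊆-length {xs = []} u sub = z≤n
unique-⊆-length {xs = x ∷ xs} u@(_ ∷ u′) sub with ∈-∃++ (sub (here refl))
... | l₁ , l₂ , refl = subst (suc (length xs) ≤_) (sym (↭-length (shift x l₁ l₂))) (s≤s (unique-⊆-length u′ sub′))
  where
  sub′ : ∀ {y} → y ∈ xs → y ∈ l₁ ++ l₂
  sub′ m with ∈-resp-↭ (shift x l₁ l₂) (sub (there m))
  ... | here refl = ⊥-elim (unique-head u m)
  ... | there m′ = m′

-- The common form of the Boolean tests `joinIsTop` and `transitive`: n closure steps from 0 along a
-- reflexive relation. Reflexivity makes the reached sets increase.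
module Closure (n : ℕ) (1≤n : 1 ≤ n) (r : ℕ → ℕ → Bool) (r-refl : ∀ j → T (r j j)) where

  step : List ℕ → List ℕ
  step X = filterᵇ (λ j → any (λ i → r i j) X) (upTo n)

  reach : ℕ → List ℕ
  reach m = iter m step [ 0 ]

  step⁻ : ∀ X {j} → j ∈ step X → j < n × (∃ λ i → i ∈ X × T (r i j))
  step⁻ X {j} m with ∈-filterᵇ⁻ (λ j → any (λ i → r i j) X) m
  ... | j∈ , h = ∈-upTo⁻ j∈ , any⇒∃ (λ i → r i j) X h

  step⁺ : ∀ {X i j} → i ∈ X → j < n → T (r i j) → j ∈ step X
  step⁺ {X} {i} {j} m h e = ∈-filterᵇ⁺ (λ j → any (λ i → r i j) X) (∈-upTo⁺ h) (∃⇒any (λ i → r i j) m e)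

  reach< : ∀ m {i} → i ∈ reach m → i < n
  reach< zero (here refl) = 1≤n
  reach< (suc m) h = proj₁ (step⁻ (reach m) h)

  grow : ∀ m {i} → i ∈ reach m → i ∈ reach (suc m)
  grow m h = step⁺ h (reach< m h) (r-refl _)

  reach-unique : ∀ m → Unique (reach m)
  reach-unique zero = [] ∷ []
  reach-unique (suc m) = Uniq.filter⁺ _ (Uniq.upTo⁺ n)

  Stable : ℕ → Set
  Stable m = ∀ {j} → j ∈ reach (suc m) → j ∈ reach m

  -- A step that is not stationary adds a point, and a stationary one remains so. Hence the reached
  -- set is stable after n steps, as it cannot have more than n elements.
  saturates : ∀ m → Stable m ⊎ m < length (reach m)
  saturates zero = inj₂ (s≤s z≤n)
  saturates (suc m) with saturates m | suc (suc m) ≤? length (reach (suc m))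
  ... | _ | yes q = inj₂ q
  ... | inj₁ st | no _ = inj₁ (λ h → let (h< , i , i∈ , e) = step⁻ (reach (suc m)) h in step⁺ (st i∈) h< e)
  ... | inj₂ lt | no q = inj₁ (λ h → let (h< , i , i∈ , e) = step⁻ (reach (suc m)) h in step⁺ (st i∈) h< e)
    where
    st : Stable m
    st {j} h with j ∈? reach m
    ... | yes p = p
    ... | no ne = ⊥-elim (q (≤-trans (s≤s lt) (unique-⊆-length (unique-∷ ne (reach-unique m))
          λ { (here refl) → h ; (there x∈) → grow m x∈ })))

  stable : Stable n
  stable with saturates n
  ... | inj₁ st = st
  ... | inj₂ lt = ⊥-elim (<⇒≱ lt (subst (length (reach n) ≤_) (length-upTo n)
        (unique-⊆-length (reach-unique n) (∈-upTo⁺ ∘ reach< n))))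

  0∈reach : ∀ m → 0 ∈ reach m
  0∈reach zero = here refl
  0∈reach (suc m) = grow m (0∈reach m)

  everything : Bool
  everything = all (λ j → mem j (reach n)) (upTo n)

  sound : T everything → (R : ℕ → ℕ) → (∀ {i j} → i < n → j < n → T (r i j) → R i ≡ R j) → ∀ {i} → i < n → R i ≡ R 0
  sound h R inv {i} i<n = go n (mem⇒∈ i (reach n) (all⇒∀ _ (upTo n) h (∈-upTo⁺ i<n)))
    where
    go : ∀ m {i} → i ∈ reach m → R i ≡ R 0
    go zero (here refl) = refl
    go (suc m) h with step⁻ (reach m) h
    ... | j<n , i , i∈ , e = trans (sym (inv (reach< m i∈) j<n e)) (go m i∈)

  -- The hypothesis is used for membership in the reached set, which `stable` shows to be closed.
  complete : ((χ : ℕ → Bool) → T (χ 0) → (∀ {i j} → i < n → j < n → T (χ i) → T (r i j) → T (χ j)) → ∀ {i} → i < n → T (χ i)) →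
             T everything
  complete h = ∀⇒all _ (upTo n) (λ m → h (λ j → mem j (reach n)) (∈⇒mem (0∈reach n))
    (λ {i} _ j<n p e → ∈⇒mem (stable (step⁺ (mem⇒∈ i (reach n) p) j<n e))) (∈-upTo⁻ m))

-- Label the points of χ by 0 and the others by 1. Closure under a permutation is already
-- invariance, because the way back is a forward power; so the labelling is constant.
transitive-closed : ∀ {n α β} → 1 ≤ n → IsPerm n α → IsPerm n β → Transitive n α β → (χ : ℕ → Bool) → T (χ 0) →
                    (∀ {i} → i < n → T (χ i) → T (χ (α i))) → (∀ {i} → i < n → T (χ i) → T (χ (β i))) →
                    ∀ {i} → i < n → T (χ i)
transitive-closed {n} 1≤n pα pβ tr χ χ0 χα χβ {i} i<n with χ i | tr R R< (invar pα χα) (invar pβ χβ) i<n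
  where
  R : ℕ → ℕ
  R i = if χ i then 0 else 1
  R< : Below n n R
  R< {zero} h rewrite T⇒≡ χ0 = h
  -- Label 1 is below n: a point outside χ is not 0, so n is at least 2.
  R< {suc i} h with χ (suc i)
  ... | true = 1≤n
  ... | false = ≤-trans (s≤s (s≤s z≤n)) h
  invar : ∀ {π} → IsPerm n π → (∀ {i} → i < n → T (χ i) → T (χ (π i))) → ∀ {i} → i < n → R (π i) ≡ R i
  invar {π} p χπ {i} h = cong (λ b → if b then 0 else 1) (bool-ext back (χπ h))
    where
    along : ∀ m {x} → x < n → T (χ x) → T (χ (iter m π x))
    along zero _ q = q
    along (suc m) hx q = χπ (iter< p m hx) (along m hx q)
    back : T (χ (π i)) → T (χ i)
    back q with orb-sym p h orb-step
    ... | m , e = subst (T ∘ χ) e (along m (π< p h) q)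
... | true | _ = _
... | false | e rewrite T⇒≡ χ0 with e
... | ()

module _ {n} (1≤n : 1 ≤ n) {α β : ℕ → ℕ} (pα : IsPerm n α) (pβ : IsPerm n β) where

  -- The strings enter only as orbit labellings, so the test gives the same answer for restricted
  -- growth strings and for orbit minima.
  joinIsTop⇔ : ∀ σ τ → OrbLab n α (nth σ) → OrbLab n β (nth τ) → T (joinIsTop n σ τ) ⇔ Transitive n α β
  joinIsTop⇔ σ τ lσ lτ = mk⇔ to from
    where
    r : ℕ → ℕ → Bool
    r i j = (nth σ i ≡ᵇ nth σ j) ∨ (nth τ i ≡ᵇ nth τ j)
    open Closure n 1≤n r (λ j → ⇐ (T-∨ {nth σ j ≡ᵇ nth σ j}) (inj₁ (≡⇒≡ᵇ (nth σ j) _ refl)))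
    to : T everything → Transitive n α β
    to h R _ Rα Rβ = sound h R inv′
      where
      inv′ : ∀ {i j} → i < n → j < n → T (r i j) → R i ≡ R j
      inv′ {i} {j} hi hj e with ⇒ (T-∨ {nth σ i ≡ᵇ nth σ j}) e
      ... | inj₁ q = stay* R pα Rα hi (joins lσ hi hj (≡ᵇ⇒≡ _ _ q))
      ... | inj₂ q = stay* R pβ Rβ hi (joins lτ hi hj (≡ᵇ⇒≡ _ _ q))
    from : Transitive n α β → T everything
    from tr = complete (λ χ χ0 cl → transitive-closed 1≤n pα pβ tr χ χ0
      (λ {i} hi q → cl hi (π< pα hi) q (⇐ (T-∨ {nth σ i ≡ᵇ nth σ (α i)}) (inj₁ (≡⇒≡ᵇ _ _ (sym (stay lσ hi))))))
      (λ {i} hi q → cl hi (π< pβ hi) q (⇐ (T-∨ {nth σ i ≡ᵇ nth σ (β i)}) (inj₂ (≡⇒≡ᵇ _ _ (sym (stay lτ hi)))))))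

-- With γ = αβ, the pairs α, γ and α, β generate the same group.
transitive⇔ : ∀ {n} α γ {β} → 1 ≤ n → IsPerm n (nth α) → IsPerm n β → (∀ {i} → i < n → nth α (β i) ≡ nth γ i) →
              T (transitive n α γ) ⇔ Transitive n (nth α) β
transitive⇔ {n} α γ {β} 1≤n pα pβ eγ = mk⇔ to from
  where
  r : ℕ → ℕ → Bool
  r i j = (j ≡ᵇ i) ∨ (nth α i ≡ᵇ j) ∨ (nth γ i ≡ᵇ j)
  open Closure n 1≤n r (λ j → ⇐ (T-∨ {j ≡ᵇ j}) (inj₁ (≡⇒≡ᵇ j j refl)))
  rα : ∀ i → T (r i (nth α i))
  rα i = ⇐ (T-∨ {nth α i ≡ᵇ i}) (inj₂ (⇐ (T-∨ {nth α i ≡ᵇ nth α i}) (inj₁ (≡⇒≡ᵇ (nth α i) _ refl))))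
  rγ : ∀ i → T (r i (nth γ i))
  rγ i = ⇐ (T-∨ {nth γ i ≡ᵇ i}) (inj₂ (⇐ (T-∨ {nth α i ≡ᵇ nth γ i}) (inj₂ (≡⇒≡ᵇ (nth γ i) _ refl))))
  to : T everything → Transitive n (nth α) β
  to h R _ Rα Rβ = sound h R inv′
    where
    inv′ : ∀ {i j} → i < n → j < n → T (r i j) → R i ≡ R j
    inv′ {i} {j} hi hj e with ⇒ (T-∨ {j ≡ᵇ i}) e
    ... | inj₁ q = cong R (sym (≡ᵇ⇒≡ j i q))
    ... | inj₂ e′ with ⇒ (T-∨ {nth α i ≡ᵇ j}) e′
    ...   | inj₁ q = trans (sym (Rα hi)) (cong R (≡ᵇ⇒≡ _ j q))
    ...   | inj₂ q = trans (sym (Rβ hi)) (trans (sym (Rα (π< pβ hi))) (trans (cong R (eγ hi)) (cong R (≡ᵇ⇒≡ _ j q))))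
  from : Transitive n (nth α) β → T everything
  from tr = complete (λ χ χ0 cl → let
      clα : ∀ {i} → i < n → T (χ i) → T (χ (nth α i))
      clα {i} hi q = cl hi (π< pα hi) q (rα i)
      clα* : ∀ m {i} → i < n → T (χ i) → T (χ (iter m (nth α) i))
      clα* = along χ clα
    in transitive-closed 1≤n pα pβ tr χ χ0 clα
      (λ {i} hi q →
        -- β i is reached by applying γ and then α⁻¹, which is a power of α
        let γi< = subst (_< n) (eγ hi) (π< pα (π< pβ hi))
            (m , e) = orb-sym pα (π< pβ hi) (1 , eγ hi)
        in subst (T ∘ χ) e (clα* m γi< (cl hi γi< q (rγ i)))))
    where
    along : (χ : ℕ → Bool) → (∀ {i} → i < n → T (χ i) → T (χ (nth α i))) → ∀ m {i} → i < n → T (χ i) → T (χ (iter m (nth α) i))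
    along χ cl zero _ q = q
    along χ cl (suc m) hi q = cl (iter< pα m hi) (along χ cl m hi q)

-- Sums over set partitions

weight : ℕ → List ℕ → ℕ
weight n b = product (map (λ s → (s ∸ 1) !) (blockSizes n b))

product-filter : (g : ℕ → ℕ) → g 0 ≡ 1 → ∀ xs → product (map g (filterᵇ (1 ≤ᵇ_) xs)) ≡ product (map g xs)
product-filter g g0 [] = refl
product-filter g g0 (zero ∷ xs) rewrite g0 = trans (product-filter g g0 xs) (sym (+-identityʳ _))
product-filter g g0 (suc x ∷ xs) = cong (g (suc x) *_) (product-filter g g0 xs)

weight-labels : ∀ n b → weight n b ≡ product (map (λ L → (count L b ∸ 1) !) (upTo n))
weight-labels n b = trans (product-filter (λ s → (s ∸ 1) !) refl (map (λ L → count L b) (upTo n)))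
  (cong product (sym (map-∘ (upTo n))))

product-change : (g g′ : ℕ → ℕ) (L a : ℕ) → g′ L ≡ g L * a → (∀ {x} → x ≢ L → g′ x ≡ g x) →
                 ∀ {xs} → Unique xs → L ∈ xs → product (map g′ xs) ≡ product (map g xs) * a
product-change g g′ L a eL eo {x ∷ xs} u (here refl) = trans
  (cong₂ _*_ eL (cong product (map-cong-∈ {f = g′} {g = g} xs λ m → eo (λ e → unique-head u (subst (_∈ xs) e m)))))
  (solve 3 (λ p q r → p :* q :* r := p :* r :* q) refl (g x) a (product (map g xs)))
product-change g g′ L a eL eo {x ∷ xs} u@(_ ∷ u′) (there m) = trans
  (cong₂ _*_ (eo (λ e → unique-head u (subst (_∈ xs) (sym e) m))) (product-change g g′ L a eL eo u′ m))
  (sym (*-assoc (g x) _ a))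

count-snoc : ∀ L b → count L (b ++ [ L ]) ≡ suc (count L b)
count-snoc L b = trans (count-++ L b [ L ]) (trans (cong (count L b +_) (count-here L [])) (+-comm (count L b) 1))

count-snoc-other : ∀ {L M} b → L ≢ M → count L (b ++ [ M ]) ≡ count L b
count-snoc-other {L} b ne = trans (count-++ L b _) (trans (cong (count L b +_) (count-other [] ne)) (+-identityʳ _))

weight-snoc : ∀ n b L a → L < n → count L b ! ≡ (count L b ∸ 1) ! * a → weight n (b ++ [ L ]) ≡ weight n b * a
weight-snoc n b L a L<n e = trans (weight-labels n (b ++ [ L ])) (trans
  (product-change (λ L → (count L b ∸ 1) !) (λ M → (count M (b ++ [ L ]) ∸ 1) !) L a
    (trans (cong (λ k → (k ∸ 1) !) (count-snoc L b)) e)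
    (λ ne → cong (λ k → (k ∸ 1) !) (count-snoc-other b ne)) (Uniq.upTo⁺ n) (∈-upTo⁺ L<n))
  (cong (_* a) (sym (weight-labels n b))))

-- The factor s! / (s-1)! = s is the number of points of the block behind which the new point can be
-- placed in a cycle.
weight-old : ∀ n b L → L < n → 1 ≤ count L b → weight n (b ++ [ L ]) ≡ weight n b * count L b
weight-old n b L h q = weight-snoc n b L (count L b) h (go (count L b) q)
  where
  go : ∀ k → 1 ≤ k → k ! ≡ (k ∸ 1) ! * k
  go (suc k) _ = *-comm (suc k) (k !)

weight-new : ∀ n b L → L < n → count L b ≡ 0 → weight n (b ++ [ L ]) ≡ weight n b
weight-new n b L h q = trans
  (weight-snoc n b L 1 h (trans (cong _! q) (cong (λ k → (k ∸ 1) ! * 1) (sym q)))) (*-identityʳ _)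

-- The invariant of the recursion rgsFrom: b is the word read so far.
record Growth (m : ℕ) (b : List ℕ) : Set where
  field
    bound : ∀ {x} → x ∈ b → x < m
    onto  : ∀ {L} → L < m → L ∈ b
    small : m ≤ length b

open Growth

growth-old : ∀ {m b L} → Growth m b → L < m → Growth m (b ++ [ L ])
growth-old {m} {b} {L} g h = record
  { bound = λ q → bnd (∈-++⁻ b q)
  ; onto = ∈-++⁺ˡ ∘ onto g
  ; small = ≤-trans (small g) (subst (length b ≤_) (sym (length-++ b)) (m≤m+n _ 1)) }
  where
  bnd : ∀ {x} → x ∈ b ⊎ x ∈ [ L ] → x < m
  bnd (inj₁ q) = bound g q
  bnd (inj₂ (here refl)) = h

growth-new : ∀ {m b} → Growth m b → Growth (suc m) (b ++ [ m ])
growth-new {m} {b} g = record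
  { bound = λ q → bnd (∈-++⁻ b q)
  ; onto = λ h → ont (m≤n⇒m<n∨m≡n (≤-pred h))
  ; small = subst (suc m ≤_) (sym (trans (length-++ b) (+-comm (length b) 1))) (s≤s (small g)) }
  where
  bnd : ∀ {x} → x ∈ b ⊎ x ∈ [ m ] → x < suc m
  bnd (inj₁ q) = m<n⇒m<1+n (bound g q)
  bnd (inj₂ (here refl)) = ≤-refl
  ont : ∀ {L} → L < m ⊎ L ≡ m → L ∈ b ++ [ m ]
  ont (inj₁ q) = ∈-++⁺ˡ (onto g q)
  ont (inj₂ refl) = ∈-++⁺ʳ b (here refl)

growth-labels : ∀ {c} → IsCode c → Growth (length (sizes c)) (labels c)
growth-labels [] = record { bound = λ () ; onto = λ () ; small = z≤n }
growth-labels {j ∷ c} (p ∷ ic) rewrite length-sizes j c with j ≡ᵇ length c in e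
... | true = growth-new (growth-labels ic)
... | false = growth-old (growth-labels ic) (labels< ic (≤∧≢⇒< p (λ q → subst T e (≡⇒≡ᵇ j (length c) q))))

module RingSums {c ℓ} (R : CommutativeRing c ℓ) (inv : ℕ → CommutativeRing.Carrier R) where
  open Formula R inv public
  private module R = CommutativeRing R
  open R using (_≈_; 0#; 1#)
    renaming (Carrier to C; _+_ to _⊕_; _*_ to _⊛_; refl to ≈-refl; sym to ≈-sym; trans to ≈-trans) public
  open Sums R.commutativeSemiring public
  open import Relation.Binary.Reasoning.Setoid R.setoid public

  ι-+ : ∀ a b → ι (a + b) ≈ ι a ⊕ ι b
  ι-+ zero b = ≈-sym (R.+-identityˡ _)
  ι-+ (suc a) b = ≈-trans (R.+-congˡ (ι-+ a b)) (≈-sym (R.+-assoc _ _ _))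

  ι-* : ∀ a b → ι (a * b) ≈ ι a ⊛ ι b
  ι-* zero b = ≈-sym (R.zeroˡ _)
  ι-* (suc a) b = begin
    ι (b + a * b)          ≈⟨ ι-+ b (a * b) ⟩
    ι b ⊕ ι (a * b)        ≈⟨ R.+-cong (≈-sym (R.*-identityˡ _)) (ι-* a b) ⟩
    1# ⊛ ι b ⊕ ι a ⊛ ι b   ≈⟨ ≈-sym (R.distribʳ _ _ _) ⟩
    (1# ⊕ ι a) ⊛ ι b       ∎

  ι-cong : ∀ {a b} → a ≡ b → ι a ≈ ι b
  ι-cong e = R.reflexive (cong ι e)

  ι-1 : ι 1 ≈ 1#
  ι-1 = R.+-identityʳ 1#

  ∑-count : ∀ m xs {F : ℕ → C} → (∀ {x} → x ∈ xs → x < m) → ∑ xs F ≈ ∑ (upTo m) (λ L → ι (count L xs) ⊛ F L)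
  ∑-count m [] h = ≈-sym (≈-trans (∑-cong (upTo m) (λ _ → R.zeroˡ _)) (∑-zero (upTo m)))
  ∑-count m (x ∷ xs) {F} h = begin
    F x ⊕ ∑ xs F  ≈⟨ R.+-cong (≈-sym (∑-delta (upTo m) (_≡ᵇ x) x (Uniq.upTo⁺ m) (∈-upTo⁺ (h (here refl)))
                       (λ {y} _ → ≡ᵇ⇒≡ y x) (≡⇒≡ᵇ x x refl))) (∑-count m xs (h ∘ there)) ⟩
    ∑ (upTo m) (λ L → when (L ≡ᵇ x) (F L)) ⊕ ∑ (upTo m) (λ L → ι (count L xs) ⊛ F L)
                  ≈⟨ ≈-sym (∑-+ (upTo m)) ⟩
    ∑ (upTo m) (λ L → when (L ≡ᵇ x) (F L) ⊕ ι (count L xs) ⊛ F L)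
                  ≈⟨ ∑-cong (upTo m) (λ {L} _ → add L) ⟩
    ∑ (upTo m) (λ L → ι (count L (x ∷ xs)) ⊛ F L) ∎
    where
    add : ∀ L → when (L ≡ᵇ x) (F L) ⊕ ι (count L xs) ⊛ F L ≈ ι (count L (x ∷ xs)) ⊛ F L
    add L with L ≡ᵇ x
    ... | true = ≈-trans (R.+-congʳ (≈-sym (R.*-identityˡ _))) (≈-sym (R.distribʳ _ _ _))
    ... | false = R.+-identityˡ _

  ∑-upTo-suc : ∀ n {F : ℕ → C} → ∑ (upTo (suc n)) F ≈ ∑ (upTo n) F ⊕ F n
  ∑-upTo-suc n {F} = ≈-trans (R.reflexive (cong (λ l → ∑ l F) (sym (upTo-∷ʳ n))))
    (≈-trans (∑-++ (upTo n) [ n ]) (R.+-congˡ (R.+-identityʳ _)))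

  module _ (G : List ℕ → C) where

    -- The sum of G over all completions by r letters of the label word b with m labels, where each position
    -- of b offers its own copy of its label.
    completions : ℕ → ℕ → List ℕ → C
    completions zero m b = G b
    completions (suc r) m b = ∑ b (λ L → completions r m (b ++ [ L ])) ⊕ completions r (suc m) (b ++ [ m ])

    -- The factor `count L b` that an old letter adds to the weight is absorbed by summing over the
    -- positions of `b` in place of its labels; a new letter adds no factor.
    ∑-rgsFrom : ∀ n r m b → Growth m b → length b + r ≡ n →
                ∑ (rgsFrom r m) (λ w → ι (weight n (b ++ w)) ⊛ G (b ++ w)) ≈ ι (weight n b) ⊛ completions r m b
    ∑-rgsFrom n zero m b g e = ≈-trans (R.+-identityʳ _) (R.reflexive (cong (λ l → ι (weight n l) ⊛ G l) (++-identityʳ b)))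
    ∑-rgsFrom n (suc r) m b g e = begin
      ∑ (concatMap (λ L → map (L ∷_) (rgsFrom r (if L ≡ᵇ m then suc m else m))) (upTo (suc m))) H
        ≈⟨ ∑-concatMap (λ L → map (L ∷_) (rgsFrom r (if L ≡ᵇ m then suc m else m))) (upTo (suc m)) ⟩
      ∑ (upTo (suc m)) (λ L → ∑ (map (L ∷_) (rgsFrom r (if L ≡ᵇ m then suc m else m))) H)
        ≈⟨ ∑-cong (upTo (suc m)) (λ {L} _ → ≈-trans (R.reflexive (∑-map (L ∷_) (rgsFrom r _)))
             (∑-cong (rgsFrom r _) (λ {w} _ → R.reflexive (cong (λ l → ι (weight n l) ⊛ G l) (sym (++-assoc b [ L ] w)))))) ⟩
      ∑ (upTo (suc m)) inner
        ≈⟨ ∑-upTo-suc m ⟩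
      ∑ (upTo m) inner ⊕ inner m
        ≈⟨ R.+-cong (∑-cong (upTo m) (λ L∈ → old (∈-upTo⁻ L∈))) new ⟩
      ∑ (upTo m) (λ L → ι (weight n b) ⊛ (ι (count L b) ⊛ completions r m (b ++ [ L ])))
        ⊕ ι (weight n b) ⊛ completions r (suc m) (b ++ [ m ])
        ≈⟨ R.+-congʳ (≈-trans (∑-*ˡ (upTo m) _) (R.*-congˡ (≈-sym (∑-count m b (bound g))))) ⟩
      ι (weight n b) ⊛ ∑ b (λ L → completions r m (b ++ [ L ])) ⊕ ι (weight n b) ⊛ completions r (suc m) (b ++ [ m ])
        ≈⟨ ≈-sym (R.distribˡ _ _ _) ⟩
      ι (weight n b) ⊛ completions (suc r) m b ∎
      where
      H : List ℕ → C
      H w = ι (weight n (b ++ w)) ⊛ G (b ++ w)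
      inner : ℕ → C
      inner L = ∑ (rgsFrom r (if L ≡ᵇ m then suc m else m)) (λ w → ι (weight n ((b ++ [ L ]) ++ w)) ⊛ G ((b ++ [ L ]) ++ w))
      len : ∀ L → length (b ++ [ L ]) + r ≡ n
      len L = trans (cong (_+ r) (trans (length-++ b) (+-comm (length b) 1))) (trans (sym (+-suc (length b) r)) e)
      m<n : m < n
      m<n = ≤-<-trans (small g) (subst (length b <_) e (m<m+n (length b) (s≤s z≤n)))
      old : ∀ {L} → L < m → inner L ≈ ι (weight n b) ⊛ (ι (count L b) ⊛ completions r m (b ++ [ L ]))
      old {L} h rewrite eqᵇ-false (<⇒≢ h) = begin
        _ ≈⟨ ∑-rgsFrom n r m (b ++ [ L ]) (growth-old g h) (len L) ⟩
        ι (weight n (b ++ [ L ])) ⊛ completions r m (b ++ [ L ])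
          ≈⟨ R.*-congʳ (≈-trans (ι-cong (weight-old n b L (<-trans h m<n) (∈⇒count-≥1 (onto g h)))) (ι-* (weight n b) (count L b))) ⟩
        (ι (weight n b) ⊛ ι (count L b)) ⊛ completions r m (b ++ [ L ]) ≈⟨ R.*-assoc _ _ _ ⟩
        _ ∎
      new : inner m ≈ ι (weight n b) ⊛ completions r (suc m) (b ++ [ m ])
      new rewrite eqᵇ-true (refl {x = m}) = ≈-trans (∑-rgsFrom n r (suc m) (b ++ [ m ]) (growth-new g) (len m))
        (R.*-congʳ (ι-cong (weight-new n b m m<n (∉⇒count-0 (λ q → <-irrefl refl (bound g q))))))

    ∑-codes-suc : ∀ n {F : List ℕ → C} → ∑ (codes (suc n)) F ≈ ∑ (codes n) (λ c → ∑ (upTo (suc n)) (λ j → F (j ∷ c)))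
    ∑-codes-suc n = ≈-trans (∑-concatMap (λ c → map (_∷ c) (upTo (suc n))) (codes n)) (∑-cong (codes n) (λ {c} _ → R.reflexive (∑-map (_∷ c) (upTo (suc n)))))

    -- For b = `labels c`, a position of `b` is an entry j < i of the extended code, and the summand
    -- for a new label is the entry j = i.
    completions-codes : ∀ i r → ∑ (codes i) (λ c → completions r (length (sizes c)) (labels c)) ≈ ∑ (codes (i + r)) (λ c → G (labels c))
    completions-codes i zero = R.reflexive (cong (λ k → ∑ (codes k) (λ c → G (labels c))) (sym (+-identityʳ i)))
    completions-codes i (suc r) = begin
      ∑ (codes i) (λ c → completions (suc r) (length (sizes c)) (labels c))
        ≈⟨ ∑-cong (codes i) (λ m → split m) ⟩
      ∑ (codes i) (λ c → ∑ (upTo (suc i)) (λ j → completions r (length (sizes (j ∷ c))) (labels (j ∷ c))))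
        ≈⟨ ≈-sym (∑-codes-suc i) ⟩
      ∑ (codes (suc i)) (λ c → completions r (length (sizes c)) (labels c))
        ≈⟨ completions-codes (suc i) r ⟩
      ∑ (codes (suc i + r)) (λ c → G (labels c))
        ≈⟨ R.reflexive (cong (λ k → ∑ (codes k) (λ c → G (labels c))) (sym (+-suc i r))) ⟩
      ∑ (codes (i + suc r)) (λ c → G (labels c)) ∎
      where
      split : ∀ {c} → c ∈ codes i → completions (suc r) (length (sizes c)) (labels c) ≈
                ∑ (upTo (suc i)) (λ j → completions r (length (sizes (j ∷ c))) (labels (j ∷ c)))
      split {c} m with codes⇒ i m
      ... | ic , refl = ≈-sym (≈-trans (∑-upTo-suc i) (R.+-cong (≈-trans (∑-cong (upTo i) (λ j∈ → old (∈-upTo⁻ j∈)))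
            (≈-trans (R.reflexive (sym (∑-map (nth (labels c)) (upTo i)))) (R.reflexive (cong (λ l → ∑ l F)
              (sym (tab-nth′ {xs = labels c} (length-labels c))))))) new))
        where
        F : ℕ → C
        F L = completions r (length (sizes c)) (labels c ++ [ L ])
        old : ∀ {j} → j < length c → completions r (length (sizes (j ∷ c))) (labels (j ∷ c)) ≈ F (nth (labels c) j)
        old {j} h rewrite length-sizes j c | eqᵇ-false (<⇒≢ h) = ≈-refl
        new : completions r (length (sizes (length c ∷ c))) (labels (length c ∷ c)) ≈
              completions r (suc (length (sizes c))) (labels c ++ [ length (sizes c) ])
        new rewrite length-sizes (length c) c | eqᵇ-true (refl {x = length c}) = ≈-refl

    ∑-P : ∀ n → ∑ (P n) (λ σ → ι (weight n σ) ⊛ G σ) ≈ ∑ (codes n) (λ c → G (labels c))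
    ∑-P n = begin
      ∑ (P n) (λ σ → ι (weight n σ) ⊛ G σ)
        ≈⟨ ∑-rgsFrom n n 0 [] (record { bound = λ () ; onto = λ () ; small = z≤n }) refl ⟩
      ι (weight n []) ⊛ completions n 0 []
        ≈⟨ R.*-congʳ (≈-trans (ι-cong (trans (weight-labels n []) (ones (upTo n)))) ι-1) ⟩
      1# ⊛ completions n 0 []
        ≈⟨ ≈-trans (R.*-identityˡ _) (≈-sym (R.+-identityʳ _)) ⟩
      ∑ (codes 0) (λ c → completions n (length (sizes c)) (labels c))
        ≈⟨ completions-codes 0 n ⟩
      ∑ (codes n) (λ c → G (labels c)) ∎
      where
      ones : ∀ (xs : List ℕ) → product (map (λ _ → 1) xs) ≡ 1
      ones [] = refl
      ones (x ∷ xs) = trans (+-identityʳ _) (ones xs)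

-- Sizes of conjugacy classes

private module ≥O = DecTotalOrder (Flip.decTotalOrder ≤-decTotalOrder)

-- Integer partitions as sorted lists, and their comparison with cycle types

data Partition : ℕ → List ℕ → Set where
  []  : ∀ {b} → Partition b []
  _∷_ : ∀ {b p l} → 1 ≤ p × p ≤ b → Partition p l → Partition b (p ∷ l)

partition-sorted : ∀ {b l} → Partition b l → Linked _≥_ l
partition-sorted [] = []
partition-sorted (_ ∷ []) = [-]
partition-sorted (_ ∷ (q ∷ d)) = proj₂ q ∷ partition-sorted (q ∷ d)

sorted-partition : ∀ {b l} → Linked _≥_ l → All (1 ≤_) l → (∀ {x} → x ∈ l → x ≤ b) → Partition b l
sorted-partition [] _ _ = []
sorted-partition [-] (a ∷ _) h = (a , h (here refl)) ∷ []
sorted-partition (q ∷ s) (a ∷ as) h = (a , h (here refl)) ∷ sorted-partition s as (bnd s q)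
  where
  bnd : ∀ {x y l} → Linked _≥_ (y ∷ l) → y ≤ x → ∀ {z} → z ∈ y ∷ l → z ≤ x
  bnd s q (here refl) = q
  bnd (q′ ∷ s) q (there m) = bnd s (≤-trans q′ q) m

partition-positive : ∀ {b l} → Partition b l → All (1 ≤_) l
partition-positive [] = []
partition-positive (q ∷ d) = proj₁ q ∷ partition-positive d

sorted-unique : ∀ {l l′} → Linked _≥_ l → Linked _≥_ l′ → l ↭ l′ → l ≡ l′
sorted-unique s s′ p = ≋⇒≡ (↗↭↗⇒≋ ≥O.totalOrder s s′ (Perm.↭⇒↭ₛ p))

∈⇒≤sum : ∀ {x xs} → x ∈ xs → x ≤ sum xs
∈⇒≤sum {xs = y ∷ ys} (here refl) = m≤m+n y (sum ys)
∈⇒≤sum {xs = y ∷ ys} (there m) = ≤-trans (∈⇒≤sum m) (m≤n+m (sum ys) y)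

private
  parts : ℕ → ℕ → List ℕ
  parts m b = filterᵇ (λ p → p ≤ᵇ b) (map suc (upTo (suc m)))

  parts⁻ : ∀ m b {p} → p ∈ parts m b → (1 ≤ p × p ≤ b) × p ≤ suc m
  parts⁻ m b h with ∈-filterᵇ⁻ (λ p → p ≤ᵇ b) h
  ... | h₁ , h₂ with ∈-map⁻ suc h₁
  ... | q , q∈ , refl = (s≤s z≤n , ≤ᵇ⇒≤ _ b h₂) , ∈-upTo⁻ q∈

  parts⁺ : ∀ m b {p} → 1 ≤ p × p ≤ b → p ≤ suc m → p ∈ parts m b
  parts⁺ m b {suc p} (_ , h) h′ = ∈-filterᵇ⁺ (λ p → p ≤ᵇ b) (∈-map⁺ suc (∈-upTo⁺ h′)) (≤⇒≤ᵇ h)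

∈ipf⇒ : ∀ fuel m b {l} → l ∈ ipf fuel m b → Partition b l × sum l ≡ m
∈ipf⇒ fuel zero b (here refl) = [] , refl
∈ipf⇒ (suc fuel) (suc m) b h with ∈-concatMap-elim (λ p → map (p ∷_) (ipf fuel (suc m ∸ p) p)) (parts m b) h
... | p , p∈ , h′ with ∈-map⁻ (p ∷_) h′ | parts⁻ m b p∈
... | l , l∈ , refl | q , le with ∈ipf⇒ fuel (suc m ∸ p) p l∈
... | d , e = (q ∷ d) , trans (cong (p +_) e) (m+[n∸m]≡n le)

-- Parts are positive, so each unit of fuel is matched by a drop of the remaining sum by at least
-- one.
⇒∈ipf : ∀ fuel {b l} → Partition b l → sum l ≤ fuel → l ∈ ipf fuel (sum l) b
⇒∈ipf fuel [] h = here refl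
⇒∈ipf (suc fuel) {b} {suc p ∷ l} (q ∷ d) (s≤s h) =
  ∈-concatMap-intro (λ p → map (p ∷_) (ipf fuel (suc m ∸ p) p)) (parts⁺ m b q (s≤s (m≤m+n p (sum l))))
    (∈-map⁺ (suc p ∷_) (subst (λ k → l ∈ ipf fuel k (suc p)) (sym (m+n∸m≡n p (sum l)))
      (⇒∈ipf fuel d (≤-trans (m≤n+m (sum l) p) h))))
  where m = p + sum l
⇒∈ipf zero {b} {suc p ∷ l} (q ∷ d) ()
⇒∈ipf _ {b} {zero ∷ l} ((() , _) ∷ d) h

ipf-unique : ∀ fuel m b → Unique (ipf fuel m b)
ipf-unique fuel zero b = [] ∷ []
ipf-unique zero (suc m) b = []
ipf-unique (suc fuel) (suc m) b = unique-concatMap (λ p → map (p ∷_) (ipf fuel (suc m ∸ p) p))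
  (Uniq.filter⁺ (T? ∘ (λ p → p ≤ᵇ b)) (Uniq.map⁺ suc-injective (Uniq.upTo⁺ (suc m))))
  (λ {p} _ → Uniq.map⁺ (proj₂ ∘ ∷-injective) (ipf-unique fuel (suc m ∸ p) p))
  λ {x} {y} _ _ p q → let (_ , _ , e) = ∈-map⁻ (x ∷_) p ; (_ , _ , e′) = ∈-map⁻ (y ∷_) q in
    proj₁ (∷-injective (trans (sym e) e′))

-- Equality as multisets in Boolean form, so that it can serve as a condition under a sum. The order
-- of `sort` is the non-increasing one, so sorted lists of sizes are integer partitions.
same : List ℕ → List ℕ → Bool
same l ζ = isYes (≡-dec _≟_ (sort l) (sort ζ))

same⇔ : ∀ l ζ → T (same l ζ) ⇔ (l ↭ ζ)
same⇔ l ζ = mk⇔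
  (λ h → ↭-trans (↭-sym (sort-↭ l)) (↭-trans (↭-reflexive (toWitness {a? = ≡-dec _≟_ (sort l) (sort ζ)} h)) (sort-↭ ζ)))
  (λ p → fromWitness {a? = ≡-dec _≟_ (sort l) (sort ζ)}
    (sorted-unique (sort-↗ l) (sort-↗ ζ) (↭-trans (sort-↭ l) (↭-trans p (↭-sym (sort-↭ ζ))))))

nth-incAt : ∀ i xs → i < length xs → nth (incAt i xs) i ≡ suc (nth xs i)
nth-incAt zero (x ∷ xs) h = refl
nth-incAt (suc i) (x ∷ xs) (s≤s h) = nth-incAt i xs h

nth-incAt-other : ∀ i xs {k} → k ≢ i → nth (incAt i xs) k ≡ nth xs k
nth-incAt-other i [] ne = refl
nth-incAt-other zero (x ∷ xs) {zero} ne = ⊥-elim (ne refl)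
nth-incAt-other zero (x ∷ xs) {suc k} ne = refl
nth-incAt-other (suc i) (x ∷ xs) {zero} ne = refl
nth-incAt-other (suc i) (x ∷ xs) {suc k} ne = nth-incAt-other i xs (ne ∘ cong suc)

incAt-↭ : ∀ i xs → i < length xs → ∃ λ ys → xs ↭ nth xs i ∷ ys × incAt i xs ↭ suc (nth xs i) ∷ ys
incAt-↭ zero (x ∷ xs) h = xs , ↭-refl , ↭-refl
incAt-↭ (suc i) (x ∷ xs) (s≤s h) with incAt-↭ i xs h
... | ys , p , q = x ∷ ys , ↭-trans (prep x p) (swap x _ ↭-refl) , ↭-trans (prep x q) (swap x _ ↭-refl)

sizes-count : ∀ {c} → IsCode c → ∀ {L} → L < length (sizes c) → count L (labels c) ≡ nth (sizes c) L
sizes-count {j ∷ c} (p ∷ ic) {L} h with j ≡ᵇ length c in e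
... | true with m≤n⇒m<n∨m≡n (≤-pred (subst (L <_) (trans (length-++ (sizes c)) (+-comm _ 1)) h))
...   | inj₁ q = trans (count-snoc-other (labels c) (<⇒≢ q)) (trans (sizes-count ic q) (sym (nth-++ˡ (sizes c) [ 1 ] q)))
...   | inj₂ refl = trans (count-snoc L (labels c)) (trans
          (cong suc (∉⇒count-0 (λ m → <-irrefl refl (Growth.bound (growth-labels ic) m)))) (sym (nth-snoc (sizes c) 1)))
sizes-count {j ∷ c} (p ∷ ic) {L} h | false with L ≟ nth (labels c) j
... | yes refl = trans (count-snoc L (labels c)) (trans (cong suc (sizes-count ic L<)) (sym (nth-incAt L (sizes c) L<)))
  where L< = subst (L <_) (length-incAt L (sizes c)) h
... | no ne = trans (count-snoc-other (labels c) ne) (trans (sizes-count ic (subst (L <_) (length-incAt _ (sizes c)) h))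
        (sym (nth-incAt-other _ (sizes c) ne)))

label< : ∀ {j c} → IsCode c → j ≤ length c → (j ≡ᵇ length c) ≡ false → nth (labels c) j < length (sizes c)
label< {j} {c} ic p e = labels< ic (≤∧≢⇒< p (λ q → subst T e (≡⇒≡ᵇ j (length c) q)))

sizes-positive : ∀ {c} → IsCode c → All (1 ≤_) (sizes c)
sizes-positive [] = []
sizes-positive {j ∷ c} (p ∷ ic) with j ≡ᵇ length c in e
... | true = All-resp-↭ (↭-sym (shift 1 (sizes c) [])) (s≤s z≤n ∷ subst (All (1 ≤_)) (sym (++-identityʳ _)) (sizes-positive ic))
... | false with incAt-↭ (nth (labels c) j) (sizes c) (label< ic p e)
...   | ys , q , q′ with All-resp-↭ q (sizes-positive ic)
...   | _ ∷ a = All-resp-↭ (↭-sym q′) (s≤s z≤n ∷ a)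

sum-sizes : ∀ {c} → IsCode c → sum (sizes c) ≡ length c
sum-sizes [] = refl
sum-sizes {j ∷ c} (p ∷ ic) with j ≡ᵇ length c in e
... | true = trans (sum-++ (sizes c) [ 1 ]) (trans (+-comm (sum (sizes c)) 1) (cong suc (sum-sizes ic)))
... | false with incAt-↭ (nth (labels c) j) (sizes c) (label< ic p e)
...   | ys , q , q′ = trans (sum-↭ q′) (cong suc (trans (sym (sum-↭ q)) (sum-sizes ic)))

remove : ℕ → List ℕ → List ℕ
remove x [] = []
remove x (y ∷ ys) = if x ≡ᵇ y then ys else y ∷ remove x ys

remove-↭ : ∀ {x ys} → x ∈ ys → ys ↭ x ∷ remove x ys
remove-↭ {x} {y ∷ ys} m with x ≡ᵇ y in e
... | true = ↭-reflexive (cong (_∷ ys) (sym (≡ᵇ⇒≡ x y (subst T (sym e) _))))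
remove-↭ {x} {y ∷ ys} (here refl) | false = ⊥-elim (subst T e (≡⇒≡ᵇ x x refl))
remove-↭ {x} {y ∷ ys} (there m) | false = ↭-trans (prep y (remove-↭ m)) (swap y x ↭-refl)

∷-same : ∀ x l ζ → same (x ∷ l) ζ ≡ (mem x ζ ∧ same l (remove x ζ))
∷-same x l ζ = bool-ext
  (λ h → let p = ⇒ (same⇔ _ ζ) h ; x∈ = ∈-resp-↭ p (here refl) in
    ⇐ T-∧ (∈⇒mem x∈ , ⇐ (same⇔ l _) (drop-∷ (↭-trans p (remove-↭ x∈)))))
  (λ h → let (a , b) = ⇒ (T-∧ {mem x ζ}) h in
    ⇐ (same⇔ _ ζ) (↭-trans (prep x (⇒ (same⇔ l _) b)) (↭-sym (remove-↭ (mem⇒∈ x ζ a)))))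

same-↭ : ∀ {l l′} ζ → l ↭ l′ → same l ζ ≡ same l′ ζ
same-↭ {l} {l′} ζ p = bool-ext (λ h → ⇐ (same⇔ l′ ζ) (↭-trans (↭-sym p) (⇒ (same⇔ l ζ) h)))
                               (λ h → ⇐ (same⇔ l ζ) (↭-trans p (⇒ (same⇔ l′ ζ) h)))

-- The order of the centraliser of a permutation of cycle type ζ.
zee : ℕ → List ℕ → ℕ
zee n ζ = product ζ * product (map (λ i → (t i ζ) !) (map suc (upTo n)))

zee-↭ : ∀ n {ζ ζ′} → ζ ↭ ζ′ → zee n ζ ≡ zee n ζ′
zee-↭ n p = cong₂ _*_ (product-↭ p) (cong product (map-cong (λ i → cong _! (count-↭ i p)) (map suc (upTo n))))

zee-∷ : ∀ n x ζ → 1 ≤ x → x ≤ n → zee n (x ∷ ζ) ≡ zee n ζ * (x * suc (t x ζ))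
zee-∷ n (suc x) ζ _ h = trans (cong (suc x * product ζ *_)
    (product-change (λ i → (t i ζ) !) (λ i → (t i (suc x ∷ ζ)) !) (suc x) (suc (t (suc x) ζ))
      (trans (cong _! (count-here (suc x) ζ)) (*-comm (suc (t (suc x) ζ)) _))
      (λ ne → cong _! (count-other ζ ne))
      (Uniq.map⁺ suc-injective (Uniq.upTo⁺ n)) (∈-map⁺ suc (∈-upTo⁺ h))))
  (solve 4 (λ a b c d → a :* b :* (c :* d) := b :* c :* (a :* d)) refl (suc x) (product ζ)
    (product (map (λ i → (t i ζ) !) (map suc (upTo n)))) (suc (t (suc x) ζ)))

zee-remove : ∀ n {x ζ} → 1 ≤ x → x ≤ n → x ∈ ζ → zee n ζ ≡ zee n (remove x ζ) * (x * t x ζ)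
zee-remove n {x} {ζ} h h′ m = trans (zee-↭ n (remove-↭ m)) (trans (zee-∷ n x (remove x ζ) h h′)
  (cong (λ k → zee n (remove x ζ) * (x * k)) (sym (trans (count-↭ x (remove-↭ m)) (count-here x (remove x ζ))))))

module ClassSizes {c ℓ} (R : CommutativeRing c ℓ) (inv : ℕ → CommutativeRing.Carrier R) where
  open RingSums R inv public
  private module R = CommutativeRing R

  -- The number of permutations of cycle type ζ, as an element of the ring.
  N : ℕ → List ℕ → C
  N n ζ = ∑ (codes n) (λ c → when (same (sizes c) ζ) 1#)

  ∑-upTo-0 : ∀ n {F : ℕ → C} → ∑ (upTo (suc n)) F ≈ F 0 ⊕ ∑ (upTo n) (F ∘ suc)
  ∑-upTo-0 n {F} = R.+-congˡ (≈-trans (R.reflexive (cong (λ l → ∑ l F) (sym (map-upTo suc n)))) (R.reflexive (∑-map suc (upTo n))))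

  when-∧ : ∀ a b {x} → when (a ∧ b) x ≈ when a (when b x)
  when-∧ true b = ≈-refl
  when-∧ false b = ≈-refl

  ∑-ι : ∀ xs → ∑ xs ι ≈ ι (sum xs)
  ∑-ι [] = ≈-refl
  ∑-ι (x ∷ xs) = ≈-trans (R.+-congˡ (∑-ι xs)) (≈-sym (ι-+ x (sum xs)))

  -- Types of the codes that extend to type ζ by enlarging a block of size p + 1, with multiplicity the total size
  -- of the blocks that can be enlarged.
  growths : List ℕ → List ℕ → ℕ → C
  growths ζ l p = ι (suc p * suc (t (suc p) (remove (2 + p) ζ))) ⊛
                  when (mem (2 + p) ζ) (when (same l (suc p ∷ remove (2 + p) ζ)) 1#)

  children : ∀ n ζ {d} → d ∈ codes n →
    ∑ (upTo (suc n)) (λ j → when (same (sizes (j ∷ d)) ζ) 1#) ≈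
    when (mem 1 ζ) (when (same (sizes d) (remove 1 ζ)) 1#) ⊕ ∑ (upTo n) (growths ζ (sizes d))
  children n ζ {d} m with codes⇒ n m
  ... | ic , refl = begin
    ∑ (upTo (suc n)) (λ j → when (same (sizes (j ∷ d)) ζ) 1#)
      ≈⟨ ∑-upTo-suc n ⟩
    ∑ (upTo n) (λ j → when (same (sizes (j ∷ d)) ζ) 1#) ⊕ when (same (sizes (n ∷ d)) ζ) 1#
      ≈⟨ R.+-cong (≈-trans (∑-cong (upTo n) (λ j∈ → old (∈-upTo⁻ j∈))) grown) new ⟩
    ∑ (upTo n) (growths ζ (sizes d)) ⊕ when (mem 1 ζ) (when (same (sizes d) (remove 1 ζ)) 1#)
      ≈⟨ R.+-comm _ _ ⟩
    _ ∎
    where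
    Y : ℕ → C
    Y p = when (mem (suc p) ζ) (when (same (sizes d) (p ∷ remove (suc p) ζ)) 1#)
    inc : ∀ {L} → L < length (sizes d) → when (same (incAt L (sizes d)) ζ) 1# ≈ Y (nth (sizes d) L)
    inc {L} h with incAt-↭ L (sizes d) h
    ... | ys , q , q′ = ≈-trans (when-cong (trans (same-↭ ζ q′) (trans (∷-same (suc (nth (sizes d) L)) ys ζ) (cong (mem (suc (nth (sizes d) L)) ζ ∧_) (bool-ext
          (λ s → ⇐ (same⇔ (sizes d) _) (↭-trans q (prep _ (⇒ (same⇔ ys _) s))))
          (λ s → ⇐ (same⇔ ys _) (drop-∷ (↭-trans (↭-sym q) (⇒ (same⇔ (sizes d) _) s)))))))) (λ _ → ≈-refl))
          (when-∧ (mem (suc (nth (sizes d) L)) ζ) _)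
    old : ∀ {j} → j < n → when (same (sizes (j ∷ d)) ζ) 1# ≈ Y (nth (sizes d) (nth (labels d) j))
    old {j} h rewrite eqᵇ-false (<⇒≢ h) = inc (labels< ic h)
    k = length (sizes d)
    -- The entry j matters only through the size p of its block. The sum is regrouped twice: a block
    -- of size p accounts for p values of j, and blocks of equal size contribute their number.
    grown : ∑ (upTo n) (λ j → Y (nth (sizes d) (nth (labels d) j))) ≈ ∑ (upTo n) (growths ζ (sizes d))
    grown = begin
      ∑ (upTo n) (λ j → Y (nth (sizes d) (nth (labels d) j)))
        ≈⟨ R.reflexive (trans (sym (∑-map (nth (labels d)) (upTo n) {Y ∘ nth (sizes d)}))
             (cong (λ l → ∑ l (Y ∘ nth (sizes d))) (sym (tab-nth′ {xs = labels d} (length-labels d))))) ⟩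
      ∑ (labels d) (Y ∘ nth (sizes d))
        ≈⟨ ∑-count k (labels d) (Growth.bound (growth-labels ic)) ⟩
      ∑ (upTo k) (λ L → ι (count L (labels d)) ⊛ Y (nth (sizes d) L))
        ≈⟨ ∑-cong (upTo k) (λ L∈ → R.*-congʳ (ι-cong (sizes-count ic (∈-upTo⁻ L∈)))) ⟩
      ∑ (upTo k) (λ L → ι (nth (sizes d) L) ⊛ Y (nth (sizes d) L))
        ≈⟨ R.reflexive (trans (sym (∑-map (nth (sizes d)) (upTo k) {λ p → ι p ⊛ Y p}))
             (cong (λ l → ∑ l (λ p → ι p ⊛ Y p)) (tab-nth (sizes d)))) ⟩
      ∑ (sizes d) (λ p → ι p ⊛ Y p)
        ≈⟨ ∑-count (suc n) (sizes d) (λ m → s≤s (subst (_ ≤_) (sum-sizes ic) (∈⇒≤sum m))) ⟩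
      ∑ (upTo (suc n)) (λ p → ι (count p (sizes d)) ⊛ (ι p ⊛ Y p))
        ≈⟨ ∑-upTo-0 n ⟩
      ι (count 0 (sizes d)) ⊛ (ι 0 ⊛ Y 0) ⊕ ∑ (upTo n) (λ p → ι (count (suc p) (sizes d)) ⊛ (ι (suc p) ⊛ Y (suc p)))
        ≈⟨ R.+-cong (≈-trans (R.*-congˡ (R.zeroˡ _)) (R.zeroʳ _)) (∑-cong (upTo n) (λ {p} _ → part p)) ⟩
      0# ⊕ ∑ (upTo n) (growths ζ (sizes d))
        ≈⟨ R.+-identityˡ _ ⟩
      ∑ (upTo n) (growths ζ (sizes d)) ∎
      where
      -- If the types match, the number of blocks of size p + 1 can be read off the target type and
      -- no longer depends on `d`; otherwise both sides vanish.
      part : ∀ p → ι (count (suc p) (sizes d)) ⊛ (ι (suc p) ⊛ Y (suc p)) ≈ growths ζ (sizes d) p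
      part p with mem (2 + p) ζ
      ... | false = ≈-trans (≈-trans (R.*-congˡ (R.zeroʳ _)) (R.zeroʳ _)) (≈-sym (R.zeroʳ _))
      ... | true with same (sizes d) (suc p ∷ remove (2 + p) ζ) in e
      ...   | false = ≈-trans (≈-trans (R.*-congˡ (R.zeroʳ _)) (R.zeroʳ _)) (≈-sym (R.zeroʳ _))
      ...   | true = ≈-trans (≈-sym (R.*-assoc _ _ _)) (R.*-congʳ (≈-trans (≈-sym (ι-* (count (suc p) (sizes d)) (suc p)))
              (ι-cong (trans (*-comm (count (suc p) (sizes d)) (suc p)) (cong (suc p *_)
                (trans (count-↭ (suc p) (⇒ (same⇔ (sizes d) _) (subst T (sym e) _))) (count-here (suc p) (remove (2 + p) ζ))))))))
    new : when (same (sizes (n ∷ d)) ζ) 1# ≈ when (mem 1 ζ) (when (same (sizes d) (remove 1 ζ)) 1#)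
    new rewrite eqᵇ-true (refl {x = n}) = ≈-trans
      (when-cong (trans (same-↭ ζ (↭-trans (shift 1 (sizes d) []) (↭-reflexive (cong (1 ∷_) (++-identityʳ (sizes d))))))
        (∷-same 1 (sizes d) ζ)) (λ _ → ≈-refl)) (when-∧ (mem 1 ζ) _)

  N-suc : ∀ n ζ → N (suc n) ζ ≈ when (mem 1 ζ) (N n (remove 1 ζ)) ⊕
            ∑ (upTo n) (λ p → ι (suc p * suc (t (suc p) (remove (2 + p) ζ))) ⊛ when (mem (2 + p) ζ) (N n (suc p ∷ remove (2 + p) ζ)))
  N-suc n ζ = begin
    N (suc n) ζ
      ≈⟨ ∑-codes-suc (λ _ → 0#) n ⟩
    ∑ (codes n) (λ d → ∑ (upTo (suc n)) (λ j → when (same (sizes (j ∷ d)) ζ) 1#))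
      ≈⟨ ∑-cong (codes n) (λ m → children n ζ m) ⟩
    ∑ (codes n) (λ d → when (mem 1 ζ) (when (same (sizes d) (remove 1 ζ)) 1#) ⊕ ∑ (upTo n) (growths ζ (sizes d)))
      ≈⟨ ∑-+ (codes n) ⟩
    ∑ (codes n) (λ d → when (mem 1 ζ) (when (same (sizes d) (remove 1 ζ)) 1#)) ⊕ ∑ (codes n) (λ d → ∑ (upTo n) (growths ζ (sizes d)))
      ≈⟨ R.+-cong (≈-sym (when-∑ (mem 1 ζ) (codes n))) (≈-trans (∑-swap (codes n) (upTo n))
           (∑-cong (upTo n) (λ {p} _ → ≈-trans (∑-*ˡ (codes n) _) (R.*-congˡ (≈-sym (when-∑ (mem (2 + p) ζ) (codes n))))))) ⟩
    _ ∎

  -- Each part q = p + 1 of ζ accounts for the share q t_q(ζ) / (n + 1) of (n + 1)!, since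
  -- z(ζ) p t_p(ζ′) = z(ζ′) q t_q(ζ) when ζ′ arises from ζ by lowering one part q to p.
  class-size : ∀ M n ζ → n ≤ M → All (1 ≤_) ζ → sum ζ ≡ n → ι (zee M ζ) ⊛ N n ζ ≈ ι (n !)
  class-size M zero [] h a e = begin
    ι (zee M []) ⊛ N 0 []
      ≈⟨ R.*-cong (ι-cong (trans (+-identityʳ _) (ones (upTo M)))) (≈-trans (R.+-identityʳ _) (when-true (⇐ (same⇔ [] []) ↭-refl))) ⟩
    ι 1 ⊛ 1#  ≈⟨ R.*-identityʳ _ ⟩
    ι 1 ∎
    where
    ones : ∀ (xs : List ℕ) → product (map (λ i → (t i []) !) (map suc xs)) ≡ 1
    ones [] = refl
    ones (x ∷ xs) = trans (+-identityʳ _) (ones xs)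
  class-size M zero (suc x ∷ ζ) h a ()
  class-size M zero (zero ∷ ζ) h (() ∷ _) e
  -- The range `M` of the factorials in `zee` stays fixed while n falls, so all values compared are
  -- values of one function.
  class-size M (suc n) ζ h a e = begin
    ι (zee M ζ) ⊛ N (suc n) ζ
      ≈⟨ R.*-congˡ (N-suc n ζ) ⟩
    ι (zee M ζ) ⊛ (when (mem 1 ζ) (N n (remove 1 ζ)) ⊕ ∑ (upTo n) grown)
      ≈⟨ ≈-trans (R.distribˡ _ _ _) (R.+-congˡ (≈-sym (∑-*ˡ (upTo n) _))) ⟩
    ι (zee M ζ) ⊛ when (mem 1 ζ) (N n (remove 1 ζ)) ⊕ ∑ (upTo n) (λ p → ι (zee M ζ) ⊛ grown p)
      ≈⟨ R.+-cong first (∑-cong (upTo n) (λ p∈ → other (∈-upTo⁻ p∈))) ⟩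
    ι (n !) ⊛ (ι (t 1 ζ) ⊛ ι 1) ⊕ ∑ (upTo n) (λ p → ι (n !) ⊛ (ι (t (2 + p) ζ) ⊛ ι (2 + p)))
      ≈⟨ ≈-trans (R.+-congˡ (∑-*ˡ (upTo n) _)) (≈-sym (R.distribˡ _ _ _)) ⟩
    ι (n !) ⊛ (ι (t 1 ζ) ⊛ ι 1 ⊕ ∑ (upTo n) (λ p → ι (t (2 + p) ζ) ⊛ ι (2 + p)))
      ≈⟨ R.*-congˡ total ⟩
    ι (n !) ⊛ ι (suc n)
      ≈⟨ ≈-trans (≈-sym (ι-* (n !) (suc n))) (ι-cong (*-comm (n !) (suc n))) ⟩
    ι (suc n !) ∎
    where
    grown : ℕ → C
    grown p = ι (suc p * suc (t (suc p) (remove (2 + p) ζ))) ⊛ when (mem (2 + p) ζ) (N n (suc p ∷ remove (2 + p) ζ))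
    -- The shares add up to ∑ q t_q(ζ), the sum of the parts. A vanishing term q = 0 completes the
    -- range for `∑-count`.
    total : ι (t 1 ζ) ⊛ ι 1 ⊕ ∑ (upTo n) (λ p → ι (t (2 + p) ζ) ⊛ ι (2 + p)) ≈ ι (suc n)
    total = begin
      ι (t 1 ζ) ⊛ ι 1 ⊕ ∑ (upTo n) (λ p → ι (t (2 + p) ζ) ⊛ ι (2 + p))
        ≈⟨ ≈-sym (∑-upTo-0 n) ⟩
      ∑ (upTo (suc n)) (λ p → ι (t (suc p) ζ) ⊛ ι (suc p))
        ≈⟨ ≈-sym (≈-trans (R.+-congʳ (R.zeroʳ _)) (R.+-identityˡ _)) ⟩
      ι (t 0 ζ) ⊛ ι 0 ⊕ ∑ (upTo (suc n)) (λ p → ι (t (suc p) ζ) ⊛ ι (suc p))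
        ≈⟨ ≈-sym (∑-upTo-0 (suc n)) ⟩
      ∑ (upTo (2 + n)) (λ p → ι (t p ζ) ⊛ ι p)
        ≈⟨ ≈-sym (∑-count (2 + n) ζ (λ m → s≤s (subst (_ ≤_) e (∈⇒≤sum m)))) ⟩
      ∑ ζ ι ≈⟨ ∑-ι ζ ⟩
      ι (sum ζ) ≈⟨ ι-cong e ⟩
      ι (suc n) ∎
    sum-remove : ∀ {x} → x ∈ ζ → x + sum (remove x ζ) ≡ suc n
    sum-remove m = trans (sym (sum-↭ (remove-↭ m))) e
    pos-remove : ∀ {x} → x ∈ ζ → All (1 ≤_) (remove x ζ)
    pos-remove m with All-resp-↭ (remove-↭ m) a
    ... | _ ∷ a′ = a′
    first : ι (zee M ζ) ⊛ when (mem 1 ζ) (N n (remove 1 ζ)) ≈ ι (n !) ⊛ (ι (t 1 ζ) ⊛ ι 1)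
    first with mem 1 ζ in q
    ... | false = ≈-trans (R.zeroʳ _) (≈-sym (≈-trans (R.*-congˡ (≈-trans (R.*-congʳ (ι-cong
            (∉⇒count-0 {1} {ζ} (λ m → subst T q (∈⇒mem m))))) (R.zeroˡ _))) (R.zeroʳ _)))
    ... | true = begin
      ι (zee M ζ) ⊛ N n (remove 1 ζ)
        ≈⟨ R.*-congʳ (≈-trans (ι-cong (trans (zee-remove M ≤-refl (≤-trans (s≤s z≤n) h) 1∈) (*-comm (zee M (remove 1 ζ)) (1 * t 1 ζ))))
             (ι-* (1 * t 1 ζ) (zee M (remove 1 ζ)))) ⟩
      (ι (1 * t 1 ζ) ⊛ ι (zee M (remove 1 ζ))) ⊛ N n (remove 1 ζ)
        ≈⟨ R.*-assoc _ _ _ ⟩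
      ι (1 * t 1 ζ) ⊛ (ι (zee M (remove 1 ζ)) ⊛ N n (remove 1 ζ))
        ≈⟨ R.*-cong (≈-trans (ι-cong (*-comm 1 (t 1 ζ))) (ι-* (t 1 ζ) 1))
             (class-size M n (remove 1 ζ) (<⇒≤ h) (pos-remove 1∈) (suc-injective (sum-remove 1∈))) ⟩
      (ι (t 1 ζ) ⊛ ι 1) ⊛ ι (n !)
        ≈⟨ R.*-comm _ _ ⟩
      _ ∎
      where
      1∈ : 1 ∈ ζ
      1∈ = mem⇒∈ 1 ζ (subst T (sym q) _)
    other : ∀ {p} → p < n → ι (zee M ζ) ⊛ grown p ≈ ι (n !) ⊛ (ι (t (2 + p) ζ) ⊛ ι (2 + p))
    other {p} p<n with mem (2 + p) ζ in q
    ... | false = ≈-trans (≈-trans (R.*-congˡ (R.zeroʳ _)) (R.zeroʳ _)) (≈-sym (≈-trans (R.*-congˡ (≈-trans (R.*-congʳ (ι-cong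
            (∉⇒count-0 {2 + p} {ζ} (λ m → subst T q (∈⇒mem m))))) (R.zeroˡ _))) (R.zeroʳ _)))
    ... | true = begin
      ι (zee M ζ) ⊛ (ι w ⊛ N n ζ′)
        ≈⟨ ≈-trans (≈-sym (R.*-assoc _ _ _)) (R.*-congʳ (≈-trans (≈-sym (ι-* (zee M ζ) w)) (≈-trans (ι-cong zz) (ι-* (t (2 + p) ζ * (2 + p)) (zee M ζ′))))) ⟩
      (ι (t (2 + p) ζ * (2 + p)) ⊛ ι (zee M ζ′)) ⊛ N n ζ′
        ≈⟨ R.*-assoc _ _ _ ⟩
      ι (t (2 + p) ζ * (2 + p)) ⊛ (ι (zee M ζ′) ⊛ N n ζ′)
        ≈⟨ R.*-cong (ι-* (t (2 + p) ζ) (2 + p)) (class-size M n ζ′ (<⇒≤ h) (s≤s z≤n ∷ pos-remove p∈) (suc-injective (sum-remove p∈))) ⟩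
      (ι (t (2 + p) ζ) ⊛ ι (2 + p)) ⊛ ι (n !)
        ≈⟨ R.*-comm _ _ ⟩
      _ ∎
      where
      rest = remove (2 + p) ζ
      ζ′ = suc p ∷ rest
      w = suc p * suc (t (suc p) rest)
      p∈ : 2 + p ∈ ζ
      p∈ = mem⇒∈ (2 + p) ζ (subst T (sym q) _)
      p≤M : 2 + p ≤ M
      p≤M = ≤-trans (s≤s p<n) h
      zz : zee M ζ * w ≡ t (2 + p) ζ * (2 + p) * zee M ζ′
      zz = trans (cong (_* w) (zee-remove M (s≤s z≤n) p≤M p∈)) (trans
        (solve 4 (λ a b c d → a :* (b :* c) :* d := c :* b :* (a :* d)) refl (zee M rest) (2 + p) (t (2 + p) ζ) w)
        (cong (t (2 + p) ζ * (2 + p) *_) (sym (zee-∷ M (suc p) rest (s≤s z≤n) (<⇒≤ p≤M)))))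

-- Conjugation to the permutation γ_ζ

-- The list holds the points after the start, and the arrow into the end point is included; so a
-- cycle is a path from its head back to its head.
data Path (π : ℕ → ℕ) : ℕ → List ℕ → ℕ → Set where
  done : ∀ {x y} → π x ≡ y → Path π x [] y
  step : ∀ {x y z l} → π x ≡ z → Path π z l y → Path π x (z ∷ l) y

data IsCycle (π : ℕ → ℕ) : List ℕ → Set where
  cycle : ∀ {x l} → Path π x l x → IsCycle π (x ∷ l)

-- It leaves a list without `j` alone, so it can be mapped over all cycles without locating the
-- right one.
insAfter : ℕ → ℕ → List ℕ → List ℕ
insAfter n j [] = []
insAfter n j (x ∷ l) = x ∷ (if x ≡ᵇ j then n ∷ insAfter n j l else insAfter n j l)

insAfter-∉ : ∀ n j l → j ∉ l → insAfter n j l ≡ l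
insAfter-∉ n j [] h = refl
insAfter-∉ n j (x ∷ l) h rewrite eqᵇ-false {x} {j} (λ e → h (here (sym e))) = cong (x ∷_) (insAfter-∉ n j l (h ∘ there))

insAfter-↭ : ∀ n j l → Unique l → j ∈ l → insAfter n j l ↭ n ∷ l
insAfter-↭ n j (x ∷ l) u m with x ≟ j
... | yes refl rewrite eqᵇ-true (refl {x = x}) | insAfter-∉ n x l (unique-head u) = swap x n ↭-refl
insAfter-↭ n j (x ∷ l) u (here refl) | no ne = ⊥-elim (ne refl)
insAfter-↭ n j (x ∷ l) (_ ∷ u′) (there m) | no ne rewrite eqᵇ-false ne =
  ↭-trans (prep x (insAfter-↭ n j l u′ m)) (swap x n ↭-refl)

insAfter-path : ∀ {π n j x l y} → π n ≡ n → x ≢ n → n ∉ l → Path π x l y →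
                Path (π ∘ transp n j) x (if x ≡ᵇ j then n ∷ insAfter n j l else insAfter n j l) y
insAfter-path {π} {n} {j} {x} fix x≢n n∉ (done e) with x ≟ j
... | yes refl rewrite eqᵇ-true (refl {x = x}) =
  step (trans (cong π (transpʳ n x)) fix) (done (trans (cong π (transpˡ n x)) e))
... | no ne rewrite eqᵇ-false ne = done (trans (cong π (transp-else x≢n ne)) e)
insAfter-path {π} {n} {j} {x} fix x≢n n∉ (step e p) with x ≟ j
... | yes refl rewrite eqᵇ-true (refl {x = x}) =
  step (trans (cong π (transpʳ n x)) fix) (step (trans (cong π (transpˡ n x)) e)
    (insAfter-path fix (λ q → n∉ (here (sym q))) (n∉ ∘ there) p))
... | no ne rewrite eqᵇ-false ne = step (trans (cong π (transp-else x≢n ne)) e)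
    (insAfter-path fix (λ q → n∉ (here (sym q))) (n∉ ∘ there) p)

insAfter-cycle : ∀ {π n j l} → π n ≡ n → n ∉ l → IsCycle π l → IsCycle (π ∘ transp n j) (insAfter n j l)
insAfter-cycle fix n∉ (cycle p) = cycle (insAfter-path fix (λ q → n∉ (here (sym q))) (n∉ ∘ there) p)

block : List (List ℕ) → ℕ → List ℕ
block [] i = []
block (B ∷ Bs) zero = B
block (B ∷ Bs) (suc i) = block Bs i

block-map : (f : List ℕ → List ℕ) → f [] ≡ [] → ∀ Bs i → block (map f Bs) i ≡ f (block Bs i)
block-map f e [] i = sym e
block-map f e (B ∷ Bs) zero = refl
block-map f e (B ∷ Bs) (suc i) = block-map f e Bs i

block-∈ : ∀ Bs i {x} → x ∈ block Bs i → x ∈ concat Bs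
block-∈ (B ∷ Bs) zero m = ∈-++⁺ˡ m
block-∈ (B ∷ Bs) (suc i) m = ∈-++⁺ʳ B (block-∈ Bs i m)

block-++ : ∀ Bs Cs {i x} → x ∈ block Bs i → x ∈ block (Bs ++ Cs) i
block-++ (B ∷ Bs) Cs {zero} m = m
block-++ (B ∷ Bs) Cs {suc i} m = block-++ Bs Cs m

block-last : ∀ Bs B → block (Bs ++ [ B ]) (length Bs) ≡ B
block-last [] B = refl
block-last (_ ∷ Bs) B = block-last Bs B

unique-++ˡ : ∀ {A : Set} (xs : List A) {ys} → Unique (xs ++ ys) → Unique xs
unique-++ˡ [] u = []
unique-++ˡ (x ∷ xs) u@(_ ∷ u′) = unique-∷ (unique-head u ∘ ∈-++⁺ˡ) (unique-++ˡ xs u′)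

unique-++ʳ : ∀ {A : Set} (xs : List A) {ys} → Unique (xs ++ ys) → Unique ys
unique-++ʳ [] u = u
unique-++ʳ (x ∷ xs) (_ ∷ u) = unique-++ʳ xs u

unique-++-disjoint : ∀ {A : Set} (xs : List A) {ys x} → Unique (xs ++ ys) → x ∈ xs → x ∉ ys
unique-++-disjoint (x ∷ xs) u (here refl) m = unique-head u (∈-++⁺ʳ xs m)
unique-++-disjoint (x ∷ xs) (_ ∷ u) (there p) m = unique-++-disjoint xs u p m

insBlocks : ℕ → ℕ → List (List ℕ) → List (List ℕ)
insBlocks n j = map (insAfter n j)

insBlocks-∉ : ∀ n j Bs → j ∉ concat Bs → insBlocks n j Bs ≡ Bs
insBlocks-∉ n j [] h = refl
insBlocks-∉ n j (B ∷ Bs) h = cong₂ _∷_ (insAfter-∉ n j B (h ∘ ∈-++⁺ˡ)) (insBlocks-∉ n j Bs (h ∘ ∈-++⁺ʳ B))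

insBlocks-lengths : ∀ n j Bs i → Unique (concat Bs) → j ∈ block Bs i →
                    map length (insBlocks n j Bs) ≡ incAt i (map length Bs)
insBlocks-lengths n j (B ∷ Bs) zero u m = cong₂ _∷_ (↭-length (insAfter-↭ n j B (unique-++ˡ B u) m))
  (cong (map length) (insBlocks-∉ n j Bs (unique-++-disjoint B u m)))
insBlocks-lengths n j (B ∷ Bs) (suc i) u m = cong₂ _∷_
  (cong length (insAfter-∉ n j B (λ q → unique-++-disjoint B u q (block-∈ Bs i m))))
  (insBlocks-lengths n j Bs i (unique-++ʳ B u) m)

insBlocks-concat : ∀ n j Bs → Unique (concat Bs) → j ∈ concat Bs → concat (insBlocks n j Bs) ↭ n ∷ concat Bs
insBlocks-concat n j (B ∷ Bs) u m with ∈-++⁻ B m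
... | inj₁ q rewrite insBlocks-∉ n j Bs (unique-++-disjoint B u q) = ++⁺ʳ (concat Bs) (insAfter-↭ n j B (unique-++ˡ B u) q)
... | inj₂ q rewrite insAfter-∉ n j B (λ q′ → unique-++-disjoint B u q′ q) =
  ↭-trans (++⁺ˡ B (insBlocks-concat n j Bs (unique-++ʳ B u) q)) (shift n B (concat Bs))

cycles : List ℕ → List (List ℕ)
cycles [] = []
cycles (j ∷ c) = if j ≡ᵇ length c then cycles c ++ [ [ length c ] ] else insBlocks (length c) j (cycles c)

-- The field `located` numbers the cycles by labels. It is what makes the insertion behind j
-- lengthen the same entry that `sizes` increments.
record Cycles (c : List ℕ) : Set where
  field
    cover   : concat (cycles c) ↭ upTo (length c)
    lengths : map length (cycles c) ≡ sizes c
    isCycle : All (IsCycle (perm c)) (cycles c)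
    located : ∀ {i} → i < length c → i ∈ block (cycles c) (nth (labels c) i)

concat-snoc : ∀ {A : Set} (Bs : List (List A)) B → concat (Bs ++ [ B ]) ≡ concat Bs ++ B
concat-snoc Bs B = trans (sym (concat-++ Bs [ B ])) (cong (concat Bs ++_) (++-identityʳ B))

All-map : ∀ {A B : Set} {P : A → Set} {Q : B → Set} {f : A → B} {xs} →
          (∀ {x} → x ∈ xs → P x → Q (f x)) → All P xs → All Q (map f xs)
All-map h [] = []
All-map h (p ∷ ps) = h (here refl) p ∷ All-map (h ∘ there) ps

isCycle-cong : ∀ {π ρ l} → (∀ x → π x ≡ ρ x) → IsCycle π l → IsCycle ρ l
isCycle-cong {π} {ρ} h (cycle p) = cycle (go p)
  where
  go : ∀ {x l y} → Path π x l y → Path ρ x l y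
  go (done e) = done (trans (sym (h _)) e)
  go (step e p) = step (trans (sym (h _)) e) (go p)

cycles-spec : ∀ {c} → IsCode c → Cycles c
cycles-spec [] = record { cover = ↭-refl ; lengths = refl ; isCycle = [] ; located = λ () }
cycles-spec {j ∷ c} (j≤ ∷ ic) with j ≟ length c
... | yes refl = record { cover = cover′ ; lengths = lengths′ ; isCycle = isCycle′ ; located = λ h → located′ (m≤n⇒m<n∨m≡n (≤-pred h)) }
  where
  open Cycles (cycles-spec ic)
  n = length c
  cs : cycles (n ∷ c) ≡ cycles c ++ [ [ n ] ]
  cs rewrite eqᵇ-true (refl {x = n}) = refl
  ss : sizes (n ∷ c) ≡ sizes c ++ [ 1 ]
  ss rewrite eqᵇ-true (refl {x = n}) = refl
  #cycles : length (cycles c) ≡ length (sizes c)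
  #cycles = trans (sym (length-map length (cycles c))) (cong length lengths)
  cover′ : concat (cycles (n ∷ c)) ↭ upTo (suc n)
  cover′ rewrite cs | concat-snoc (cycles c) [ n ] | sym (upTo-∷ʳ n) = ++⁺ʳ [ n ] cover
  lengths′ : map length (cycles (n ∷ c)) ≡ sizes (n ∷ c)
  lengths′ rewrite cs | ss = trans (map-++ length (cycles c) [ [ n ] ]) (cong (_++ [ 1 ]) lengths)
  isCycle′ : All (IsCycle (perm (n ∷ c))) (cycles (n ∷ c))
  isCycle′ rewrite cs = All-++ (All.map (isCycle-cong (λ x → cong (perm c) (sym (transp-self n x)))) isCycle)
      (cycle (done (trans (cong (perm c) (transp-self n n)) (perm-fix ic ≤-refl))) ∷ [])
  located′ : ∀ {i} → i < n ⊎ i ≡ n → i ∈ block (cycles (n ∷ c)) (nth (labels (n ∷ c)) i)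
  located′ (inj₁ q) rewrite labels-old n c q | cs = block-++ (cycles c) [ [ n ] ] (located q)
  located′ (inj₂ refl) rewrite labels-last n c | cs | eqᵇ-true (refl {x = n}) | sym #cycles | block-last (cycles c) [ n ] = here refl
... | no ne = record { cover = cover′ ; lengths = lengths′ ; isCycle = isCycle′ ; located = λ h → located′ (m≤n⇒m<n∨m≡n (≤-pred h)) }
  where
  open Cycles (cycles-spec ic)
  n = length c
  j<n : j < n
  j<n = ≤∧≢⇒< j≤ ne
  u : Unique (concat (cycles c))
  u = unique-resp-↭ (↭-sym cover) (Uniq.upTo⁺ n)
  cs : cycles (j ∷ c) ≡ insBlocks n j (cycles c)
  cs rewrite eqᵇ-false ne = refl
  ss : sizes (j ∷ c) ≡ incAt (nth (labels c) j) (sizes c)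
  ss rewrite eqᵇ-false ne = refl
  cover′ : concat (cycles (j ∷ c)) ↭ upTo (suc n)
  cover′ rewrite cs = ↭-trans (insBlocks-concat n j (cycles c) u (∈-resp-↭ (↭-sym cover) (∈-upTo⁺ j<n)))
    (↭-trans (prep n cover) (↭-trans (∷↭∷ʳ n (upTo n)) (↭-reflexive (upTo-∷ʳ n))))
  lengths′ : map length (cycles (j ∷ c)) ≡ sizes (j ∷ c)
  lengths′ rewrite cs | ss = trans (insBlocks-lengths n j (cycles c) _ u (located j<n)) (cong (incAt _) lengths)
  isCycle′ : All (IsCycle (perm (j ∷ c))) (cycles (j ∷ c))
  isCycle′ rewrite cs = All-map (λ {B} B∈ → insAfter-cycle (perm-fix ic ≤-refl)
    (λ n∈ → <-irrefl refl (∈-upTo⁻ (∈-resp-↭ cover (∈-concat⁺′ n∈ B∈))))) isCycle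
  located′ : ∀ {i} → i < n ⊎ i ≡ n → i ∈ block (cycles (j ∷ c)) (nth (labels (j ∷ c)) i)
  located′ {i} (inj₁ q) rewrite labels-old j c q | cs | block-map (insAfter n j) refl (cycles c) (nth (labels c) i) =
    old (block (cycles c) (nth (labels c) i)) (located q)
    where
    old : ∀ l {x} → x ∈ l → x ∈ insAfter n j l
    old (y ∷ l) (here refl) = here refl
    old (y ∷ l) (there m) with y ≡ᵇ j
    ... | true = there (there (old l m))
    ... | false = there (old l m)
  located′ (inj₂ refl) rewrite labels-last j c | cs | eqᵇ-false ne | block-map (insAfter n j) refl (cycles c) (nth (labels c) j) =
    new (block (cycles c) (nth (labels c) j)) (located j<n)
    where
    new : ∀ l → j ∈ l → n ∈ insAfter n j l
    new (y ∷ l) (here refl) rewrite eqᵇ-true (refl {x = y}) = there (here refl)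
    new (y ∷ l) (there m) with y ≡ᵇ j
    ... | true = there (here refl)
    ... | false = there (new l m)

path-map : ∀ {π x l y} → Path π x l y → map π (x ∷ l) ≡ l ++ [ y ]
path-map (done e) = cong (_∷ []) e
path-map (step e p) = cong₂ _∷_ e (path-map p)

-- When the cycles of π are written one after the other, π moves an entry to the next one of its
-- cycle exactly as γ moves its position. The prefix `pre` keeps positions in the whole word in step
-- with the offset of `gammaFrom`.
map-gammaFrom : ∀ {π} pre Bs → All (IsCycle π) Bs →
                map π (concat Bs) ≡ map (nth (pre ++ concat Bs)) (gammaFrom (length pre) (map length Bs))
map-gammaFrom pre [] [] = refl
map-gammaFrom {π} pre ((x ∷ l) ∷ Bs) (cycle p ∷ ps) = begin
  map π ((x ∷ l) ++ rest)
    ≡⟨ map-++ π (x ∷ l) rest ⟩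
  map π (x ∷ l) ++ map π rest
    ≡⟨ cong₂ _++_ (path-map p) (map-gammaFrom (pre ++ x ∷ l) Bs ps) ⟩
  (l ++ [ x ]) ++ map (nth ((pre ++ x ∷ l) ++ rest)) (gammaFrom (length (pre ++ x ∷ l)) (map length Bs))
    ≡⟨ cong₂ _++_ (sym head-block) (cong₂ (λ a b → map (nth a) (gammaFrom b (map length Bs))) (++-assoc pre (x ∷ l) rest) (length-++ pre)) ⟩
  map (nth w) (cycleBlock s (suc q)) ++ map (nth w) (gammaFrom (s + suc q) (map length Bs))
    ≡⟨ sym (map-++ (nth w) (cycleBlock s (suc q)) _) ⟩
  map (nth w) (cycleBlock s (suc q) ++ gammaFrom (s + suc q) (map length Bs)) ∎
  where
  open ≡-Reasoning
  rest = concat Bs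
  w = pre ++ (x ∷ l) ++ rest
  s = length pre
  q = length l
  head-block : map (nth w) (cycleBlock s (suc q)) ≡ l ++ [ x ]
  head-block = trans (map-++ (nth w) (map (λ i → s + suc i) (upTo q)) [ s ]) (cong₂ _++_
    (trans (sym (map-∘ (upTo q))) (trans (map-cong-∈ (upTo q) (λ {i} i∈ → trans (nth-++ʳ pre ((x ∷ l) ++ rest) (suc i))
      (nth-++ˡ l rest (∈-upTo⁻ i∈)))) (tab-nth l)))
    (cong (_∷ []) (trans (cong (nth w) (sym (+-identityʳ s))) (nth-++ʳ pre ((x ∷ l) ++ rest) 0))))

interval : ℕ → ℕ → List ℕ
interval s zero = []
interval s (suc n) = s ∷ interval (suc s) n

interval-++ : ∀ s m n → interval s (m + n) ≡ interval s m ++ interval (s + m) n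
interval-++ s zero n = cong (λ k → interval k n) (sym (+-identityʳ s))
interval-++ s (suc m) n = cong (s ∷_) (trans (interval-++ (suc s) m n) (cong (λ k → interval (suc s) m ++ interval k n) (sym (+-suc s m))))

interval-map : ∀ s n → interval s n ≡ map (s +_) (upTo n)
interval-map s zero = refl
interval-map s (suc n) = cong₂ _∷_ (sym (+-identityʳ s)) (trans (interval-map (suc s) n)
  (trans (map-cong (λ i → sym (+-suc s i)) (upTo n)) (trans (map-∘ (upTo n)) (cong (map (s +_)) (map-upTo suc n)))))

gammaFrom-↭ : ∀ s ζ → gammaFrom s ζ ↭ interval s (sum ζ)
gammaFrom-↭ s [] = ↭-refl
gammaFrom-↭ s (p ∷ ζ) = ↭-trans (↭-++⁺ (cb p) (gammaFrom-↭ (s + p) ζ)) (↭-reflexive (sym (interval-++ s p (sum ζ))))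
  where
  cb : ∀ p → cycleBlock s p ↭ interval s p
  cb zero = ↭-refl
  cb (suc q) = ↭-trans (shift s (map (λ i → s + suc i) (upTo q)) []) (prep s (↭-reflexive (trans (++-identityʳ _)
    (trans (map-cong (+-suc s) (upTo q)) (sym (interval-map (suc s) q))))))

gamma-↭ : ∀ ζ → gamma ζ ↭ upTo (sum ζ)
gamma-↭ ζ = ↭-trans (gammaFrom-↭ 0 ζ) (↭-reflexive (trans (interval-map 0 (sum ζ)) (map-id (upTo (sum ζ)))))

-- The relation α′ = δ α δ⁻¹, written without an inverse.
Conj : ℕ → (ℕ → ℕ) → (ℕ → ℕ) → (ℕ → ℕ) → Set
Conj n δ α α′ = ∀ {i} → i < n → α′ (δ i) ≡ δ (α i)

-- The word w writes the cycles of c one after the other, in the order of ζ.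
gamma-conj : ∀ {c ζ} → IsCode c → sizes c ↭ ζ →
             ∃ λ w → w ↭ upTo (length c) × Conj (length c) (nth w) (nth (gamma ζ)) (perm c)
gamma-conj {c} {ζ} ic p with ↭-map-inv length (↭-trans (↭-reflexive lengths) p)
  where open Cycles (cycles-spec ic)
... | Bs , refl , q = w , w↭ , conj
  where
  open Cycles (cycles-spec ic)
  w = concat Bs
  n = length c
  concat-↭ : ∀ {Bs Cs : List (List ℕ)} → Bs ↭ Cs → concat Bs ↭ concat Cs
  concat-↭ Perm.refl = ↭-refl
  concat-↭ (prep B r) = ++⁺ˡ B (concat-↭ r)
  concat-↭ {_ ∷ _ ∷ Bs} {_ ∷ _ ∷ Cs} (swap B B′ r) = ↭-trans (↭-reflexive (sym (++-assoc B B′ (concat Bs))))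
    (↭-trans (↭-++⁺ (++-comm B B′) (concat-↭ r)) (↭-reflexive (++-assoc B′ B (concat Cs))))
  concat-↭ (Perm.trans r r′) = ↭-trans (concat-↭ r) (concat-↭ r′)
  w↭ : w ↭ upTo n
  w↭ = ↭-trans (concat-↭ (↭-sym q)) cover
  lenw : length w ≡ n
  lenw = trans (↭-length w↭) (length-upTo n)
  eq : map (perm c) w ≡ map (nth w) (gamma (map length Bs))
  eq = map-gammaFrom [] Bs (All-resp-↭ q isCycle)
  leng : length (gamma (map length Bs)) ≡ n
  leng = trans (sym (length-map (nth w) (gamma (map length Bs)))) (trans (cong length (sym eq)) (trans (length-map (perm c) w) lenw))
  conj : Conj n (nth w) (nth (gamma (map length Bs))) (perm c)
  conj {i} h = trans (sym (nth-map (perm c) w (subst (i <_) (sym lenw) h))) (trans (cong (λ l → nth l i) eq)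
    (nth-map (nth w) (gamma (map length Bs)) (subst (i <_) (sym leng) h)))

-- Invariance under conjugation

conj-sym : ∀ {n δ α α′} (d : IsPerm n δ) → IsPerm n α → Conj n δ α α′ → Conj n (inv d) α′ α
conj-sym {n} {δ} {α} {α′} d a h {x} hx = sym (trans (cong (inv d ∘ α′) (sym (π-inv d hx)))
  (trans (cong (inv d) (h (inv< d hx))) (inv-π d (π< a (inv< d hx)))))

conj-orb : ∀ {n δ α α′} → IsPerm n α → Conj n δ α α′ → ∀ {i k} → i < n → Orb α i k → Orb α′ (δ i) (δ k)
conj-orb {n} {δ} {α} {α′} a h hi (m , refl) = m , go m
  where
  go : ∀ m → iter m α′ (δ _) ≡ δ (iter m α _)
  go zero = refl
  go (suc m) = trans (cong α′ (go m)) (h (iter< a m hi))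

-- An orbit labelling f of α becomes the labelling f δ⁻¹ of α′. Its table is a rearrangement of that
-- of f, so each label keeps its count.
conj-sizes : ∀ {n δ} {α α′} → IsPerm n δ → IsPerm n (nth α) → IsPerm n (nth α′) → Conj n δ (nth α) (nth α′) →
             blockSizes n (cyclePartition n α) ↭ blockSizes n (cyclePartition n α′)
conj-sizes {n} {δ} {α} {α′} d a a′ h = ↭-sym (↭-trans (cycleSizes α′ a′ l′) (↭-reflexive
    (cong (filterᵇ (1 ≤ᵇ_)) (map-cong (λ L → count-↭ L shuffled) (upTo n)))))
  where
  f = orbitMin n α
  l = orbitMin-lab α a
  h′ = conj-sym {α′ = nth α′} d a h
  l′ : OrbLab n (nth α′) (f ∘ inv d)
  l′ = record
    { lab< = lab< l ∘ inv< d
    ; stay = λ q → trans (cong f (sym (h′ q))) (stay l (inv< d q))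
    ; joins = λ {i} {k} hi hk e → subst₂ (Orb (nth α′)) (π-inv d hi) (π-inv d hk)
        (conj-orb {δ = δ} a h (inv< d hi) (joins l (inv< d hi) (inv< d hk) e)) }
  shuffled : tab n (f ∘ inv d) ↭ tab n f
  shuffled = ↭-trans (↭-reflexive (map-∘ (upTo n))) (↭-map⁺ f (tab-↭ (inverse d)))

-- A labelling R invariant under α′, β′ pulls back to R δ, invariant under α, β and hence constant;
-- as δ is onto, R is constant too.
conj-transitive : ∀ {n δ α α′ β β′} → 1 ≤ n → IsPerm n δ → Conj n δ α α′ → Conj n δ β β′ →
                  Transitive n α β → Transitive n α′ β′
conj-transitive {n} {δ} {α} {α′} {β} {β′} 1≤n d hα hβ tr R R< Rα Rβ {i} hi =
  trans (const hi) (sym (const 1≤n))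
  where
  const : ∀ {i} → i < n → R i ≡ R (δ 0)
  const hi = trans (cong R (sym (π-inv d hi))) (tr (R ∘ δ) (R< ∘ π< d)
    (λ q → trans (cong R (sym (hα q))) (Rα (π< d q))) (λ q → trans (cong R (sym (hβ q))) (Rβ (π< d q))) (inv< d hi))

conjugate : ℕ → (ℕ → ℕ) → (ℕ → ℕ) → List ℕ → List ℕ
conjugate n δ δ⁻ α = tab n (δ ∘ nth α ∘ δ⁻)

module _ {n δ} (d : IsPerm n δ) where

  conjugate-∈ : ∀ {α} → α ∈ S n → conjugate n δ (inv d) α ∈ S n
  conjugate-∈ m = tab∈S (compose d (compose (∈S⇒isPerm n m) (inverse d)))

  conjugate-conj : ∀ {α} → Conj n δ (nth α) (nth (conjugate n δ (inv d) α))
  conjugate-conj {α} {i} h = trans (nth-tab n (δ ∘ nth α ∘ inv d) (π< d h)) (cong (δ ∘ nth α) (inv-π d h))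

  conjugate-inverse : ∀ {α} → α ∈ S n → conjugate n (inv d) δ (conjugate n δ (inv d) α) ≡ α
  conjugate-inverse {α} m = trans (tab-cong (λ {i} h → trans (cong (inv d) (conjugate-conj {α} h))
    (inv-π d (π< (∈S⇒isPerm n m) h)))) (sym (S-tab n m))

  conjugate-invComp : ∀ {α γ γ′} → α ∈ S n → IsPerm n (nth γ) → IsPerm n (nth γ′) → Conj n δ (nth γ) (nth γ′) →
                      Conj n δ (nth (invComp n α γ)) (nth (invComp n (conjugate n δ (inv d) α) γ′))
  conjugate-invComp {α} {γ} {γ′} m g g′ h {i} hi = inj pα′ (π< (invComp-isPerm n γ′ m′ g′) (π< d hi)) (π< d β<)
    (trans (invComp-spec n γ′ m′ g′ (π< d hi)) (trans (h hi) (trans (cong δ (sym (invComp-spec n γ m g hi)))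
    (sym (conjugate-conj {α} β<)))))
    where
    m′ = conjugate-∈ m
    pα′ = ∈S⇒isPerm n m′
    β< = π< (invComp-isPerm n γ m g) hi

-- The formula

numBlocks-≤ : ∀ n b → numBlocks n b ≤ n
numBlocks-≤ n b = ≤-trans (length-filter (T? ∘ (1 ≤ᵇ_)) (map (λ L → count L b) (upTo n)))
  (≤-reflexive (trans (length-map _ (upTo n)) (length-upTo n)))

labels-tab : ∀ c → labels c ≡ tab (length c) (nth (labels c))
labels-tab c = tab-nth′ (length-labels c)

cls-labels : ∀ {c} → IsCode c → cls (length c) (nth (labels c)) ≡ length (sizes c)
cls-labels {c} ic = cls-image (length c) _ (length (sizes c)) (length-sizes-≤ c) (labels< ic) hit
  where
  hit : ∀ {L} → L < length (sizes c) → ∃ λ i → i < length c × nth (labels c) i ≡ L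
  hit {L} h with indexOf-∈ (Growth.onto (growth-labels ic) h)
  ... | a , b = indexOf L (labels c) , subst (indexOf L (labels c) <_) (length-labels c) a , b

code-list : ℕ → List ℕ → List ℕ
code-list n c = tab n (perm c)

code-isPerm : ∀ n {c} → c ∈ codes n → IsPerm n (nth (code-list n c))
code-isPerm n {c} m = isPerm-cong (λ h → sym (nth-tab n (perm c) h)) (codes-isPerm m)

code-orbLab : ∀ n {c} → c ∈ codes n → OrbLab n (nth (code-list n c)) (nth (labels c))
code-orbLab n {c} m with codes⇒ n m
... | ic , refl = orbLab-cong (codes-isPerm m) (λ h → sym (nth-tab n (perm c) h)) (λ _ → refl) (labels-orbLab ic)

code-sizes : ∀ n {c} → c ∈ codes n → blockSizes n (labels c) ↭ blockSizes n (cyclePartition n (code-list n c))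
code-sizes n {c} m with codes⇒ n m
... | ic , refl = ↭-sym (subst (λ l → blockSizes n (cyclePartition n (code-list n c)) ↭ blockSizes n l) (sym (labels-tab c))
  (cycleSizes (code-list n c) (code-isPerm n m) (code-orbLab n m)))

module _ {n} (1≤n : 1 ≤ n) where

  cyclePartition-orbLab : ∀ {α} → IsPerm n (nth α) → OrbLab n (nth α) (nth (cyclePartition n α))
  cyclePartition-orbLab {α} p = orbLab-cong p (λ _ → refl) (λ h → sym (nth-tab n (orbitMin n α) h)) (orbitMin-lab α p)

  joinIsTop-transitive : ∀ {α γ} → α ∈ S n → IsPerm n (nth γ) →
    joinIsTop n (cyclePartition n α) (cyclePartition n (invComp n α γ)) ≡ transitive n α γ
  joinIsTop-transitive {α} {γ} a g = bool-ext (⇐ tr ∘ ⇒ jn) (⇐ jn ∘ ⇒ tr)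
    where
    pα = ∈S⇒isPerm n a
    pβ = invComp-isPerm n γ a g
    jn = joinIsTop⇔ 1≤n pα pβ (cyclePartition n α) (cyclePartition n (invComp n α γ)) (cyclePartition-orbLab {α} pα) (cyclePartition-orbLab {invComp n α γ} pβ)
    tr = transitive⇔ α γ 1≤n pα pβ (invComp-spec n γ a g)

  joinIsTop-labels : ∀ {c d} → c ∈ codes n → d ∈ codes n →
    joinIsTop n (labels c) (labels d) ≡ joinIsTop n (cyclePartition n (code-list n c)) (cyclePartition n (code-list n d))
  joinIsTop-labels {c} {d} m m′ = bool-ext (⇐ j′ ∘ ⇒ j) (⇐ j ∘ ⇒ j′)
    where
    pc = code-isPerm n m
    pd = code-isPerm n m′
    j = joinIsTop⇔ 1≤n pc pd (labels c) (labels d) (code-orbLab n m) (code-orbLab n m′)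
    j′ = joinIsTop⇔ 1≤n pc pd (cyclePartition n (code-list n c)) (cyclePartition n (code-list n d)) (cyclePartition-orbLab {code-list n c} pc) (cyclePartition-orbLab {code-list n d} pd)

  genus-natural : ∀ {α} γ → α ∈ S n → IsPerm n (nth γ) → T (transitive n α γ) →
    ∃ λ h → numCycles n α + numCycles n (invComp n α γ) + numCycles n γ + 2 * h ≡ n + 2
  genus-natural {α} γ a g tr = genus-exists 1≤n pα pβ (invComp-spec n γ a g)
    (orbitMin-lab α pα) (orbitMin-lab (invComp n α γ) pβ) (orbitMin-lab γ g)
    (⇒ (transitive⇔ α γ 1≤n pα pβ (invComp-spec n γ a g)) tr)
    where
    pα = ∈S⇒isPerm n a
    pβ = invComp-isPerm n γ a g

  transitive-conj : ∀ {δ} (d : IsPerm n δ) {α} γ γ′ → α ∈ S n → IsPerm n (nth γ) → IsPerm n (nth γ′) → Conj n δ (nth γ) (nth γ′) →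
    transitive n α γ ≡ transitive n (conjugate n δ (inv d) α) γ′
  transitive-conj {δ} d {α} γ γ′ a g g′ h = bool-ext
    (⇐ tr′ ∘ conj-transitive 1≤n d hα hβ ∘ ⇒ tr)
    (⇐ tr ∘ conj-transitive 1≤n (inverse d) (conj-sym d pα hα) (conj-sym d pβ hβ) ∘ ⇒ tr′)
    where
    a′ = conjugate-∈ d a
    pα = ∈S⇒isPerm n a
    pβ = invComp-isPerm n γ a g
    hα : Conj n δ (nth α) (nth (conjugate n δ (inv d) α))
    hα = conjugate-conj d {α}
    hβ = conjugate-invComp d {α} {γ} {γ′} a g g′ h
    tr = transitive⇔ α γ 1≤n pα pβ (invComp-spec n γ a g)
    tr′ = transitive⇔ (conjugate n δ (inv d) α) γ′ 1≤n (∈S⇒isPerm n a′) (invComp-isPerm n γ′ a′ g′) (invComp-spec n γ′ a′ g′)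

-- This is 2n - (n + 1 - k) = n - 1 + k; the bounds keep every truncated subtraction exact.
sign-exponent : ∀ {n k a b} → 1 ≤ n → k < n → a ≤ n → b ≤ n → a + b ≡ n + 1 ∸ k → (n ∸ a) + (n ∸ b) ≡ (n ∸ 1) + k
sign-exponent {suc n} {k} {a} {b} _ k<n a≤ b≤ e = +-cancelʳ-≡ (a + b) _ _ (begin
  (suc n ∸ a) + (suc n ∸ b) + (a + b)
    ≡⟨ solve 4 (λ x y a b → x :+ y :+ (a :+ b) := (x :+ a) :+ (y :+ b)) refl (suc n ∸ a) (suc n ∸ b) a b ⟩
  (suc n ∸ a + a) + (suc n ∸ b + b)
    ≡⟨ cong₂ _+_ (m∸n+n≡m a≤) (m∸n+n≡m b≤) ⟩
  suc n + suc n
    ≡⟨ solve 1 (λ n → (con 1 :+ n) :+ (con 1 :+ n) := n :+ (con 1 :+ n :+ con 1)) refl n ⟩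
  n + (suc n + 1)
    ≡⟨ cong (n +_) (sym (m+[n∸m]≡n (≤-trans (<⇒≤ k<n) (m≤m+n (suc n) 1)))) ⟩
  n + (k + (suc n + 1 ∸ k))
    ≡⟨ sym (+-assoc n k _) ⟩
  n + k + (suc n + 1 ∸ k)
    ≡⟨ cong (n + k +_) (sym e) ⟩
  n + k + (a + b) ∎)
  where open ≡-Reasoning

-- Subtracting the two equations gives c + 2h = k + 1, and c ≥ 1 forces 2h ≤ k: this is the origin
-- of the range of g.
euler-genus : ∀ {n k s c h} → k < n → 1 ≤ c → s ≡ n + 1 ∸ k → s + c + 2 * h ≡ n + 2 → h ≤ ⌊ k /2⌋ × c ≡ k + 1 ∸ 2 * h
euler-genus {n} {k} {s} {c} {h} k<n 1≤c es e = half , sym (trans (cong (_∸ 2 * h) (sym ck)) (m+n∸n≡m c (2 * h)))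
  where
  ck : c + 2 * h ≡ k + 1
  ck = +-cancelˡ-≡ s _ _ (trans (sym (+-assoc s c (2 * h))) (trans e (sym (trans (cong (_+ (k + 1)) es)
    (trans (sym (+-assoc (n + 1 ∸ k) k 1)) (trans (cong (_+ 1) (m∸n+n≡m (≤-trans (<⇒≤ k<n) (m≤m+n n 1))))
    (+-assoc n 1 1)))))))
  2h≤k : 2 * h ≤ k
  2h≤k = +-cancelˡ-≤ 1 _ _ (≤-trans (+-monoˡ-≤ (2 * h) 1≤c) (≤-reflexive (trans ck (+-comm k 1))))
  half : h ≤ ⌊ k /2⌋
  half = subst (_≤ ⌊ k /2⌋) (trans (cong ⌊_/2⌋ (cong (h +_) (+-identityʳ h))) (sym (n≡⌊n+n/2⌋ h))) (⌊n/2⌋-mono 2h≤k)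

-- The converse direction. The bound on g makes k + 1 ∸ 2g a true difference.
genus-blocks : ∀ {n k s c g} → k < n → g ≤ ⌊ k /2⌋ → c ≡ k + 1 ∸ 2 * g → s + c + 2 * g ≡ n + 2 → s ≡ n + 1 ∸ k
genus-blocks {n} {k} {s} {c} {g} k<n g≤ ec e = sym (trans (cong (_∸ k) (sym sk)) (m+n∸n≡m s k))
  where
  2g≤k : 2 * g ≤ k
  2g≤k = ≤-trans (*-monoʳ-≤ 2 g≤) (≤-trans (≤-reflexive (cong (⌊ k /2⌋ +_) (+-identityʳ ⌊ k /2⌋)))
    (≤-trans (+-monoʳ-≤ ⌊ k /2⌋ (⌊n/2⌋≤⌈n/2⌉ k)) (≤-reflexive (⌊n/2⌋+⌈n/2⌉≡n k))))
  ck : c + 2 * g ≡ k + 1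
  ck = trans (cong (_+ 2 * g) ec) (m∸n+n≡m (≤-trans 2g≤k (m≤m+n k 1)))
  sk : s + k ≡ n + 1
  sk = +-cancelʳ-≡ 1 _ _ (trans (+-assoc s k 1) (trans (cong (s +_) (sym ck)) (trans (sym (+-assoc s c (2 * g)))
    (trans e (sym (+-assoc n 1 1))))))

module Main {c ℓ} (R : CommutativeRing c ℓ) (inv′ : ℕ → CommutativeRing.Carrier R)
  (invertible : (m : ℕ) → CommutativeRing._≈_ R (CommutativeRing._*_ R (Formula.ι R inv′ (suc m)) (inv′ (suc m))) (CommutativeRing.1# R))
  where
  open ClassSizes R inv′
  private module R = CommutativeRing R
  open import Algebra.Properties.Ring R.ring using (-‿distribˡ-*; -‿distribʳ-*; -‿involutive)
  open import Algebra.Properties.CommutativeSemigroup R.*-commutativeSemigroup using (interchange; x∙yz≈y∙xz)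

  prodR-↭ : ∀ (f : ℕ → C) {xs ys} → xs ↭ ys → prodR (map f xs) ≈ prodR (map f ys)
  prodR-↭ f Perm.refl = ≈-refl
  prodR-↭ f (prep x p) = R.*-congˡ (prodR-↭ f p)
  prodR-↭ f (swap x y p) = ≈-trans (x∙yz≈y∙xz _ _ _) (R.*-congˡ (R.*-congˡ (prodR-↭ f p)))
  prodR-↭ f (Perm.trans p q) = ≈-trans (prodR-↭ f p) (prodR-↭ f q)

  sumR-concatMap : {A : Set} (F : A → List C) (xs : List A) → sumR (concatMap F xs) ≈ ∑ xs (λ x → sumR (F x))
  sumR-concatMap F [] = ≈-refl
  sumR-concatMap F (x ∷ xs) = ≈-trans (sumR-++ (F x)) (R.+-congˡ (sumR-concatMap F xs))
    where
    sumR-++ : ∀ ys {zs} → sumR (ys ++ zs) ≈ sumR ys ⊕ sumR zs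
    sumR-++ [] = ≈-sym (R.+-identityˡ _)
    sumR-++ (y ∷ ys) = ≈-trans (R.+-congˡ (sumR-++ ys)) (≈-sym (R.+-assoc _ _ _))

  sgn-+ : ∀ a b → sgn (a + b) ≈ sgn a ⊛ sgn b
  sgn-+ zero b = ≈-sym (R.*-identityˡ _)
  sgn-+ (suc a) b = ≈-trans (R.-‿cong (sgn-+ a b)) (-‿distribˡ-* _ _)

  sgn-square : ∀ a → sgn a ⊛ sgn a ≈ 1#
  sgn-square zero = R.*-identityˡ _
  sgn-square (suc a) = begin
    (R.- sgn a) ⊛ (R.- sgn a)    ≈⟨ ≈-sym (-‿distribˡ-* _ _) ⟩
    R.- (sgn a ⊛ (R.- sgn a))    ≈⟨ R.-‿cong (≈-sym (-‿distribʳ-* _ _)) ⟩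
    R.- (R.- (sgn a ⊛ sgn a))    ≈⟨ -‿involutive _ ⟩
    sgn a ⊛ sgn a                ≈⟨ sgn-square a ⟩
    1# ∎

  cancel-inv : ∀ {m} → 1 ≤ m → ι m ⊛ inv′ m ≈ 1#
  cancel-inv {suc m} _ = invertible m

  ∑-S-codes : ∀ n {F : List ℕ → C} → ∑ (S n) F ≈ ∑ (codes n) (λ c → F (code-list n c))
  ∑-S-codes n = ≈-trans (≈-sym (∑-↭ (S-↭-codes n))) (R.reflexive (∑-map (code-list n) (codes n)))

  -- The class size n! / z, divided by the (n - 1)! of the left side, is n / z. Both z and (n - 1)!
  -- are positive, so their inverses may be cancelled.
  coef-N : ∀ n ζ → 1 ≤ n → All (1 ≤_) ζ → sum ζ ≡ n → inv′ ((n ∸ 1) !) ⊛ N n ζ ≈ coef n ζ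
  coef-N (suc n) ζ _ pos e = begin
    inv′ (n !) ⊛ N (suc n) ζ
      ≈⟨ R.*-congˡ (≈-sym (≈-trans (R.*-congʳ (≈-trans (R.*-comm _ _) (cancel-inv z≥1))) (R.*-identityˡ _))) ⟩
    inv′ (n !) ⊛ ((inv′ z ⊛ ι z) ⊛ N (suc n) ζ)
      ≈⟨ R.*-congˡ (≈-trans (R.*-assoc _ _ _) (R.*-congˡ (≈-trans (class-size (suc n) (suc n) ζ ≤-refl pos e) (ι-* (suc n) (n !))))) ⟩
    inv′ (n !) ⊛ (inv′ z ⊛ (ι (suc n) ⊛ ι (n !)))
      ≈⟨ ≈-trans (R.*-congˡ (≈-sym (R.*-assoc _ _ _))) (≈-trans (x∙yz≈y∙xz _ _ _) (R.*-congˡ (≈-trans (R.*-comm _ _) (cancel-inv (n!≥1 n))))) ⟩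
    (inv′ z ⊛ ι (suc n)) ⊛ 1#
      ≈⟨ ≈-trans (R.*-identityʳ _) (R.*-comm _ _) ⟩
    ι (suc n) ⊛ inv′ z ∎
    where
    z = zee (suc n) ζ
    n!≥1 : ∀ m → 1 ≤ m !
    n!≥1 m = n≢0⇒n>0 (λ q → ≢-nonZero⁻¹ (m !) {{m !≢0}} q)
    z≥1 : 1 ≤ z
    z≥1 = n≢0⇒n>0 (λ q → ≢-nonZero⁻¹ z {{m*n≢0 (product ζ) _ {{product≢0 (All.map >-nonZero pos)}}
      {{product≢0 (All-map⁺ {f = λ i → (t i ζ) !} (All.tabulate {xs = map suc (upTo (suc n))} (λ {i} _ → (t i ζ) !≢0)))}}}} q)

  module _ (u v : ℕ → C) (n k : ℕ) (1≤n : 1 ≤ n) (k<n : k < n) where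

    private
      -- `E` is a summand of the left side without its sign and factorials, `M` the same for the
      -- factorisation γ = α (α⁻¹γ), `H` its sum over α, and `X` collects the inner sums of the
      -- right side over all genera for one ζ.
      E : List ℕ → List ℕ → C
      E σ τ = when (joinIsTop n σ τ ∧ ((numBlocks n σ + numBlocks n τ) ≡ᵇ (n + 1 ∸ k))) (uP u n σ ⊛ uP v n τ)

      M : List ℕ → List ℕ → C
      M α γ = when (transitive n α γ ∧ ((numCycles n α + numCycles n (invComp n α γ)) ≡ᵇ (n + 1 ∸ k)))
                   (uPerm u n α ⊛ uPerm v n (invComp n α γ))

      H : List ℕ → C
      H γ = ∑ (S n) (λ α → M α γ)

      X : List ℕ → C
      X ζ = ∑ (upTo (suc ⌊ k /2⌋)) (λ g → when (length ζ ≡ᵇ (k + 1 ∸ 2 * g))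
              (∑ (S n) (λ α → when (inSNC n g ζ α) (uPerm u n α ⊛ uPerm v n (invComp n α (gamma ζ))))))

      ε : C
      ε = sgn (n ∸ 1) ⊛ sgn k

    summand : ∀ σ τ →
      (if joinIsTop n σ τ ∧ ((numBlocks n σ + numBlocks n τ) ≡ᵇ (n + 1 ∸ k))
       then mob n σ ⊛ mob n τ ⊛ uP u n σ ⊛ uP v n τ else 0#)
      ≈ ι (weight n σ) ⊛ (ι (weight n τ) ⊛ (ε ⊛ E σ τ))
    summand σ τ with joinIsTop n σ τ ∧ ((numBlocks n σ + numBlocks n τ) ≡ᵇ (n + 1 ∸ k)) in q
    ... | false = ≈-sym (≈-trans (R.*-congˡ (≈-trans (R.*-congˡ (R.zeroʳ _)) (R.zeroʳ _))) (R.zeroʳ _))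
    ... | true = begin
      ((sσ ⊛ wσ) ⊛ (sτ ⊛ wτ)) ⊛ uP u n σ ⊛ uP v n τ
        ≈⟨ R.*-assoc _ _ _ ⟩
      ((sσ ⊛ wσ) ⊛ (sτ ⊛ wτ)) ⊛ (uP u n σ ⊛ uP v n τ)
        ≈⟨ R.*-congʳ (≈-trans (interchange _ _ _ _) (R.*-congʳ sign)) ⟩
      (ε ⊛ (wσ ⊛ wτ)) ⊛ (uP u n σ ⊛ uP v n τ)
        ≈⟨ ≈-trans (R.*-congʳ (R.*-comm _ _)) (≈-trans (R.*-assoc _ _ _) (R.*-assoc _ _ _)) ⟩
      wσ ⊛ (wτ ⊛ (ε ⊛ (uP u n σ ⊛ uP v n τ))) ∎
      where
      sσ = sgn (n ∸ numBlocks n σ)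
      sτ = sgn (n ∸ numBlocks n τ)
      wσ = ι (weight n σ)
      wτ = ι (weight n τ)
      -- The product of the Möbius signs depends only on |σ| + |τ|, which the summation condition
      -- fixes.
      sign : sσ ⊛ sτ ≈ ε
      sign = ≈-trans (≈-sym (sgn-+ (n ∸ numBlocks n σ) (n ∸ numBlocks n τ))) (≈-trans
        (R.reflexive (cong sgn (sign-exponent 1≤n k<n (numBlocks-≤ n σ) (numBlocks-≤ n τ)
          (≡ᵇ⇒≡ (numBlocks n σ + numBlocks n τ) (n + 1 ∸ k) (proj₂ (⇒ (T-∧ {joinIsTop n σ τ}) (subst T (sym q) _)))))))
        (sgn-+ (n ∸ 1) k))

    E-cong : ∀ {σ σ′ τ τ′} → joinIsTop n σ τ ≡ joinIsTop n σ′ τ′ → blockSizes n σ ↭ blockSizes n σ′ →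
             blockSizes n τ ↭ blockSizes n τ′ → E σ τ ≈ E σ′ τ′
    E-cong ej p q = when-cong (cong₂ _∧_ ej (cong₂ (λ a b → (a + b) ≡ᵇ (n + 1 ∸ k)) (↭-length p) (↭-length q)))
      (λ _ → R.*-cong (prodR-↭ u p) (prodR-↭ v q))

    partitions-to-permutations :
      sumR (concatMap (λ σ → map (λ τ →
            if joinIsTop n σ τ ∧ ((numBlocks n σ + numBlocks n τ) ≡ᵇ (n + 1 ∸ k))
            then mob n σ ⊛ mob n τ ⊛ uP u n σ ⊛ uP v n τ
            else 0#) (P n)) (P n))
      ≈ ε ⊛ ∑ (S n) (λ α → ∑ (S n) (λ β → E (cyclePartition n α) (cyclePartition n β)))
    partitions-to-permutations = begin
      _
        ≈⟨ sumR-concatMap _ (P n) ⟩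
      _
        ≈⟨ ∑-cong (P n) (λ {σ} _ → ≈-trans (∑-cong (P n) (λ {τ} _ → summand σ τ)) (∑-*ˡ (P n) (ι (weight n σ)))) ⟩
      ∑ (P n) (λ σ → ι (weight n σ) ⊛ ∑ (P n) (λ τ → ι (weight n τ) ⊛ (ε ⊛ E σ τ)))
        ≈⟨ ∑-cong (P n) (λ {σ} _ → R.*-congˡ (∑-P (λ τ → ε ⊛ E σ τ) n)) ⟩
      ∑ (P n) (λ σ → ι (weight n σ) ⊛ ∑ (codes n) (λ d → ε ⊛ E σ (labels d)))
        ≈⟨ ∑-P (λ σ → ∑ (codes n) (λ d → ε ⊛ E σ (labels d))) n ⟩
      ∑ (codes n) (λ c → ∑ (codes n) (λ d → ε ⊛ E (labels c) (labels d)))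
        ≈⟨ ∑-cong (codes n) (λ {c} m → ≈-trans (∑-*ˡ (codes n) ε) (R.*-congˡ (∑-cong (codes n) (λ {d} m′ →
             E-cong {labels c} {cyclePartition n (code-list n c)} {labels d} {cyclePartition n (code-list n d)} (joinIsTop-labels 1≤n m m′) (code-sizes n m) (code-sizes n m′))))) ⟩
      ∑ (codes n) (λ c → ε ⊛ ∑ (codes n) (λ d → E (cyclePartition n (code-list n c)) (cyclePartition n (code-list n d))))
        ≈⟨ ∑-*ˡ (codes n) ε ⟩
      ε ⊛ ∑ (codes n) (λ c → ∑ (codes n) (λ d → E (cyclePartition n (code-list n c)) (cyclePartition n (code-list n d))))
        ≈⟨ R.*-congˡ (≈-sym (≈-trans (∑-S-codes n) (∑-cong (codes n) (λ _ → ∑-S-codes n)))) ⟩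
      _ ∎

    -- For fixed α, the substitution β = α⁻¹γ is a bijection of the symmetric group with inverse β ↦
    -- αβ.
    factor : ∑ (S n) (λ α → ∑ (S n) (λ β → E (cyclePartition n α) (cyclePartition n β))) ≈ ∑ (S n) H
    factor = begin
      ∑ (S n) (λ α → ∑ (S n) (λ β → E (cyclePartition n α) (cyclePartition n β)))
        ≈⟨ ∑-cong (S n) (λ {α} a → ≈-sym (∑-reindex (S n) (invComp n α) (λ β → tab n (nth α ∘ nth β)) (S-unique n)
             (λ {γ} g → invComp-∈ n γ a (∈S⇒isPerm n g))
             (λ b → tab∈S (compose (∈S⇒isPerm n a) (∈S⇒isPerm n b)))
             (λ {γ} g → trans (tab-cong (invComp-spec n γ a (∈S⇒isPerm n g))) (sym (S-tab n g)))
             (λ {β} b → invComp-unique n (tab n (nth α ∘ nth β)) a (∈S⇒isPerm n (tab∈S (compose (∈S⇒isPerm n a) (∈S⇒isPerm n b)))) b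
               (λ h → sym (nth-tab n (nth α ∘ nth β) h))))) ⟩
      ∑ (S n) (λ α → ∑ (S n) (λ γ → E (cyclePartition n α) (cyclePartition n (invComp n α γ))))
        ≈⟨ ∑-cong (S n) (λ {α} a → ∑-cong (S n) (λ {γ} g → when-cong
             (cong (_∧ ((numCycles n α + numCycles n (invComp n α γ)) ≡ᵇ (n + 1 ∸ k)))
               (joinIsTop-transitive 1≤n {α} {γ} a (∈S⇒isPerm n g))) (λ _ → ≈-refl))) ⟩
      ∑ (S n) (λ α → ∑ (S n) (λ γ → M α γ))
        ≈⟨ ∑-swap (S n) (S n) ⟩
      ∑ (S n) H ∎

    -- Conjugating α and γ by the same δ preserves transitivity and the cycle sizes of α and of
    -- α⁻¹γ, and it permutes the range of α.
    H-conj : ∀ {δ} γ γ′ → IsPerm n δ → IsPerm n (nth γ) → IsPerm n (nth γ′) → Conj n δ (nth γ) (nth γ′) → H γ ≈ H γ′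
    H-conj {δ} γ γ′ d g g′ h = ≈-trans (∑-cong (S n) (λ a → termwise a))
      (∑-reindex (S n) (conjugate n δ (inv d)) (conjugate n (inv d) δ) {λ α → M α γ′} (S-unique n)
        (conjugate-∈ d) (conjugate-∈ (inverse d)) (conjugate-inverse d) (conjugate-inverse (inverse d)))
      where
      termwise : ∀ {α} → α ∈ S n → M α γ ≈ M (conjugate n δ (inv d) α) γ′
      termwise {α} a = when-cong (cong₂ _∧_ (transitive-conj 1≤n d γ γ′ a g g′ h)
          (cong₂ (λ x y → (x + y) ≡ᵇ (n + 1 ∸ k)) (↭-length pα) (↭-length pβ)))
        (λ _ → R.*-cong (prodR-↭ u pα) (prodR-↭ v pβ))
        where
        a′ = conjugate-∈ d a
        pα = conj-sizes {α = α} {α′ = conjugate n δ (inv d) α} d (∈S⇒isPerm n a) (∈S⇒isPerm n a′) (conjugate-conj d {α})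
        pβ = conj-sizes {α = invComp n α γ} {α′ = invComp n (conjugate n δ (inv d) α) γ′} d
               (invComp-isPerm n γ a g) (invComp-isPerm n γ′ a′ g′) (conjugate-invComp d {α} {γ} {γ′} a g g′ h)

    -- For a transitive α the relation of `genus-natural` has a single solution h. Given it, the
    -- number of cycles prescribed for α and α⁻¹γ and the length k + 1 - 2h prescribed for ζ are the
    -- same condition, so at most one g contributes.
    H-genus : ∀ ζ → IsPerm n (nth (gamma ζ)) → numCycles n (gamma ζ) ≡ length ζ → 1 ≤ length ζ → H (gamma ζ) ≈ X ζ
    H-genus ζ g eℓ ℓ≥1 = ≈-sym (begin
      X ζ
        ≈⟨ ∑-cong gs (λ {h} _ → when-∑ (b₁ h) (S n)) ⟩
      ∑ gs (λ h → ∑ (S n) (λ α → when (b₁ h) (when (inSNC n h ζ α) (w α))))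
        ≈⟨ ∑-swap gs (S n) ⟩
      ∑ (S n) (λ α → ∑ gs (λ h → when (b₁ h) (when (inSNC n h ζ α) (w α))))
        ≈⟨ ∑-cong (S n) (λ a → ≈-trans (∑-cong gs (λ {h} _ → ≈-sym (when-∧ (b₁ h) _))) (pick a)) ⟩
      H (gamma ζ) ∎)
      where
      gs = upTo (suc ⌊ k /2⌋)
      γ = gamma ζ
      b₁ : ℕ → Bool
      b₁ h = length ζ ≡ᵇ (k + 1 ∸ 2 * h)
      w : List ℕ → C
      w α = uPerm u n α ⊛ uPerm v n (invComp n α γ)
      blocks : List ℕ → ℕ
      blocks α = numCycles n α + numCycles n (invComp n α γ)
      split : ∀ {h α} → T (b₁ h ∧ inSNC n h ζ α) →
              length ζ ≡ k + 1 ∸ 2 * h × T (transitive n α γ) × blocks α + numCycles n γ + 2 * h ≡ n + 2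
      split {h} {α} q with ⇒ (T-∧ {b₁ h}) q
      ... | q₁ , q₂ with ⇒ (T-∧ {transitive n α γ}) q₂
      ... | q₃ , q₄ = ≡ᵇ⇒≡ (length ζ) _ q₁ , q₃ , ≡ᵇ⇒≡ (blocks α + numCycles n γ + 2 * h) (n + 2) q₄
      pick : ∀ {α} → α ∈ S n → ∑ gs (λ h → when (b₁ h ∧ inSNC n h ζ α) (w α)) ≈ M α γ
      pick {α} a with T? (transitive n α γ ∧ (blocks α ≡ᵇ (n + 1 ∸ k)))
      ... | no ¬q = ≈-trans (∑-cong gs (λ {h} h∈ → when-false (λ q → ¬q (let (q₁ , q₂ , q₃) = split {h} {α} q in
              ⇐ T-∧ (q₂ , ≡⇒≡ᵇ (blocks α) _ (genus-blocks k<n (≤-pred (∈-upTo⁻ h∈)) (trans eℓ q₁) q₃))))))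
              (≈-trans (∑-zero gs) (≈-sym (when-false ¬q)))
      ... | yes q with ⇒ (T-∧ {transitive n α γ}) q
      ...   | tr , q′ with genus-natural 1≤n γ a g tr
      ...     | h , eh = ≈-trans (∑-delta gs (λ h → b₁ h ∧ inSNC n h ζ α) h (Uniq.upTo⁺ _) (∈-upTo⁺ (s≤s (proj₁ gh)))
                (λ {h′} _ q″ → *-cancelˡ-≡ h′ h 2 (+-cancelˡ-≡ (blocks α + numCycles n γ) _ _
                  (trans (proj₂ (proj₂ (split {h′} {α} q″))) (sym eh))))
                (⇐ (T-∧ {b₁ h}) (≡⇒≡ᵇ (length ζ) _ (trans (sym eℓ) (proj₂ gh)) , ⇐ T-∧ (tr , ≡⇒≡ᵇ _ (n + 2) eh))))
                (≈-sym (when-true q))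
        where
        gh : h ≤ ⌊ k /2⌋ × numCycles n γ ≡ k + 1 ∸ 2 * h
        gh = euler-genus k<n (subst (1 ≤_) (sym eℓ) ℓ≥1) (≡ᵇ⇒≡ (blocks α) _ q′) eh

    H-code : ∀ {c ζ} → c ∈ codes n → sizes c ↭ ζ → H (code-list n c) ≈ X ζ
    H-code {c} {ζ} m p with codes⇒ n m
    ... | ic , refl with gamma-conj ic p
    ... | w , w↭ , conj = ≈-trans (≈-sym (H-conj (gamma ζ) (code-list n c) d g pc conj′)) (H-genus ζ g #γ ℓ≥1)
      where
      d : IsPerm n (nth w)
      d = ↭⇒isPerm w↭
      pc = code-isPerm n m
      sumζ : sum ζ ≡ n
      sumζ = trans (sym (sum-↭ p)) (sum-sizes ic)
      g : IsPerm n (nth (gamma ζ))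
      g = ↭⇒isPerm (subst (λ k → gamma ζ ↭ upTo k) sumζ (gamma-↭ ζ))
      conj′ : Conj n (nth w) (nth (gamma ζ)) (nth (code-list n c))
      conj′ h = trans (nth-tab n (perm c) (π< d h)) (conj h)
      -- The cycles of γ_ζ are counted on the conjugate permutation of the code, where the sizes are
      -- known.
      #γ : numCycles n (gamma ζ) ≡ length ζ
      #γ = trans (↭-length (conj-sizes {α = gamma ζ} {α′ = code-list n c} d g pc conj′))
        (trans (sym (↭-length (code-sizes n m))) (trans (cong (numBlocks n) (labels-tab c)) (trans (cls-labels ic) (↭-length p))))
      ℓ≥1 : 1 ≤ length ζ
      ℓ≥1 = nonempty ζ sumζ
        where
        nonempty : ∀ ζ → sum ζ ≡ n → 1 ≤ length ζ
        nonempty [] e = ⊥-elim (<⇒≢ 1≤n e)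
        nonempty (x ∷ ζ) e = s≤s z≤n

    -- Among the integer partitions exactly one has the type of `c`, the sorted list of its sizes,
    -- so the sum on the right has one term.
    by-type : ∀ {c} → c ∈ codes n → H (code-list n c) ≈ ∑ (intPartitions n) (λ ζ → when (same (sizes c) ζ) (X ζ))
    by-type {c} m with codes⇒ n m
    ... | ic , refl = ≈-sym (≈-trans (∑-delta (intPartitions n) (same (sizes c)) ζ₀ (ipf-unique n n n) ζ₀∈
        (λ {ζ} ζ∈ q → sorted-unique (partition-sorted (proj₁ (∈ipf⇒ n n n ζ∈))) (sort-↗ (sizes c))
          (↭-trans (↭-sym (⇒ (same⇔ (sizes c) ζ) q)) (↭-sym (sort-↭ (sizes c)))))
        (⇐ (same⇔ (sizes c) ζ₀) (↭-sym (sort-↭ (sizes c)))))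
        (≈-sym (H-code m (↭-sym (sort-↭ (sizes c))))))
      where
      ζ₀ = sort (sizes c)
      sumζ₀ : sum ζ₀ ≡ n
      sumζ₀ = trans (sum-↭ (sort-↭ (sizes c))) (sum-sizes ic)
      ζ₀∈ : ζ₀ ∈ intPartitions n
      ζ₀∈ = subst (λ s → ζ₀ ∈ ipf n s n) sumζ₀ (⇒∈ipf n (sorted-partition (sort-↗ (sizes c))
        (All-resp-↭ (↭-sym (sort-↭ (sizes c))) (sizes-positive ic)) (λ x∈ → subst (_ ≤_) sumζ₀ (∈⇒≤sum x∈))) (≤-reflexive sumζ₀))

    classes : inv′ ((n ∸ 1) !) ⊛ ∑ (S n) H ≈ ∑ (intPartitions n) (λ ζ → coef n ζ ⊛ X ζ)
    classes = begin
      inv′ ((n ∸ 1) !) ⊛ ∑ (S n) H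
        ≈⟨ R.*-congˡ (≈-trans (∑-S-codes n) (∑-cong (codes n) by-type)) ⟩
      inv′ ((n ∸ 1) !) ⊛ ∑ (codes n) (λ c → ∑ (intPartitions n) (λ ζ → when (same (sizes c) ζ) (X ζ)))
        ≈⟨ R.*-congˡ (≈-trans (∑-swap (codes n) (intPartitions n)) (∑-cong (intPartitions n) (λ {ζ} _ →
             ≈-trans (∑-cong (codes n) (λ {c} _ → one (same (sizes c) ζ))) (∑-*ʳ (codes n) (X ζ))))) ⟩
      inv′ ((n ∸ 1) !) ⊛ ∑ (intPartitions n) (λ ζ → N n ζ ⊛ X ζ)
        ≈⟨ ≈-sym (∑-*ˡ (intPartitions n) _) ⟩
      ∑ (intPartitions n) (λ ζ → inv′ ((n ∸ 1) !) ⊛ (N n ζ ⊛ X ζ))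
        ≈⟨ ∑-cong (intPartitions n) (λ {ζ} ζ∈ → ≈-trans (≈-sym (R.*-assoc _ _ _)) (R.*-congʳ (let (d , e) = ∈ipf⇒ n n n ζ∈ in
             coef-N n ζ 1≤n (partition-positive d) e))) ⟩
      ∑ (intPartitions n) (λ ζ → coef n ζ ⊛ X ζ) ∎
      where
      one : ∀ b {x} → when b x ≈ when b 1# ⊛ x
      one true = ≈-sym (R.*-identityˡ _)
      one false = ≈-sym (R.zeroˡ _)

    by-genus : sumR (map (s u v n k) (upTo (suc ⌊ k /2⌋))) ≈ ∑ (intPartitions n) (λ ζ → coef n ζ ⊛ X ζ)
    by-genus = begin
      ∑ gs (s u v n k)
        ≈⟨ ∑-cong gs (λ {g} _ → ≈-trans (∑-filter (λ ζ → length ζ ≡ᵇ (k + 1 ∸ 2 * g)) (intPartitions n))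
             (∑-cong (intPartitions n) (λ {ζ} _ → ≈-trans (when-cong {b = length ζ ≡ᵇ (k + 1 ∸ 2 * g)} refl
               (λ _ → R.*-congˡ (∑-filter (inSNC n g ζ) (S n)))) (≈-sym (when-*ˡ (length ζ ≡ᵇ (k + 1 ∸ 2 * g))))))) ⟩
      ∑ gs (λ g → ∑ (intPartitions n) (λ ζ → coef n ζ ⊛ when (length ζ ≡ᵇ (k + 1 ∸ 2 * g))
        (∑ (S n) (λ α → when (inSNC n g ζ α) (uPerm u n α ⊛ uPerm v n (invComp n α (gamma ζ)))))))
        ≈⟨ ≈-trans (∑-swap gs (intPartitions n)) (∑-cong (intPartitions n) (λ {ζ} _ → ∑-*ˡ gs (coef n ζ))) ⟩
      ∑ (intPartitions n) (λ ζ → coef n ζ ⊛ X ζ) ∎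
      where gs = upTo (suc ⌊ k /2⌋)

    theorem : LHS u v n k ≈ RHS u v n k
    theorem = begin
      (sgn (n ∸ 1) ⊛ inv′ ((n ∸ 1) !)) ⊛ _
        ≈⟨ R.*-congˡ (≈-trans partitions-to-permutations (R.*-congˡ factor)) ⟩
      (sgn (n ∸ 1) ⊛ inv′ ((n ∸ 1) !)) ⊛ ((sgn (n ∸ 1) ⊛ sgn k) ⊛ ∑ (S n) H)
        ≈⟨ interchange _ _ _ _ ⟩
      (sgn (n ∸ 1) ⊛ (sgn (n ∸ 1) ⊛ sgn k)) ⊛ (inv′ ((n ∸ 1) !) ⊛ ∑ (S n) H)
        -- The sign (-1)^{n-1} of the prefactor meets the same sign from the Möbius values, and
        -- (-1)^k remains.
        ≈⟨ R.*-cong (≈-trans (≈-sym (R.*-assoc _ _ _)) (≈-trans (R.*-congʳ (sgn-square (n ∸ 1))) (R.*-identityˡ _)))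
             (≈-trans classes (≈-sym by-genus)) ⟩
      RHS u v n k ∎

theorem4p3 : {c ℓ : Level} (R : CommutativeRing c ℓ)
    (inv : ℕ → CommutativeRing.Carrier R) →
    ((m : ℕ) → CommutativeRing._≈_ R (CommutativeRing._*_ R (Formula.ι R inv (suc m)) (inv (suc m))) (CommutativeRing.1# R)) →
    (u v : ℕ → CommutativeRing.Carrier R) (n k : ℕ) → 1 ≤ n → k < n →
    CommutativeRing._≈_ R (Formula.LHS R inv u v n k) (Formula.RHS R inv u v n k)
theorem4p3 R inv invertible u v n k 1≤n k<n = Main.theorem R inv invertible u v n k 1≤n k<n
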